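{- Let $\mathbb{K}$ be a field of characteristic zero and let $G$ be a simple graph on the vertex set $\{0,1,\dots,n\}$. Then $\mathcal{D}^T_G$ and $\mathcal{K}^T_G$ are isomorphic as filtered algebras.
   Context: $\Phi^T_G$ is the commutative $\mathbb{K}$-algebra generated by $\phi_e$ ($e$ an edge of $G$) with relations $\phi_e^2=0$ for every edge $e$, and $\prod_{e\in H}\phi_e=0$ for every non-slim set of edges $H$, where $H$ is slim if the graph on all vertices with edge set $E(G)\setminus H$ is connected. For a vertex $i$ and edge $e$: $c_{i,e}=1$ if $e$ joins $i$ to $j$ with $i<j$, $c_{i,e}=-1$ if $e$ joins $i$ to $j$ with $i>j$, $c_{i,e}=0$ otherwise. $Y^T_i=\prod_e(1+c_{i,e}\phi_e)\in\Phi^T_G$, $i=0,\dots,n$; $\mathcal{K}^T_G$ is the subalgebra generated by $1,Y^T_0,\dots,Y^T_n$, filtered with $k$-th piece the span of products of at most $k$ of the $Y^T_i$ (empty product $1$). For a vertex set $I$, $D_I$ is the number of edges with exactly one endpoint in $I$. $\mathcal{D}^T_G=\mathbb{K}[y_0,\dots,y_n]/\mathcal{I}^T_G$ where $\mathcal{I}^T_G$ is generated by $\left(\prod_{i\in I}y_i-1\right)^{D_I}$ for all nonempty proper $I\subsetneq\{0,\dots,n\}$ together with $\prod_{i=0}^n y_i-1$; its filtration has $k$-th piece the image of polynomials of total degree at most $k$. A filtered isomorphism is an algebra isomorphism mapping the $k$-th piece onto the $k$-th piece for all $k$. -}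

module Defs where

open import Level using (Level; _⊔_)
open import Algebra.Bundles using (CommutativeRing)
open import Data.Nat as ℕ using (ℕ; zero; suc; _≤_; _<_)
open import Data.Bool using (Bool; true; false; if_then_else_; _xor_)
open import Data.Fin as Fin using (Fin; zero; suc)
open import Data.Vec as Vec using (Vec; []; _∷_; lookup; tabulate)
import Data.Vec.Properties as VecP
import Data.Nat.ListAction as NL
open import Data.List as List using (List; []; _∷_; _++_; allFin)
open import Data.List.Relation.Unary.All using (All)
open import Data.Product using (Σ; ∃; _×_; _,_; proj₁; proj₂)
open import Data.Sum using (_⊎_)
open import Relation.Nullary using (¬_; does)
open import Relation.Binary.PropositionalEquality using (_≡_; _≢_)
open import Data.Fin.Subset using (Subset; Nonempty; ⊤)

module _ {c ℓ : Level} (R : CommutativeRing c ℓ) where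
  open CommutativeRing R hiding (zero)

  IsField : Set (c ⊔ ℓ)
  IsField = (¬ (1# ≈ 0#)) × (∀ x → ¬ (x ≈ 0#) → ∃ λ y → (x * y) ≈ 1#)

  fromℕ : ℕ → Carrier
  fromℕ zero = 0#
  fromℕ (suc k) = 1# + fromℕ k

  CharZero : Set ℓ
  CharZero = ∀ k → fromℕ k ≈ 0# → k ≡ 0

-- Multivariate polynomials over a commutative ring R in variables Fin m.
-- A polynomial is a finite list of terms (coefficient, exponent vector);
-- two polynomials are equal when all their coefficients agree.

module Poly {c ℓ : Level} (R : CommutativeRing c ℓ) where
  open CommutativeRing R hiding (zero)

  Mono : ℕ → Set
  Mono m = Vec ℕ m

  Pol : ℕ → Set c
  Pol m = List (Carrier × Mono m)

  coeff : ∀ {m} → Pol m → Mono m → Carrier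
  coeff [] α = 0#
  coeff ((a , β) ∷ p) α =
    if does (VecP.≡-dec ℕ._≟_ β α) then a + coeff p α else coeff p α

  _≈ₚ_ : ∀ {m} → Pol m → Pol m → Set ℓ
  p ≈ₚ q = ∀ α → coeff p α ≈ coeff q α

  zeroMono : ∀ {m} → Mono m
  zeroMono = Vec.replicate _ 0

  con : ∀ {m} → Carrier → Pol m
  con a = (a , zeroMono) ∷ []

  oneP : ∀ {m} → Pol m
  oneP = con 1#

  monoP : ∀ {m} → Mono m → Pol m
  monoP α = (1# , α) ∷ []

  var : ∀ {m} → Fin m → Pol m
  var i = monoP (tabulate λ j → if does (i Fin.≟ j) then 1 else 0)

  _+ₚ_ : ∀ {m} → Pol m → Pol m → Pol m
  p +ₚ q = p ++ q

  -ₚ_ : ∀ {m} → Pol m → Pol m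
  -ₚ p = List.map (λ t → (- proj₁ t , proj₂ t)) p

  _-ₚ_ : ∀ {m} → Pol m → Pol m → Pol m
  p -ₚ q = p +ₚ (-ₚ q)

  _*ₚ_ : ∀ {m} → Pol m → Pol m → Pol m
  p *ₚ q = List.concatMap
    (λ s → List.map (λ t → (proj₁ s * proj₁ t , Vec.zipWith ℕ._+_ (proj₂ s) (proj₂ t))) q) p

  powP : ∀ {m} → Pol m → ℕ → Pol m
  powP p zero = oneP
  powP p (suc k) = p *ₚ powP p k

  prodP : ∀ {m} → List (Pol m) → Pol m
  prodP = List.foldr _*ₚ_ oneP

  sumP : ∀ {m} → List (Pol m) → Pol m
  sumP = List.foldr _+ₚ_ []

  degM : ∀ {m} → Mono m → ℕ
  degM = Vec.sum

  DegLe : ∀ {m} → ℕ → Pol m → Set c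
  DegLe k p = All (λ t → degM (proj₂ t) ≤ k) p

  evalMono : ∀ {m m'} → Mono m' → (Fin m' → Pol m) → Pol m
  evalMono [] v = oneP
  evalMono (a ∷ α) v = powP (v Fin.zero) a *ₚ evalMono α (λ j → v (Fin.suc j))

  subst : ∀ {m m'} → Pol m' → (Fin m' → Pol m) → Pol m
  subst P v = sumP (List.map (λ t → con (proj₁ t) *ₚ evalMono (proj₂ t) v) P)

  InIdeal : ∀ {m} → (Pol m → Set c) → Pol m → Set (c ⊔ ℓ)
  InIdeal Gen p = Σ (List (Pol _ × Pol _)) λ rs →
    All (λ rg → Gen (proj₂ rg)) rs ×
    (p ≈ₚ sumP (List.map (λ rg → proj₁ rg *ₚ proj₂ rg) rs))

  ModIdeal : ∀ {m} → (Pol m → Set c) → Pol m → Pol m → Set (c ⊔ ℓ)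
  ModIdeal Gen p q = InIdeal Gen (p -ₚ q)

record SimpleGraph (n : ℕ) : Set where
  field
    m     : ℕ
    lo    : Fin m → Fin (suc n)
    hi    : Fin m → Fin (suc n)
    lo<hi : ∀ e → lo e Fin.< hi e
    noMulti : ∀ e f → lo e ≡ lo f → hi e ≡ hi f → e ≡ f

module _ {n : ℕ} (G : SimpleGraph n) where
  open SimpleGraph G

  data Reach (H : Subset m) (u : Fin (suc n)) : Fin (suc n) → Set where
    here : Reach H u u
    stepʳ : ∀ e → lookup H e ≡ false → Reach H u (lo e) → Reach H u (hi e)
    stepˡ : ∀ e → lookup H e ≡ false → Reach H u (hi e) → Reach H u (lo e)

  Slim : Subset m → Set
  Slim H = ∀ u v → Reach H u v

  cut : Subset (suc n) → ℕ
  cut I = NL.sum (List.map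
    (λ e → if lookup I (lo e) xor lookup I (hi e) then 1 else 0) (allFin m))

module Alg {c ℓ : Level} (K : CommutativeRing c ℓ) {n : ℕ} (G : SimpleGraph n) where
  open CommutativeRing K hiding (zero)
  open Poly K public
  open SimpleGraph G

  indicator : ∀ {k} → Subset k → Mono k
  indicator = Vec.map (λ b → if b then 1 else 0)

  ΦGen : Pol m → Set c
  ΦGen p = (∃ λ e → p ≡ var e *ₚ var e)
         ⊎ (∃ λ (H : Subset m) → ¬ Slim G H × p ≡ monoP (indicator H))

  _≈Φ_ : Pol m → Pol m → Set (c ⊔ ℓ)
  _≈Φ_ = ModIdeal ΦGen

  cie : Fin (suc n) → Fin m → Carrier
  cie i e = if does (lo e Fin.≟ i) then 1#
            else (if does (hi e Fin.≟ i) then - 1# else 0#)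

  Y : Fin (suc n) → Pol m
  Y i = prodP (List.map (λ e → oneP +ₚ (con (cie i e) *ₚ var e)) (allFin m))

  -- k-th filtered piece of K^T_G (as a subset of Φ^T_G):
  -- classes of P(Y_0,…,Y_n) with P of total degree ≤ k
  InKF : ℕ → Pol m → Set (c ⊔ ℓ)
  InKF k x = Σ (Pol (suc n)) λ P → DegLe k P × (x ≈Φ subst P Y)

  InK : Pol m → Set (c ⊔ ℓ)
  InK x = Σ (Pol (suc n)) λ P → x ≈Φ subst P Y

  DGen : Pol (suc n) → Set c
  DGen p = (∃ λ (I : Subset (suc n)) → Nonempty I × I ≢ ⊤ ×
              p ≡ powP (monoP (indicator I) -ₚ oneP) (cut G I))
         ⊎ (p ≡ monoP (indicator {suc n} ⊤) -ₚ oneP)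

  _≈D_ : Pol (suc n) → Pol (suc n) → Set (c ⊔ ℓ)
  _≈D_ = ModIdeal DGen

  InDF : ℕ → Pol (suc n) → Set (c ⊔ ℓ)
  InDF k p = Σ (Pol (suc n)) λ q → DegLe k q × (p ≈D q)

  -- A filtered K-algebra isomorphism D^T_G → K^T_G, given on representatives
  record FilteredIso : Set (c ⊔ ℓ) where
    field
      f        : Pol (suc n) → Pol m
      wellDef  : ∀ p q → p ≈D q → f p ≈Φ f q
      into     : ∀ p → InK (f p)
      pres-+   : ∀ p q → f (p +ₚ q) ≈Φ (f p +ₚ f q)
      pres-*   : ∀ p q → f (p *ₚ q) ≈Φ (f p *ₚ f q)
      pres-con : ∀ a → f (con a) ≈Φ con a
      inj      : ∀ p q → f p ≈Φ f q → p ≈D q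
      surj     : ∀ x → InK x → ∃ λ p → f p ≈Φ x
      filt     : ∀ k p → InDF k p → InKF k (f p)
      filt-onto : ∀ k x → InKF k x → ∃ λ p → InDF k p × (f p ≈Φ x)

  FilteredIsomorphic : Set (c ⊔ ℓ)
  FilteredIsomorphic = FilteredIso

{-# OPTIONS --safe #-}

-- Since φ_e² = 0, each factor 1 + c_{i,e} φ_e is exp(c_{i,e} φ_e), so Y_i = exp X_i with
-- X_i = Σ_e c_{i,e} φ_e; and y_i − 1 is nilpotent in D, so y_i = exp l_i there. Substituting
-- exponentials reduces the theorem to the additive statement of Postnikov and Shapiro: the kernel
-- of K[x] → Φ, x_i ↦ X_i, is the ideal J generated by the (Σ_{i∈I} x_i)^{D_I} and Σ_i x_i.
-- A polynomial p is in this kernel iff the products of the derivations δ_e = ∂_lo(e) − ∂_hi(e) over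
-- slim sets of edges kill p at the origin. That such a p lies in J follows by deletion–contraction,
-- without counting dimensions: by induction δ_e p lies in the ideal of G ∖ e; integration by parts
-- lifts it to some p′ ∈ J with δ_e p′ = δ_e p; and p − p′ is a polynomial of the contraction G / e.

module Submission where

open import Defs
open import Level using (Level; _⊔_; Lift; lift; lower)
open import Data.Nat as ℕ using (ℕ; zero; suc; _≤_; _<_; z≤n; s≤s)
open import Algebra.Bundles using (CommutativeRing; Monoid; RawRing)
import Algebra.Properties.AbelianGroup
import Algebra.Properties.CommutativeMonoid.Sum
import Algebra.Properties.CommutativeSemigroup
import Algebra.Properties.CommutativeSemiring.Exp
import Algebra.Properties.Monoid.Sum
import Algebra.Properties.Ring
import Algebra.Properties.Semiring.Exp
import Algebra.Properties.Semiring.Mult.TCOptimised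
import Algebra.Properties.Semiring.Sum
import Algebra.Solver.Ring
import Algebra.Solver.Ring.AlmostCommutativeRing as ACR
open import Data.Bool as Bool using (Bool; true; false; if_then_else_; _xor_; _∨_)
open import Data.Bool.Properties using (∨-assoc; ∨-comm)
open import Data.Empty using (⊥-elim)
open import Data.Fin as Fin using (Fin; zero; suc)
import Data.Fin.Properties as FinP
open import Data.Fin.Subset using (Subset; Nonempty; ⊤)
open import Data.List as List using (List; []; _∷_; _++_; allFin)
open import Data.List.Membership.Propositional using (_∈_; _∉_)
import Data.List.Properties as ListP
open import Data.List.Relation.Unary.All as All using (All; []; _∷_)
import Data.List.Relation.Unary.All.Properties as AllP
open import Data.List.Relation.Unary.AllPairs using (_∷_)
open import Data.List.Relation.Unary.Any using (here; there)
open import Data.List.Relation.Unary.Unique.Propositional using (Unique)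
import Data.List.Relation.Unary.Unique.Propositional.Properties as UniqueP
open import Data.Maybe using (Maybe; just; nothing)
import Data.Nat.ListAction as NL
import Data.Nat.Properties as ℕP
open import Data.Product using (Σ; ∃; _×_; _,_; proj₁; proj₂)
open import Data.Sum as Sum using (_⊎_; inj₁; inj₂)
open import Data.Vec as Vec using (Vec; []; _∷_; lookup; tabulate)
import Data.Vec.Properties as VecP
open import Function using (_∘_)
import Relation.Binary.Reasoning.Setoid
open import Relation.Binary.PropositionalEquality as ≡ using (_≡_; _≢_)
open import Relation.Nullary using (¬_; Dec; does; yes; no; ¬?)

-- Because the isomorphism is induced by y_i ↦ Y_i, both filtrations come from the degree of a
-- representing polynomial and agree at once; all the work lies in showing that the kernel is
-- exactly the ideal of D.
--
-- Contraction is never performed on the graph. Edges are split into a list `L`, still to be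
-- treated, and a list `C`, already contracted, and the polynomials of the contraction are those
-- killed by every δ_e with e in `C`. All ideals thus live in one polynomial ring, and the induction
-- runs over `L` alone.
--
-- Deleting a bridge is not an exception. A disconnected graph has a proper vertex set with D_I = 0,
-- whose generator is 1, while its vanishing condition is empty because no subset of its edges is
-- connected. The case that does need care is an edge that has become a loop of the contraction: no
-- linear form separates its ends, so nothing can be integrated, but δ_e then already kills p and
-- contraction alone suffices.
--
-- Characteristic zero enters through the inverses of the positive integers: in exponentials, in
-- integration, and in recovering a polynomial from its derivatives and its constant term.

-- A ring solver with integer coefficients; an integer a − b is the pair (a , b), kept reduced
-- so that equal normal forms are identical.
module IntegerSolver {c ℓ : Level} (R : CommutativeRing c ℓ) where
  open CommutativeRing R hiding (zero)
  open import Algebra.Properties.Ring ring using (x[y-z]≈xy-xz; [y-z]x≈yx-zx; -0#≈0#)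
  open import Algebra.Properties.AbelianGroup +-abelianGroup using (⁻¹-∙-comm; ⁻¹-involutive)
  open import Algebra.Properties.CommutativeSemigroup +-commutativeSemigroup using (interchange)
  open import Algebra.Properties.Semiring.Mult.TCOptimised semiring using (×-homo-+; ×1-homo-*) renaming (_×_ to _·_)
  open import Relation.Binary.Reasoning.Setoid setoid

  private
    reduce : ℕ → ℕ → ℕ × ℕ
    reduce (suc a) (suc b) = reduce a b
    reduce a       b       = a , b

    coefficients : RawRing _ _
    coefficients = record
      { Carrier = ℕ × ℕ
      ; _≈_     = _≡_
      ; _+_     = λ { (a , b) (c , d) → reduce (a ℕ.+ c) (b ℕ.+ d) }
      ; _*_     = λ { (a , b) (c , d) → reduce (a ℕ.* c ℕ.+ b ℕ.* d) (a ℕ.* d ℕ.+ b ℕ.* c) }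
      ; -_      = λ { (a , b) → b , a }
      ; 0#      = 0 , 0
      ; 1#      = 1 , 0
      }

    val : ℕ × ℕ → Carrier
    val (a , zero)  = a · 1#
    val (a , suc b) = a · 1# - suc b · 1#

    val-difference : ∀ a b → val (a , b) ≈ a · 1# - b · 1#
    val-difference a zero    = sym (trans (+-congˡ -0#≈0#) (+-identityʳ _))
    val-difference a (suc b) = refl

    difference-+ : ∀ a b c d → (a + c) - (b + d) ≈ (a - b) + (c - d)
    difference-+ a b c d = begin
      (a + c) + - (b + d)     ≈⟨ +-congˡ (⁻¹-∙-comm b d) ⟨
      (a + c) + (- b + - d)   ≈⟨ interchange a c (- b) (- d) ⟩
      (a - b) + (c - d)       ∎

    difference-cancel : ∀ x y z → (x + z) - (y + z) ≈ x - y
    difference-cancel x y z = begin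
      (x + z) - (y + z)     ≈⟨ difference-+ x y z z ⟩
      (x - y) + (z - z)     ≈⟨ +-congˡ (-‿inverseʳ z) ⟩
      (x - y) + 0#          ≈⟨ +-identityʳ _ ⟩
      x - y                 ∎

    val-reduce : ∀ a b → val (reduce a b) ≈ a · 1# - b · 1#
    val-reduce zero    b       = val-difference zero b
    val-reduce (suc a) zero    = val-difference (suc a) zero
    val-reduce (suc a) (suc b) = begin
      val (reduce a b)                ≈⟨ val-reduce a b ⟩
      a · 1# - b · 1#                 ≈⟨ difference-cancel (a · 1#) (b · 1#) 1# ⟨
      (a · 1# + 1#) - (b · 1# + 1#)   ≈⟨ +-cong (·-suc a) (-‿cong (·-suc b)) ⟩
      suc a · 1# - suc b · 1#         ∎
      where
      ·-suc : ∀ k → k · 1# + 1# ≈ suc k · 1#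
      ·-suc k = trans (+-comm _ _) (sym (×-homo-+ 1# 1 k))

    difference-neg : ∀ a b → - (a - b) ≈ b - a
    difference-neg a b = begin
      - (a + - b)     ≈⟨ ⁻¹-∙-comm a (- b) ⟨
      - a + - (- b)   ≈⟨ +-congˡ (⁻¹-involutive b) ⟩
      - a + b         ≈⟨ +-comm (- a) b ⟩
      b - a           ∎

    difference-* : ∀ a b c d → (a * c + b * d) - (a * d + b * c) ≈ (a - b) * (c - d)
    difference-* a b c d = begin
      (a * c + b * d) - (a * d + b * c)     ≈⟨ difference-+ _ _ _ _ ⟩
      (a * c - a * d) + (b * d - b * c)     ≈⟨ +-congˡ (difference-neg _ _) ⟨
      (a * c - a * d) - (b * c - b * d)     ≈⟨ +-cong (x[y-z]≈xy-xz a c d) (-‿cong (x[y-z]≈xy-xz b c d)) ⟨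
      a * (c - d) - b * (c - d)             ≈⟨ [y-z]x≈yx-zx (c - d) a b ⟨
      (a - b) * (c - d)                     ∎

    morphism : coefficients ACR.-Raw-AlmostCommutative⟶ ACR.fromCommutativeRing R
    morphism = record
      { ⟦_⟧    = val
      ; +-homo = λ { (a , b) (c , d) → begin
          val (reduce (a ℕ.+ c) (b ℕ.+ d))               ≈⟨ val-reduce (a ℕ.+ c) (b ℕ.+ d) ⟩
          (a ℕ.+ c) · 1# - (b ℕ.+ d) · 1#               ≈⟨ +-cong (×-homo-+ 1# a c) (-‿cong (×-homo-+ 1# b d)) ⟩
          (a · 1# + c · 1#) - (b · 1# + d · 1#)         ≈⟨ difference-+ _ _ _ _ ⟩
          (a · 1# - b · 1#) + (c · 1# - d · 1#)         ≈⟨ +-cong (val-difference a b) (val-difference c d) ⟨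
          val (a , b) + val (c , d)                     ∎ }
      ; *-homo = λ { (a , b) (c , d) → begin
          val (reduce (a ℕ.* c ℕ.+ b ℕ.* d) (a ℕ.* d ℕ.+ b ℕ.* c))
            ≈⟨ val-reduce (a ℕ.* c ℕ.+ b ℕ.* d) (a ℕ.* d ℕ.+ b ℕ.* c) ⟩
          (a ℕ.* c ℕ.+ b ℕ.* d) · 1# - (a ℕ.* d ℕ.+ b ℕ.* c) · 1#
            ≈⟨ +-cong (product-sum a c b d) (-‿cong (product-sum a d b c)) ⟩
          (a · 1# * c · 1# + b · 1# * d · 1#) - (a · 1# * d · 1# + b · 1# * c · 1#)
            ≈⟨ difference-* _ _ _ _ ⟩
          (a · 1# - b · 1#) * (c · 1# - d · 1#)
            ≈⟨ *-cong (val-difference a b) (val-difference c d) ⟨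
          val (a , b) * val (c , d) ∎ }
      ; -‿homo = λ { (a , b) → begin
          val (b , a)             ≈⟨ val-difference b a ⟩
          b · 1# - a · 1#         ≈⟨ difference-neg _ _ ⟨
          - (a · 1# - b · 1#)     ≈⟨ -‿cong (val-difference a b) ⟨
          - val (a , b)           ∎ }
      ; 0-homo = refl
      ; 1-homo = refl
      }
      where
      product-sum : ∀ a b c d → (a ℕ.* b ℕ.+ c ℕ.* d) · 1# ≈ a · 1# * b · 1# + c · 1# * d · 1#
      product-sum a b c d = trans (×-homo-+ 1# (a ℕ.* b) (c ℕ.* d)) (+-cong (×1-homo-* a b) (×1-homo-* c d))

    equal? : ∀ x y → Maybe (val x ≈ val y)
    equal? (a , b) (c , d) with a ℕ.+ d ℕ.≟ c ℕ.+ b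
    ... | no _  = nothing
    ... | yes q = just (begin
        val (a , b)                         ≈⟨ val-difference a b ⟩
        a · 1# - b · 1#                     ≈⟨ difference-cancel (a · 1#) (b · 1#) (d · 1#) ⟨
        (a · 1# + d · 1#) - (b · 1# + d · 1#)
          ≈⟨ +-congʳ (trans (sym (×-homo-+ 1# a d)) (trans (reflexive (≡.cong (_· 1#) q)) (×-homo-+ 1# c b))) ⟩
        (c · 1# + b · 1#) - (b · 1# + d · 1#)   ≈⟨ +-congˡ (-‿cong (+-comm _ _)) ⟩
        (c · 1# + b · 1#) - (d · 1# + b · 1#)   ≈⟨ difference-cancel (c · 1#) (d · 1#) (b · 1#) ⟩
        c · 1# - d · 1#                     ≈⟨ val-difference c d ⟨
        val (c , d)                         ∎)

  open Algebra.Solver.Ring coefficients (ACR.fromCommutativeRing R) morphism equal? public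
    using (solve; _:=_; _:+_; _:*_; _:-_; :-_; con; Polynomial)

  :1 : ∀ {n} → Polynomial n
  :1 = con (1 , 0)

  :0 : ∀ {n} → Polynomial n
  :0 = con (0 , 0)

-- Exponentials and logarithms of nilpotent elements

module Exponential {c ℓ : Level} (R : CommutativeRing c ℓ)
  (inv : ℕ → CommutativeRing.Carrier R)
  (inv-inverse : ∀ k → CommutativeRing._≈_ R (CommutativeRing._*_ R (fromℕ R (suc k)) (inv k)) (CommutativeRing.1# R))
  where
  open CommutativeRing R hiding (zero)
  open IntegerSolver R
  open import Algebra.Properties.Semiring.Exp semiring using (_^_; ^-homo-*)
  open import Algebra.Properties.Monoid.Sum +-monoid using (sum)
  open import Algebra.Properties.Monoid.Sum *-monoid using () renaming (sum to product)
  open import Relation.Binary.Reasoning.Setoid setoid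

  -- This is a^k / k!, since `inv k` is the inverse of k + 1.
  divided-power : Carrier → ℕ → Carrier
  divided-power a zero    = 1#
  divided-power a (suc k) = inv k * (a * divided-power a k)

  sum< : ℕ → (ℕ → Carrier) → Carrier
  sum< zero    f = 0#
  sum< (suc N) f = f 0 + sum< N (f ∘ suc)

  exp< : ℕ → Carrier → Carrier
  exp< N a = sum< N (divided-power a)

  VanishesFrom : ℕ → (ℕ → Carrier) → Set ℓ
  VanishesFrom N f = ∀ k → N ≤ k → f k ≈ 0#

  -- A relation and not a function, since the series is finite only where the divided powers
  -- eventually vanish. The bound is part of the data so that bounds can be added and compared; any
  -- larger truncation gives the same sum.
  IsExp : Carrier → Carrier → Set ℓ
  IsExp a u = Σ ℕ λ N → VanishesFrom N (divided-power a) × u ≈ exp< N a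

  divided-power-cong : ∀ {a b} → a ≈ b → ∀ k → divided-power a k ≈ divided-power b k
  divided-power-cong a≈b zero    = refl
  divided-power-cong a≈b (suc k) = *-congˡ (*-cong a≈b (divided-power-cong a≈b k))

  sum<-cong : ∀ N {f g} → (∀ k → f k ≈ g k) → sum< N f ≈ sum< N g
  sum<-cong zero    h = refl
  sum<-cong (suc N) h = +-cong (h 0) (sum<-cong N (h ∘ suc))

  sum<-+ : ∀ N f g → sum< N (λ k → f k + g k) ≈ sum< N f + sum< N g
  sum<-+ zero    f g = sym (+-identityʳ 0#)
  sum<-+ (suc N) f g = begin
    (f 0 + g 0) + sum< N (λ k → f (suc k) + g (suc k))     ≈⟨ +-congˡ (sum<-+ N _ _) ⟩
    (f 0 + g 0) + (sum< N (f ∘ suc) + sum< N (g ∘ suc))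
      ≈⟨ solve 4 (λ a b c d → (a :+ b) :+ (c :+ d) := (a :+ c) :+ (b :+ d)) refl _ _ _ _ ⟩
    (f 0 + sum< N (f ∘ suc)) + (g 0 + sum< N (g ∘ suc))    ∎

  sum<-*ˡ : ∀ N a f → sum< N (λ k → a * f k) ≈ a * sum< N f
  sum<-*ˡ zero    a f = sym (zeroʳ a)
  sum<-*ˡ (suc N) a f = trans (+-congˡ (sum<-*ˡ N a _)) (sym (distribˡ _ _ _))

  sum<-stable : ∀ {N M f} → N ≤ M → VanishesFrom N f → sum< M f ≈ sum< N f
  sum<-stable {zero}  {zero}  z≤n h = refl
  sum<-stable {zero}  {suc M} {f} z≤n h =
    trans (+-cong (h 0 z≤n) (sum<-stable {zero} {M} {f ∘ suc} z≤n (λ k _ → h (suc k) z≤n))) (+-identityʳ 0#)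
  sum<-stable {suc N} {suc M} (s≤s N≤M) h = +-congˡ (sum<-stable N≤M (λ k N≤k → h (suc k) (s≤s N≤k)))

  -- Sequences stand for the coefficients of power series in a formal variable t, and this is the
  -- Cauchy product. Shifting `f` at each step avoids subtraction of indices.
  convolution : (ℕ → Carrier) → (ℕ → Carrier) → ℕ → Carrier
  convolution f g zero    = f 0 * g 0
  convolution f g (suc k) = f 0 * g (suc k) + convolution (f ∘ suc) g k

  convolution-cong : ∀ {f f′ g g′} → (∀ k → f k ≈ f′ k) → (∀ k → g k ≈ g′ k) →
    ∀ k → convolution f g k ≈ convolution f′ g′ k
  convolution-cong hf hg zero    = *-cong (hf 0) (hg 0)
  convolution-cong hf hg (suc k) =
    +-cong (*-cong (hf 0) (hg (suc k))) (convolution-cong (hf ∘ suc) hg k)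

  convolution-+ : ∀ f f′ g k → convolution (λ i → f i + f′ i) g k ≈ convolution f g k + convolution f′ g k
  convolution-+ f f′ g zero    = distribʳ _ _ _
  convolution-+ f f′ g (suc k) = begin
    (f 0 + f′ 0) * g (suc k) + convolution (λ i → f (suc i) + f′ (suc i)) g k
      ≈⟨ +-congˡ (convolution-+ (f ∘ suc) (f′ ∘ suc) g k) ⟩
    (f 0 + f′ 0) * g (suc k) + (convolution (f ∘ suc) g k + convolution (f′ ∘ suc) g k)
      ≈⟨ solve 5 (λ a b c d e → (a :+ b) :* c :+ (d :+ e) := (a :* c :+ d) :+ (b :* c :+ e)) refl _ _ _ _ _ ⟩
    (f 0 * g (suc k) + convolution (f ∘ suc) g k) + (f′ 0 * g (suc k) + convolution (f′ ∘ suc) g k) ∎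

  convolution-scaleˡ : ∀ a f g k → convolution (λ i → a * f i) g k ≈ a * convolution f g k
  convolution-scaleˡ a f g zero    = *-assoc _ _ _
  convolution-scaleˡ a f g (suc k) = begin
    a * f 0 * g (suc k) + convolution (λ i → a * f (suc i)) g k   ≈⟨ +-cong (*-assoc _ _ _) (convolution-scaleˡ a (f ∘ suc) g k) ⟩
    a * (f 0 * g (suc k)) + a * convolution (f ∘ suc) g k         ≈⟨ distribˡ _ _ _ ⟨
    a * (f 0 * g (suc k) + convolution (f ∘ suc) g k)             ∎

  convolution-scaleʳ : ∀ a f g k → convolution f (λ i → a * g i) k ≈ a * convolution f g k
  convolution-scaleʳ a f g zero    = solve 3 (λ x y z → x :* (y :* z) := y :* (x :* z)) refl _ _ _
  convolution-scaleʳ a f g (suc k) = begin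
    f 0 * (a * g (suc k)) + convolution (f ∘ suc) (λ i → a * g i) k   ≈⟨ +-congˡ (convolution-scaleʳ a (f ∘ suc) g k) ⟩
    f 0 * (a * g (suc k)) + a * convolution (f ∘ suc) g k
      ≈⟨ solve 4 (λ x y z w → x :* (y :* z) :+ y :* w := y :* (x :* z :+ w)) refl _ _ _ _ ⟩
    a * (f 0 * g (suc k) + convolution (f ∘ suc) g k)                 ∎

  derivative : (ℕ → Carrier) → ℕ → Carrier
  derivative f k = fromℕ R (suc k) * f (suc k)

  -- The product rule for d/dt on coefficient sequences. In the step, k + 2 is split as 1 + (k + 1):
  -- the part k + 1 feeds the induction hypothesis for the shifted `f`, and the remaining 1 turns
  -- the derivative of the shift into the shift of the derivative.
  convolution-Leibniz : ∀ f g k →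
    derivative (convolution f g) k ≈ convolution (derivative f) g k + convolution f (derivative g) k
  convolution-Leibniz f g zero =
    solve 5 (λ n a b c d → n :* (a :* b :+ c :* d) := (n :* c) :* d :+ a :* (n :* b)) refl
      (fromℕ R 1) (f 0) (g 1) (f 1) (g 0)
  convolution-Leibniz f g (suc k) = begin
    (1# + n) * (f 0 * g (suc (suc k)) + (f 1 * g (suc k) + S))
      ≈⟨ solve 4 (λ n x y s → (:1 :+ n) :* (x :+ (y :+ s)) := (:1 :+ n) :* x :+ (y :+ s) :+ n :* (y :+ s)) refl
           n (f 0 * g (suc (suc k))) (f 1 * g (suc k)) S ⟩
    (1# + n) * (f 0 * g (suc (suc k))) + (f 1 * g (suc k) + S) + n * (f 1 * g (suc k) + S)
      ≈⟨ +-congˡ (convolution-Leibniz (f ∘ suc) g k) ⟩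
    (1# + n) * (f 0 * g (suc (suc k))) + (f 1 * g (suc k) + S) + (A + B)
      ≈⟨ solve 8 (λ n x y z w s a b →
           (:1 :+ n) :* (x :* y) :+ (z :* w :+ s) :+ (a :+ b)
             := ((:1 :+ :0) :* z :* w :+ (s :+ a)) :+ (x :* ((:1 :+ n) :* y) :+ b)) refl
           n (f 0) (g (suc (suc k))) (f 1) (g (suc k)) S A B ⟩
    (derivative f 0 * g (suc k) + (S + A)) + (f 0 * derivative g (suc k) + B)
      ≈⟨ +-congʳ (+-congˡ (convolution-+ _ _ g k)) ⟨
    (derivative f 0 * g (suc k) + convolution (λ i → f (suc (suc i)) + derivative (f ∘ suc) i) g k)
      + (f 0 * derivative g (suc k) + B)
      ≈⟨ +-congʳ (+-congˡ (convolution-cong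
           (λ i → solve 2 (λ m x → x :+ m :* x := (:1 :+ m) :* x) refl (fromℕ R (suc i)) (f (suc (suc i))))
           (λ _ → refl) k)) ⟩
    (derivative f 0 * g (suc k) + convolution (derivative f ∘ suc) g k)
      + (f 0 * derivative g (suc k) + B) ∎
    where
    n = fromℕ R (suc k)
    S = convolution (λ i → f (suc (suc i))) g k
    A = convolution (derivative (f ∘ suc)) g k
    B = convolution (f ∘ suc) (derivative g) k

  derivative-divided-power : ∀ a k → derivative (divided-power a) k ≈ a * divided-power a k
  derivative-divided-power a k = begin
    fromℕ R (suc k) * (inv k * (a * divided-power a k))   ≈⟨ *-assoc _ _ _ ⟨
    fromℕ R (suc k) * inv k * (a * divided-power a k)     ≈⟨ *-congʳ (inv-inverse k) ⟩
    1# * (a * divided-power a k)                          ≈⟨ *-identityˡ _ ⟩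
    a * divided-power a k                                 ∎

  -- By the Leibniz rule, exp(at) exp(bt) is multiplied by a + b under d/dt. Since k + 1 is
  -- invertible, this recursion and the initial coefficient 1 determine all coefficients, so
  -- binomial coefficients never appear.
  divided-power-+ : ∀ a b k → divided-power (a + b) k ≈ convolution (divided-power a) (divided-power b) k
  divided-power-+ a b zero    = sym (*-identityʳ 1#)
  divided-power-+ a b (suc k) = begin
    inv k * ((a + b) * divided-power (a + b) k)       ≈⟨ *-congˡ (*-congˡ (divided-power-+ a b k)) ⟩
    inv k * ((a + b) * C k)                           ≈⟨ *-congˡ (distribʳ _ _ _) ⟩
    inv k * (a * C k + b * C k)
      ≈⟨ *-congˡ (+-cong (trans (convolution-cong (derivative-divided-power a) (λ _ → refl) k) (convolution-scaleˡ a _ _ k))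
                         (trans (convolution-cong (λ _ → refl) (derivative-divided-power b) k) (convolution-scaleʳ b _ _ k))) ⟨
    inv k * (convolution (derivative (divided-power a)) (divided-power b) k
              + convolution (divided-power a) (derivative (divided-power b)) k)
      ≈⟨ *-congˡ (convolution-Leibniz _ _ k) ⟨
    inv k * (fromℕ R (suc k) * C (suc k))             ≈⟨ solve 3 (λ x y z → x :* (y :* z) := (y :* x) :* z) refl _ _ _ ⟩
    fromℕ R (suc k) * inv k * C (suc k)               ≈⟨ *-congʳ (inv-inverse k) ⟩
    1# * C (suc k)                                    ≈⟨ *-identityˡ _ ⟩
    C (suc k)                                         ∎
    where
    C = convolution (divided-power a) (divided-power b)

  convolution-zeroˡ : ∀ f g → (∀ k → f k ≈ 0#) → ∀ k → convolution f g k ≈ 0#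
  convolution-zeroˡ f g h zero    = trans (*-congʳ (h 0)) (zeroˡ _)
  convolution-zeroˡ f g h (suc k) =
    trans (+-cong (trans (*-congʳ (h 0)) (zeroˡ _)) (convolution-zeroˡ (f ∘ suc) g (h ∘ suc) k)) (+-identityʳ 0#)

  convolution-vanishes : ∀ N M {f g} → VanishesFrom N f → VanishesFrom M g → VanishesFrom (N ℕ.+ M) (convolution f g)
  convolution-vanishes zero M {f} {g} hf hg k _ = convolution-zeroˡ f g (λ i → hf i z≤n) k
  convolution-vanishes (suc N) M {f} {g} hf hg (suc k) (s≤s N+M≤k) = begin
    f 0 * g (suc k) + convolution (f ∘ suc) g k
      ≈⟨ +-cong (*-congˡ (hg (suc k) (ℕP.≤-trans (ℕP.m≤n+m M N) (ℕP.m≤n⇒m≤1+n N+M≤k))))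
                (convolution-vanishes N M (λ i N≤i → hf (suc i) (s≤s N≤i)) hg k N+M≤k) ⟩
    f 0 * 0# + 0#   ≈⟨ trans (+-identityʳ _) (zeroʳ _) ⟩
    0#              ∎

  -- The truncation at N + M lies beyond every nonzero coefficient of the product, so the sum is the
  -- value of a polynomial at t = 1, which is multiplicative. Splitting off f 0 leaves the same
  -- statement for the shift of `f`.
  sum<-convolution : ∀ N M {f g} → VanishesFrom N f → VanishesFrom M g →
    sum< (N ℕ.+ M) (convolution f g) ≈ sum< N f * sum< M g
  sum<-convolution zero M {f} {g} hf hg = begin
    sum< M (convolution f g)   ≈⟨ sum<-stable {0} {M} {convolution f g} z≤n (λ k _ → convolution-zeroˡ f g (λ i → hf i z≤n) k) ⟩
    0#                         ≈⟨ zeroˡ _ ⟨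
    0# * sum< M g              ∎
  sum<-convolution (suc N) M {f} {g} hf hg = begin
    f 0 * g 0 + sum< (N ℕ.+ M) (λ k → f 0 * g (suc k) + convolution (f ∘ suc) g k)
      ≈⟨ +-congˡ (trans (sum<-+ (N ℕ.+ M) _ _) (+-congʳ (sum<-*ˡ (N ℕ.+ M) (f 0) _))) ⟩
    f 0 * g 0 + (f 0 * sum< (N ℕ.+ M) (g ∘ suc) + sum< (N ℕ.+ M) (convolution (f ∘ suc) g))
      ≈⟨ solve 4 (λ a b c d → a :* b :+ (a :* c :+ d) := a :* (b :+ c) :+ d) refl _ _ _ _ ⟩
    f 0 * sum< (suc N ℕ.+ M) g + sum< (N ℕ.+ M) (convolution (f ∘ suc) g)
      ≈⟨ +-cong (*-congˡ (sum<-stable {f = g} (ℕP.m≤n+m M (suc N)) hg)) (sum<-convolution N M (λ i N≤i → hf (suc i) (s≤s N≤i)) hg) ⟩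
    f 0 * sum< M g + sum< N (f ∘ suc) * sum< M g
      ≈⟨ distribʳ _ _ _ ⟨
    sum< (suc N) f * sum< M g ∎

  isExp-resp : ∀ {a b u v} → a ≈ b → u ≈ v → IsExp a u → IsExp b v
  isExp-resp a≈b u≈v (N , vanish , u≈) =
    N , (λ k N≤k → trans (sym (divided-power-cong a≈b k)) (vanish k N≤k)) ,
    trans (sym u≈v) (trans u≈ (sum<-cong N (divided-power-cong a≈b)))

  isExp-exp< : ∀ {a u} ((N , _) : IsExp a u) → ∀ {M} → N ≤ M → u ≈ exp< M a
  isExp-exp< (N , vanish , u≈) N≤M = trans u≈ (sym (sum<-stable N≤M vanish))

  isExp-unique : ∀ {a u v} → IsExp a u → IsExp a v → u ≈ v
  isExp-unique E@(N , _) F@(M , _) =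
    trans (isExp-exp< E (ℕP.m≤m+n N M)) (sym (isExp-exp< F (ℕP.m≤n+m M N)))

  isExp-+ : ∀ {a b u v} → IsExp a u → IsExp b v → IsExp (a + b) (u * v)
  isExp-+ {a} {b} (N , vanish-a , u≈) (M , vanish-b , v≈) =
    N ℕ.+ M ,
    (λ k h → trans (divided-power-+ a b k) (convolution-vanishes N M vanish-a vanish-b k h)) ,
    trans (*-cong u≈ v≈) (sym (trans (sum<-cong (N ℕ.+ M) (divided-power-+ a b)) (sum<-convolution N M vanish-a vanish-b)))

  inv0≈1 : inv 0 ≈ 1#
  inv0≈1 = trans (solve 1 (λ x → x := (:1 :+ :0) :* x) refl (inv 0)) (inv-inverse 0)

  divided-power-1 : ∀ a → divided-power a 1 ≈ a
  divided-power-1 a = trans (*-congʳ inv0≈1) (solve 1 (λ x → :1 :* (x :* :1) := x) refl a)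

  isExp-squareZero : ∀ {a} → a * a ≈ 0# → IsExp a (1# + a)
  isExp-squareZero {a} a²≈0 = 2 , vanish , +-congˡ (sym (trans (+-identityʳ _) (divided-power-1 a)))
    where
    vanish : VanishesFrom 2 (divided-power a)
    vanish (suc (suc k)) _ = begin
      inv (suc k) * (a * (inv k * (a * divided-power a k)))
        ≈⟨ solve 4 (λ i a j d → i :* (a :* (j :* (a :* d))) := (a :* a) :* (i :* j :* d)) refl _ _ _ _ ⟩
      a * a * (inv (suc k) * inv k * divided-power a k)   ≈⟨ *-congʳ a²≈0 ⟩
      0# * (inv (suc k) * inv k * divided-power a k)      ≈⟨ zeroˡ _ ⟩
      0#                                                  ∎
    vanish (suc zero) (s≤s ())

  isExp-0 : IsExp 0# 1#
  isExp-0 = isExp-resp refl (+-identityʳ 1#) (isExp-squareZero (zeroˡ 0#))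

  isExp-sum : ∀ {k} (a u : Fin k → Carrier) → (∀ i → IsExp (a i) (u i)) → IsExp (sum a) (product u)
  isExp-sum {zero}  a u h = isExp-0
  isExp-sum {suc k} a u h = isExp-+ (h zero) (isExp-sum (a ∘ suc) (u ∘ suc) (h ∘ suc))

  isExp-quadratic : ∀ {a u} → IsExp a u → ∃ λ w → u ≈ 1# + a + a * a * w
  -- The truncation is raised to 2 + N so that the terms of degree 0 and 1 can be split off even
  -- when N < 2.
  isExp-quadratic {a} {u} E@(N , _) = sum< N w , (begin
    u                                                       ≈⟨ isExp-exp< E (ℕP.m≤n+m N 2) ⟩
    1# + (divided-power a 1 + sum< N (λ i → divided-power a (suc (suc i))))
      ≈⟨ +-congˡ (+-cong (divided-power-1 a) (trans (sum<-cong N split) (sum<-*ˡ N (a * a) w))) ⟩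
    1# + (a + a * a * sum< N w)                             ≈⟨ +-assoc _ _ _ ⟨
    1# + a + a * a * sum< N w                               ∎)
    where
    w : ℕ → Carrier
    w k = inv (suc k) * inv k * divided-power a k
    split : ∀ k → divided-power a (suc (suc k)) ≈ a * a * w k
    split k = solve 4 (λ i a j d → i :* (a :* (j :* (a :* d))) := (a :* a) :* (i :* j :* d)) refl _ _ _ _

  power-divided : ∀ a k → ∃ λ r → a ^ k ≈ r * divided-power a k
  power-divided a zero    = 1# , sym (*-identityˡ 1#)
  power-divided a (suc k) with power-divided a k
  ... | r , eq = r * fromℕ R (suc k) , (begin
    a * a ^ k                                           ≈⟨ *-congˡ eq ⟩
    a * (r * divided-power a k)                         ≈⟨ solve 3 (λ x y z → x :* (y :* z) := y :* (x :* z)) refl _ _ _ ⟩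
    r * (a * divided-power a k)                         ≈⟨ *-congˡ (derivative-divided-power a k) ⟨
    r * (fromℕ R (suc k) * divided-power a (suc k))     ≈⟨ *-assoc _ _ _ ⟨
    r * fromℕ R (suc k) * divided-power a (suc k)       ∎)

  isExp-nilpotent : ∀ {a u} → IsExp a u → ∃ λ N → a ^ N ≈ 0#
  isExp-nilpotent {a} (N , vanish , _) with power-divided a N
  ... | r , eq = N , trans eq (trans (*-congˡ (vanish N ℕP.≤-refl)) (zeroʳ r))

  divided-power-multiple : ∀ z r k → ∃ λ s → divided-power (z * r) k ≈ z ^ k * s
  divided-power-multiple z r zero    = 1# , sym (*-identityʳ 1#)
  divided-power-multiple z r (suc k) with divided-power-multiple z r k
  ... | s , eq = inv k * r * s , (begin
    inv k * (z * r * divided-power (z * r) k)   ≈⟨ *-congˡ (*-congˡ eq) ⟩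
    inv k * (z * r * (z ^ k * s))
      ≈⟨ solve 5 (λ i z r p s → i :* (z :* r :* (p :* s)) := z :* p :* (i :* r :* s)) refl _ _ _ _ _ ⟩
    z * z ^ k * (inv k * r * s)                 ∎)

  ^-vanishes : ∀ {z N} → z ^ N ≈ 0# → VanishesFrom N (z ^_)
  ^-vanishes {z} {N} zN≈0 k N≤k = begin
    z ^ k                         ≈⟨ reflexive (≡.cong (z ^_) (≡.sym (ℕP.m+[n∸m]≡n N≤k))) ⟩
    z ^ (N ℕ.+ (k ℕ.∸ N))         ≈⟨ ^-homo-* z N (k ℕ.∸ N) ⟩
    z ^ N * z ^ (k ℕ.∸ N)         ≈⟨ *-congʳ zN≈0 ⟩
    0# * z ^ (k ℕ.∸ N)            ≈⟨ zeroˡ _ ⟩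
    0#                            ∎

  multiple-hasExp : ∀ {z N} → z ^ N ≈ 0# → ∀ r → ∃ λ u → IsExp (z * r) u
  multiple-hasExp {z} {N} zN≈0 r = exp< N (z * r) , N , vanish , refl
    where
    vanish : VanishesFrom N (divided-power (z * r))
    vanish k N≤k with divided-power-multiple z r k
    ... | s , eq = trans eq (trans (*-congʳ (^-vanishes {z} {N} zN≈0 k N≤k)) (zeroˡ s))

  isExp-multiple : ∀ {a u} → IsExp a u → ∃ λ q → u - 1# ≈ a * q
  isExp-multiple {a} {u} E with isExp-quadratic E
  ... | w , eq = 1# + a * w , trans (+-congʳ eq)
        (solve 2 (λ a w → :1 :+ a :+ a :* a :* w :- :1 := a :* (:1 :+ a :* w)) refl a w)

  -- Substituting a = (u − 1) − a² w into itself pushes the remainder into ever higher powers of a.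
  isExp-divides : ∀ {a u} → IsExp a u → ∃ λ q → a ≈ (u - 1#) * q
  isExp-divides {a} {u} E = conclude (isExp-nilpotent E)
    where
    w = proj₁ (isExp-quadratic E)
    iterate : ∀ k → ∃ λ q → ∃ λ r → a ≈ (u - 1#) * q + a * (a ^ k * r)
    iterate zero    = 0# , 1# , solve 2 (λ a u → a := (u :- :1) :* :0 :+ a :* (:1 :* :1)) refl a u
    iterate (suc k) with iterate k
    ... | q , r , eq = q + a ^ k * r , - (w * r) , (begin
      a                                                     ≈⟨ eq ⟩
      (u - 1#) * q + a * (a ^ k * r)
        ≈⟨ +-congˡ (solve 4 (λ a w p r → a :* (p :* r) := ((:1 :+ a :+ a :* a :* w) :- :1) :* (p :* r) :+ a :* (a :* p :* (:- (w :* r))))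
             refl a w (a ^ k) r) ⟩
      (u - 1#) * q + (((1# + a + a * a * w) - 1#) * (a ^ k * r) + a * (a * a ^ k * (- (w * r))))
        ≈⟨ +-congˡ (+-congʳ (*-congʳ (+-congʳ (proj₂ (isExp-quadratic E))))) ⟨
      (u - 1#) * q + ((u - 1#) * (a ^ k * r) + a * (a * a ^ k * (- (w * r))))
        ≈⟨ solve 4 (λ z q s t → z :* q :+ (z :* s :+ t) := z :* (q :+ s) :+ t) refl _ _ _ _ ⟩
      (u - 1#) * (q + a ^ k * r) + a * (a * a ^ k * (- (w * r))) ∎)
    conclude : (∃ λ N → a ^ N ≈ 0#) → ∃ λ q → a ≈ (u - 1#) * q
    conclude (N , aN≈0) with iterate N
    ... | q , r , eq = q , trans eq (trans (+-congˡ (trans (*-congˡ (trans (*-congʳ aN≈0) (zeroˡ r))) (zeroʳ a))) (+-identityʳ _))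

  -- Newton's iteration for log(1 + z): if (1 + z) exp(−l) = 1 + w, then replacing l by l + w
  -- replaces w by a multiple of w², because (1 + w) exp(−w) = 1 + O(w²).
  exp-surjective : ∀ {z N} → z ^ N ≈ 0# → ∃ λ l → IsExp l (1# + z)
  exp-surjective {z} {N} zN≈0 = conclude (iterate N)
    where
    Approximation : ℕ → Set _
    Approximation k = ∃ λ s → ∃ λ v → ∃ λ r → IsExp (- (z * s)) v × (1# + z) * v ≈ 1# + z * (z ^ k * r)

    iterate : ∀ k → Approximation k
    iterate zero = 0# , 1# , 1# ,
      isExp-resp (solve 1 (λ z → :0 := :- (z :* :0)) refl z) refl isExp-0 ,
      solve 1 (λ z → (:1 :+ z) :* :1 := :1 :+ z :* (:1 :* :1)) refl z
    iterate (suc k) with iterate k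
    ... | s , v , r , E , eq with multiple-hasExp {z} {N} zN≈0 (- (z ^ k * r))
    ... | v′ , E′ with isExp-quadratic E′
    -- The new error is a multiple of w² = z² z^(2k) r². The invariant claims only z · z^(k+1) of it
    -- and puts the surplus z^k into the new `r`; one more power of z per round is enough, since z
    -- is nilpotent.
    ... | g , v′≈ = s + z ^ k * r , v * v′ , r * r * z ^ k * (g * (1# + w) - 1#) ,
      isExp-resp (solve 3 (λ z s t → :- (z :* s) :+ z :* (:- t) := :- (z :* (s :+ t))) refl z s (z ^ k * r)) refl (isExp-+ E E′) ,
      (begin
        (1# + z) * (v * v′)           ≈⟨ *-assoc _ _ _ ⟨
        (1# + z) * v * v′             ≈⟨ *-cong eq v′≈ ⟩
        (1# + w) * (1# + z * (- (z ^ k * r)) + z * (- (z ^ k * r)) * (z * (- (z ^ k * r))) * g)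
          ≈⟨ solve 4 (λ z p r g →
               (:1 :+ z :* (p :* r)) :* (:1 :+ z :* (:- (p :* r)) :+ z :* (:- (p :* r)) :* (z :* (:- (p :* r))) :* g)
                 := :1 :+ z :* (z :* p :* (r :* r :* p :* (g :* (:1 :+ z :* (p :* r)) :- :1))))
               refl z (z ^ k) r g ⟩
        1# + z * (z * z ^ k * (r * r * z ^ k * (g * (1# + w) - 1#))) ∎)
      where
      w = z * (z ^ k * r)

    conclude : Approximation N → ∃ λ l → IsExp l (1# + z)
    conclude (s , v , r , E , eq) with multiple-hasExp {z} {N} zN≈0 s
    ... | u , F = z * s , isExp-resp refl (begin
      u                     ≈⟨ *-identityʳ u ⟨
      u * 1#                ≈⟨ *-congˡ (trans eq (trans (+-congˡ (trans (*-congˡ (trans (*-congʳ zN≈0) (zeroˡ r))) (zeroʳ z))) (+-identityʳ 1#))) ⟨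
      u * ((1# + z) * v)    ≈⟨ solve 3 (λ u y v → u :* (y :* v) := y :* (u :* v)) refl u (1# + z) v ⟩
      (1# + z) * (u * v)    ≈⟨ *-congˡ (isExp-unique (isExp-resp (-‿inverseʳ (z * s)) refl (isExp-+ F E)) isExp-0) ⟩
      (1# + z) * 1#         ≈⟨ *-identityʳ _ ⟩
      1# + z                ∎) F

-- Compatibility of ring homomorphisms with truncated exponentials

module ExponentialHomomorphism {c ℓ c′ ℓ′ : Level} (R : CommutativeRing c ℓ) (S : CommutativeRing c′ ℓ′)
  (invᴿ : ℕ → CommutativeRing.Carrier R)
  (invᴿ-inverse : ∀ k → CommutativeRing._≈_ R (CommutativeRing._*_ R (fromℕ R (suc k)) (invᴿ k)) (CommutativeRing.1# R))
  (invˢ : ℕ → CommutativeRing.Carrier S)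
  (invˢ-inverse : ∀ k → CommutativeRing._≈_ S (CommutativeRing._*_ S (fromℕ S (suc k)) (invˢ k)) (CommutativeRing.1# S))
  (φ : CommutativeRing.Carrier R → CommutativeRing.Carrier S)
  (φ-cong : ∀ {a b} → CommutativeRing._≈_ R a b → CommutativeRing._≈_ S (φ a) (φ b))
  (φ-+ : ∀ a b → CommutativeRing._≈_ S (φ (CommutativeRing._+_ R a b)) (CommutativeRing._+_ S (φ a) (φ b)))
  (φ-* : ∀ a b → CommutativeRing._≈_ S (φ (CommutativeRing._*_ R a b)) (CommutativeRing._*_ S (φ a) (φ b)))
  (φ-0 : CommutativeRing._≈_ S (φ (CommutativeRing.0# R)) (CommutativeRing.0# S))
  (φ-1 : CommutativeRing._≈_ S (φ (CommutativeRing.1# R)) (CommutativeRing.1# S))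
  where
  private
    module R = CommutativeRing R
    module ER = Exponential R invᴿ invᴿ-inverse
    module ES = Exponential S invˢ invˢ-inverse
  open CommutativeRing S hiding (zero)
  open import Relation.Binary.Reasoning.Setoid setoid

  φ-fromℕ : ∀ k → φ (fromℕ R k) ≈ fromℕ S k
  φ-fromℕ zero    = φ-0
  φ-fromℕ (suc k) = trans (φ-+ R.1# (fromℕ R k)) (+-cong φ-1 (φ-fromℕ k))

  φ-inv : ∀ k → φ (invᴿ k) ≈ invˢ k
  φ-inv k = begin
    φ (invᴿ k)                                    ≈⟨ *-identityˡ _ ⟨
    1# * φ (invᴿ k)                               ≈⟨ *-congʳ (trans (*-comm _ _) (invˢ-inverse k)) ⟨
    invˢ k * fromℕ S (suc k) * φ (invᴿ k)         ≈⟨ *-assoc _ _ _ ⟩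
    invˢ k * (fromℕ S (suc k) * φ (invᴿ k))       ≈⟨ *-congˡ (*-congʳ (φ-fromℕ (suc k))) ⟨
    invˢ k * (φ (fromℕ R (suc k)) * φ (invᴿ k))   ≈⟨ *-congˡ (trans (sym (φ-* _ _)) (trans (φ-cong (invᴿ-inverse k)) φ-1)) ⟩
    invˢ k * 1#                                   ≈⟨ *-identityʳ _ ⟩
    invˢ k                                        ∎

  φ-divided-power : ∀ a k → φ (ER.divided-power a k) ≈ ES.divided-power (φ a) k
  φ-divided-power a zero    = φ-1
  φ-divided-power a (suc k) = trans (φ-* (invᴿ k) _) (*-cong (φ-inv k) (trans (φ-* a _) (*-congˡ (φ-divided-power a k))))

  φ-sum< : ∀ N f → φ (ER.sum< N f) ≈ ES.sum< N (φ ∘ f)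
  φ-sum< zero    f = φ-0
  φ-sum< (suc N) f = trans (φ-+ (f 0) _) (+-congˡ (φ-sum< N (f ∘ suc)))

  φ-exp< : ∀ N a → φ (ER.exp< N a) ≈ ES.exp< N (φ a)
  φ-exp< N a = trans (φ-sum< N (ER.divided-power a)) (ES.sum<-cong N (φ-divided-power a))

-- Finite sums, derivations and integration by parts

module FiniteSums {c ℓ : Level} (M : Monoid c ℓ) where
  open Monoid M
  open import Algebra.Properties.Monoid.Sum M using (sum)

  sum-ε : ∀ {k} (f : Fin k → Carrier) → (∀ i → f i ≈ ε) → sum f ≈ ε
  sum-ε {zero}  f h = refl
  sum-ε {suc k} f h = trans (∙-cong (h zero) (sum-ε (f ∘ suc) (h ∘ suc))) (identityʳ ε)

  sum-single : ∀ {k} (f : Fin k → Carrier) i → (∀ j → i ≢ j → f j ≈ ε) → sum f ≈ f i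
  sum-single f zero    h = trans (∙-congˡ (sum-ε (f ∘ suc) (λ j → h (suc j) (λ ())))) (identityʳ _)
  sum-single f (suc i) h =
    trans (∙-cong (h zero (λ ())) (sum-single (f ∘ suc) i (λ j i≢j → h (suc j) (i≢j ∘ FinP.suc-injective)))) (identityˡ _)

-- `AtOrigin0 p` says that the constant term of `p` vanishes; as a predicate it spares the interface
-- a ring of scalars. The degree bound is strict so that bound 0 means the zero polynomial and each
-- derivation lowers the bound by exactly one, which is what ends the repeated integration.
record DifferentialPolynomials {c ℓ : Level} (A : CommutativeRing c ℓ) (n : ℕ) : Set (c ⊔ Level.suc ℓ) where
  open CommutativeRing A
  field
    x             : Fin n → Carrier
    ∂             : Fin n → Carrier → Carrier
    ∂-cong        : ∀ i {p q} → p ≈ q → ∂ i p ≈ ∂ i q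
    ∂-+           : ∀ i p q → ∂ i (p + q) ≈ ∂ i p + ∂ i q
    ∂-*           : ∀ i p q → ∂ i (p * q) ≈ ∂ i p * q + p * ∂ i q
    ∂-comm        : ∀ i j p → ∂ i (∂ j p) ≈ ∂ j (∂ i p)
    ∂-x-same      : ∀ i → ∂ i (x i) ≈ 1#
    ∂-x-other     : ∀ {i j} → i ≢ j → ∂ i (x j) ≈ 0#
    inv           : ℕ → Carrier
    inv-inverse   : ∀ k → fromℕ A (suc k) * inv k ≈ 1#
    Degree<       : ℕ → Carrier → Set ℓ
    degree-bound  : ∀ p → ∃ λ k → Degree< k p
    degree-zero   : ∀ {p} → Degree< 0 p → p ≈ 0#
    degree-∂      : ∀ i {k p} → Degree< (suc k) p → Degree< k (∂ i p)
    degree-minus  : ∀ {k p q} → Degree< k p → Degree< k q → Degree< k (p - q)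
    AtOrigin0     : Carrier → Set ℓ
    origin-resp   : ∀ {p q} → p ≈ q → AtOrigin0 p → AtOrigin0 q
    origin-0      : AtOrigin0 0#
    origin-+      : ∀ {p q} → AtOrigin0 p → AtOrigin0 q → AtOrigin0 (p + q)
    origin-*      : ∀ q {p} → AtOrigin0 p → AtOrigin0 (q * p)
    origin-x      : ∀ i → AtOrigin0 (x i)
    constant-zero : ∀ {p} → (∀ i → ∂ i p ≈ 0#) → AtOrigin0 p → p ≈ 0#

module Derivation {c ℓ : Level} (A : CommutativeRing c ℓ)
  (D : CommutativeRing.Carrier A → CommutativeRing.Carrier A)
  (D-cong : ∀ {p q} → CommutativeRing._≈_ A p q → CommutativeRing._≈_ A (D p) (D q))
  (D-+ : ∀ p q → CommutativeRing._≈_ A (D (CommutativeRing._+_ A p q)) (CommutativeRing._+_ A (D p) (D q)))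
  (D-* : ∀ p q → CommutativeRing._≈_ A (D (CommutativeRing._*_ A p q))
    (CommutativeRing._+_ A (CommutativeRing._*_ A (D p) q) (CommutativeRing._*_ A p (D q))))
  where
  open CommutativeRing A hiding (zero)
  open IntegerSolver A
  open import Algebra.Properties.Semiring.Exp semiring using (_^_)
  open import Algebra.Properties.Monoid.Sum +-monoid using (sum)
  open import Relation.Binary.Reasoning.Setoid setoid

  private
    double-zero : ∀ {a} → a ≈ a + a → a ≈ 0#
    double-zero {a} eq = begin
      a             ≈⟨ solve 1 (λ a → a := a :+ a :- a) refl a ⟩
      a + a - a     ≈⟨ +-congʳ eq ⟨
      a - a         ≈⟨ -‿inverseʳ a ⟩
      0#            ∎

  D-0 : D 0# ≈ 0#
  D-0 = double-zero (trans (D-cong (sym (+-identityʳ 0#))) (D-+ 0# 0#))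

  D-1 : D 1# ≈ 0#
  D-1 = double-zero (begin
    D 1#                      ≈⟨ D-cong (*-identityʳ 1#) ⟨
    D (1# * 1#)               ≈⟨ D-* 1# 1# ⟩
    D 1# * 1# + 1# * D 1#     ≈⟨ +-cong (*-identityʳ _) (*-identityˡ _) ⟩
    D 1# + D 1#               ∎)

  D-neg : ∀ p → D (- p) ≈ - D p
  D-neg p = begin
    D (- p)                 ≈⟨ solve 2 (λ a b → b := (a :+ b) :- a) refl (D p) (D (- p)) ⟩
    (D p + D (- p)) - D p   ≈⟨ +-congʳ (trans (sym (D-+ p (- p))) (trans (D-cong (-‿inverseʳ p)) D-0)) ⟩
    0# - D p                ≈⟨ +-identityˡ _ ⟩
    - D p                   ∎

  D-minus : ∀ p q → D (p - q) ≈ D p - D q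
  D-minus p q = trans (D-+ p (- q)) (+-congˡ (D-neg q))

  D-fromℕ : ∀ k → D (fromℕ A k) ≈ 0#
  D-fromℕ zero    = D-0
  D-fromℕ (suc k) = trans (D-+ 1# (fromℕ A k)) (trans (+-cong D-1 (D-fromℕ k)) (+-identityʳ 0#))

  -- Differentiating a b = 1 leaves a D b = 0, and multiplying by b isolates D b. Applied to
  -- `inv k`, it makes the rational constants constants of every derivation.
  D-inverse : ∀ {a b} → a * b ≈ 1# → D a ≈ 0# → D b ≈ 0#
  D-inverse {a} {b} ab≈1 Da≈0 = begin
    D b                         ≈⟨ *-identityˡ _ ⟨
    1# * D b                    ≈⟨ *-congʳ (trans (sym ab≈1) (*-comm a b)) ⟩
    b * a * D b                 ≈⟨ solve 4 (λ a b d e → b :* a :* d := b :* ((e :* b :+ a :* d) :- e :* b)) refl a b (D b) (D a) ⟩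
    b * ((D a * b + a * D b) - D a * b)
      ≈⟨ *-congˡ (+-cong (trans (sym (D-* a b)) (trans (D-cong ab≈1) D-1)) (-‿cong (trans (*-congʳ Da≈0) (zeroˡ b)))) ⟩
    b * (0# - 0#)               ≈⟨ solve 1 (λ b → b :* (:0 :- :0) := :0) refl b ⟩
    0#                          ∎

  D-^ : ∀ t k → D (t ^ suc k) ≈ fromℕ A (suc k) * (t ^ k * D t)
  D-^ t zero    = begin
    D (t * 1#)               ≈⟨ D-cong (*-identityʳ t) ⟩
    D t                      ≈⟨ solve 1 (λ d → d := (:1 :+ :0) :* (:1 :* d)) refl (D t) ⟩
    (1# + 0#) * (1# * D t)   ∎
  D-^ t (suc k) = begin
    D (t * t ^ suc k)                                             ≈⟨ D-* t (t ^ suc k) ⟩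
    D t * t ^ suc k + t * D (t ^ suc k)                           ≈⟨ +-congˡ (*-congˡ (D-^ t k)) ⟩
    D t * (t * t ^ k) + t * (fromℕ A (suc k) * (t ^ k * D t))
      ≈⟨ solve 4 (λ d t p n → d :* (t :* p) :+ t :* (n :* (p :* d)) := (:1 :+ n) :* (t :* p :* d)) refl (D t) t (t ^ k) (fromℕ A (suc k)) ⟩
    (1# + fromℕ A (suc k)) * (t * t ^ k * D t)                    ∎

  D-sum : ∀ {k} (f : Fin k → Carrier) → D (sum f) ≈ sum (D ∘ f)
  D-sum {zero}  f = D-0
  D-sum {suc k} f = trans (D-+ _ _) (+-congˡ (D-sum (f ∘ suc)))

  -- Repeated integration by parts; it ends because D lowers the degree.
  module Integration {a : Level} (S : Carrier → Set a)
    (S-0 : S 0#) (S-* : ∀ {p q} → S p → S q → S (p * q)) (S-minus : ∀ {p q} → S p → S q → S (p - q)) (S-D : ∀ {p} → S p → S (D p))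
    (inv : ℕ → Carrier) (inv-inverse : ∀ k → fromℕ A (suc k) * inv k ≈ 1#) (S-inv : ∀ k → S (inv k))
    (Degree< : ℕ → Carrier → Set ℓ) (degree-zero : ∀ {p} → Degree< 0 p → p ≈ 0#)
    (degree-D : ∀ {k p} → Degree< (suc k) p → Degree< k (D p))
    (t ε : Carrier) (Dt≈ε : D t ≈ ε) (εε≈1 : ε * ε ≈ 1#) (Dε≈0 : D ε ≈ 0#) (S-t : S t) (S-ε : S ε)
    where

    integrate : ∀ k d {q} → Degree< k q → S q → ∃ λ r → S r × D (r * t ^ suc d) ≈ q * t ^ d
    integrate zero d {q} deg Sq = 0# , S-0 , (begin
      D (0# * t ^ suc d)    ≈⟨ trans (D-cong (zeroˡ _)) D-0 ⟩
      0#                    ≈⟨ zeroˡ _ ⟨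
      0# * t ^ d            ≈⟨ *-congʳ (degree-zero deg) ⟨
      q * t ^ d             ∎)
    integrate (suc k) d {q} deg Sq with integrate k (suc d) (degree-D deg) (S-D Sq)
    ... | r′ , Sr′ , eq =
      -- Since D t = ε is its own inverse and a constant, an antiderivative of q t^d is ε/(d + 1)
      -- times q t^(d+1) minus an antiderivative of D q t^(d+1). The recursive call supplies the
      -- latter as r′ t^(d+2); a common factor t^(d+1) is taken out.
      i * (ε * (q - r′ * t)) , S-* (S-inv d) (S-* S-ε (S-minus Sq (S-* Sr′ S-t))) , (begin
      D (i * (ε * (q - r′ * t)) * t ^ suc d)
        ≈⟨ D-cong (solve 6 (λ i ε q r t p → i :* (ε :* (q :- r :* t)) :* p := (i :* ε) :* (q :* p :- r :* (t :* p))) refl i ε q r′ t (t ^ suc d)) ⟩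
      D (i * ε * (q * t ^ suc d - r′ * t ^ suc (suc d)))
        ≈⟨ D-* _ _ ⟩
      D (i * ε) * (q * t ^ suc d - r′ * t ^ suc (suc d)) + i * ε * D (q * t ^ suc d - r′ * t ^ suc (suc d))
        ≈⟨ +-cong (*-congʳ Diε≈0) (*-congˡ (trans (D-minus _ _) (+-cong (trans (D-* q _) (+-congˡ (*-congˡ (trans (D-^ t d) (*-congˡ (*-congˡ Dt≈ε)))))) (-‿cong eq)))) ⟩
      0# * (q * t ^ suc d - r′ * t ^ suc (suc d)) + i * ε * ((D q * t ^ suc d + q * (N * (t ^ d * ε))) - D q * t ^ suc d)
        ≈⟨ solve 7 (λ i ε z u q N p → :0 :* z :+ i :* ε :* ((u :+ q :* (N :* (p :* ε))) :- u) := (N :* i) :* (ε :* ε) :* (q :* p))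
             refl i ε (q * t ^ suc d - r′ * t ^ suc (suc d)) (D q * t ^ suc d) q N (t ^ d) ⟩
      (N * i) * (ε * ε) * (q * t ^ d)
        ≈⟨ *-congʳ (*-cong (inv-inverse d) εε≈1) ⟩
      1# * 1# * (q * t ^ d)
        ≈⟨ solve 1 (λ x → :1 :* :1 :* x := x) refl _ ⟩
      q * t ^ d ∎)
      where
      i = inv d
      N = fromℕ A (suc d)
      Diε≈0 : D (i * ε) ≈ 0#
      Diε≈0 = begin
        D (i * ε)             ≈⟨ D-* i ε ⟩
        D i * ε + i * D ε     ≈⟨ +-cong (*-congʳ (D-inverse (inv-inverse d) (D-fromℕ (suc d)))) (*-congˡ Dε≈0) ⟩
        0# * ε + i * 0#       ≈⟨ solve 2 (λ i ε → :0 :* ε :+ i :* :0 := :0) refl i ε ⟩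
        0#                    ∎

-- Paths, cuts and connected components

module Connectivity {V E : Set} (lo hi : E → V) where

  data Path (C : List E) (u : V) : V → Set where
    stay : Path C u u
    up   : ∀ {e} → e ∈ C → Path C u (lo e) → Path C u (hi e)
    down : ∀ {e} → e ∈ C → Path C u (hi e) → Path C u (lo e)

  Connected : List E → Set
  Connected C = ∀ u v → Path C u v

  Closed : List E → (V → Bool) → Set
  Closed C I = ∀ {e} → e ∈ C → I (lo e) ≡ I (hi e)

  Proper : (V → Bool) → Set
  Proper I = (∃ λ u → I u ≡ true) × (∃ λ v → I v ≡ false)

  cutSize : List E → (V → Bool) → ℕ
  cutSize L I = NL.sum (List.map (λ e → if I (lo e) xor I (hi e) then 1 else 0) L)

  cutSize-same : ∀ {e} L I → I (lo e) ≡ I (hi e) → cutSize (e ∷ L) I ≡ cutSize L I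
  cutSize-same {e} L I eq with I (lo e) | I (hi e)
  ... | true  | true  = ≡.refl
  ... | false | false = ≡.refl

  cutSize-different : ∀ {e} L I → I (lo e) ≢ I (hi e) → cutSize (e ∷ L) I ≡ suc (cutSize L I)
  cutSize-different {e} L I neq with I (lo e) | I (hi e)
  ... | true  | true  = ⊥-elim (neq ≡.refl)
  ... | false | false = ⊥-elim (neq ≡.refl)
  ... | true  | false = ≡.refl
  ... | false | true  = ≡.refl

  -- For every H ⊆ L such that (L ∖ H) ∪ C is connected, applying D e for all e ∈ H in turn leads to Z:
  -- e ∈ H is the first component, e ∉ H the second.
  Vanishing : ∀ {a z} {X : Set a} (D : E → X → X) (Z : X → Set z) (C L : List E) → X → Set z
  Vanishing D Z C []      p = Connected C → Z p
  Vanishing D Z C (e ∷ L) p = Vanishing D Z C L (D e p) × Vanishing D Z (e ∷ C) L p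

  -- The relation may join two different rings. With equality it shows that the condition respects
  -- equality; with the graph of a substitution it carries the condition from edge variables back to
  -- vertex variables.
  vanishing-transport : ∀ {a b r z} {X : Set a} {X′ : Set b} {D : E → X → X} {D′ : E → X′ → X′}
    {Z : X → Set z} {Z′ : X′ → Set z} (_∼_ : X → X′ → Set r) →
    (∀ e {p q} → p ∼ q → D e p ∼ D′ e q) → (∀ {p q} → p ∼ q → Z p → Z′ q) →
    ∀ C L {p q} → p ∼ q → Vanishing D Z C L p → Vanishing D′ Z′ C L q
  vanishing-transport _∼_ D∼ Z∼ C []      p∼q h       = Z∼ p∼q ∘ h
  vanishing-transport _∼_ D∼ Z∼ C (e ∷ L) p∼q (h , k) =
    vanishing-transport _∼_ D∼ Z∼ C L (D∼ e p∼q) h , vanishing-transport _∼_ D∼ Z∼ (e ∷ C) L p∼q k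

  path-trans : ∀ {C u v w} → Path C u v → Path C v w → Path C u w
  path-trans p stay       = p
  path-trans p (up e∈ q)   = up e∈ (path-trans p q)
  path-trans p (down e∈ q) = down e∈ (path-trans p q)

  path-sym : ∀ {C u v} → Path C u v → Path C v u
  path-sym stay        = stay
  path-sym (up e∈ p)   = path-trans (down e∈ stay) (path-sym p)
  path-sym (down e∈ p) = path-trans (up e∈ stay) (path-sym p)

  path-weaken : ∀ {C e u v} → Path C u v → Path (e ∷ C) u v
  path-weaken stay        = stay
  path-weaken (up e∈ p)   = up (there e∈) (path-weaken p)
  path-weaken (down e∈ p) = down (there e∈) (path-weaken p)

  closed-path : ∀ {C I u v} → Closed C I → Path C u v → I u ≡ I v
  closed-path h stay        = ≡.refl
  closed-path h (up e∈ p)   = ≡.trans (closed-path h p) (h e∈)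
  closed-path h (down e∈ p) = ≡.trans (closed-path h p) (≡.sym (h e∈))

  closed-∷ : ∀ {C e I} → I (lo e) ≡ I (hi e) → Closed C I → Closed (e ∷ C) I
  closed-∷ h hs (here ≡.refl) = h
  closed-∷ h hs (there e∈)    = hs e∈

  -- `root` and `closed` make `member` contain every vertex joined to `u`, and `reachable` makes it
  -- contain no other. It is Boolean so that a component can itself serve as the vertex set of a
  -- cut.
  record Component (C : List E) (u : V) : Set where
    field
      member    : V → Bool
      root      : member u ≡ true
      closed    : Closed C member
      reachable : ∀ v → member v ≡ true → Path C u v

  -- A new edge with exactly one end in the component attaches the component of its other end.
  attach : ∀ {C u e w} → (I : Component C u) (I′ : Component C w) → Path (e ∷ C) u w →
    (let m = λ v → Component.member I v ∨ Component.member I′ v in m (lo e) ≡ m (hi e)) →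
    Component (e ∷ C) u
  attach {C} {u} {e} {w} I I′ u⇝w same = record
    { member    = λ v → I.member v ∨ I′.member v
    ; root      = ≡.cong (_∨ I′.member u) I.root
    ; closed    = closed-∷ {I = λ v → I.member v ∨ I′.member v} same (λ e∈ → ≡.cong₂ _∨_ (I.closed e∈) (I′.closed e∈))
    ; reachable = reach
    }
    where
    module I = Component I
    module I′ = Component I′
    reach : ∀ v → I.member v ∨ I′.member v ≡ true → Path (e ∷ C) u v
    reach v h with I.member v in eq
    ... | true  = path-weaken (I.reachable v eq)
    ... | false = path-trans u⇝w (path-weaken (I′.reachable v h))

module ComputeComponents {n : ℕ} {E : Set} (lo hi : E → Fin (suc n)) where
  open Connectivity lo hi

  component : ∀ C u → Component C u
  component [] u = record
    { member    = λ v → does (u Fin.≟ v)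
    ; root      = root
    ; closed    = λ ()
    ; reachable = reach
    }
    where
    root : does (u Fin.≟ u) ≡ true
    root with u Fin.≟ u
    ... | yes _   = ≡.refl
    ... | no  u≢u = ⊥-elim (u≢u ≡.refl)
    reach : ∀ v → does (u Fin.≟ v) ≡ true → Path [] u v
    reach v h with u Fin.≟ v
    ... | yes ≡.refl = stay
  component (e ∷ C) u = extend (component C u)
    where
    extend : Component C u → Component (e ∷ C) u
    extend I with Component.member I (lo e) in eqˡ | Component.member I (hi e) in eqʰ
    ... | true | false = attach I (component C (hi e)) (up (here ≡.refl) (path-weaken (Component.reachable I (lo e) eqˡ)))
            (≡.trans (≡.cong (_∨ Component.member (component C (hi e)) (lo e)) eqˡ)
              (≡.sym (≡.cong₂ _∨_ eqʰ (Component.root (component C (hi e))))))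
    ... | false | true = attach I (component C (lo e)) (down (here ≡.refl) (path-weaken (Component.reachable I (hi e) eqʰ)))
            (≡.trans (≡.cong₂ _∨_ eqˡ (Component.root (component C (lo e))))
              (≡.sym (≡.cong (_∨ Component.member (component C (lo e)) (hi e)) eqʰ)))
    ... | true | true = record
            { member = member ; root = root ; closed = closed-∷ {I = member} (≡.trans eqˡ (≡.sym eqʰ)) closed
            ; reachable = λ v h → path-weaken (reachable v h) }
      where open Component I
    ... | false | false = record
            { member = member ; root = root ; closed = closed-∷ {I = member} (≡.trans eqˡ (≡.sym eqʰ)) closed
            ; reachable = λ v h → path-weaken (reachable v h) }
      where open Component I

  -- The component of vertex `zero` is either everything, and then paths through `zero` connect any
  -- two vertices, or it is itself the closed proper set.
  connected-or-cut : ∀ C → Connected C ⊎ (∃ λ I → Proper I × Closed C I)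
  connected-or-cut C with FinP.any? (λ v → Component.member (component C zero) v Bool.≟ false)
  ... | yes (v , v∉) = inj₂ (member , ((zero , root) , (v , v∉)) , closed)
    where open Component (component C zero)
  ... | no none = inj₁ (λ u v → path-trans (path-sym (from-0 u)) (from-0 v))
    where
    open Component (component C zero)
    from-0 : ∀ v → Path C zero v
    from-0 v with member v in eq
    ... | true  = reachable v eq
    ... | false = ⊥-elim (none (v , eq))

-- Deletion and contraction for the power ideal

module PowerIdeal {c ℓ : Level} (A : CommutativeRing c ℓ) {n : ℕ} (poly : DifferentialPolynomials A (suc n))
  {E : Set} (lo hi : E → Fin (suc n)) where
  open CommutativeRing A hiding (zero)
  open IntegerSolver A
  open DifferentialPolynomials poly
  open import Algebra.Properties.Semiring.Exp semiring using (_^_)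
  open import Algebra.Properties.Monoid.Sum +-monoid using (sum)
  open import Relation.Binary.Reasoning.Setoid setoid
  open FiniteSums +-monoid
  open Connectivity lo hi public
  open ComputeComponents lo hi public
  private module ∂′ (i : Fin (suc n)) = Derivation A (∂ i) (∂-cong i) (∂-+ i) (∂-* i)

  δ : E → Carrier → Carrier
  δ e p = ∂ (lo e) p - ∂ (hi e) p

  δ-cong : ∀ e {p q} → p ≈ q → δ e p ≈ δ e q
  δ-cong e p≈q = +-cong (∂-cong (lo e) p≈q) (-‿cong (∂-cong (hi e) p≈q))

  δ-+ : ∀ e p q → δ e (p + q) ≈ δ e p + δ e q
  δ-+ e p q = begin
    ∂ (lo e) (p + q) - ∂ (hi e) (p + q)                             ≈⟨ +-cong (∂-+ (lo e) p q) (-‿cong (∂-+ (hi e) p q)) ⟩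
    (∂ (lo e) p + ∂ (lo e) q) - (∂ (hi e) p + ∂ (hi e) q)
      ≈⟨ solve 4 (λ a b c d → (a :+ b) :- (c :+ d) := (a :- c) :+ (b :- d)) refl _ _ _ _ ⟩
    δ e p + δ e q                                                   ∎

  δ-* : ∀ e p q → δ e (p * q) ≈ δ e p * q + p * δ e q
  δ-* e p q = begin
    ∂ (lo e) (p * q) - ∂ (hi e) (p * q)                             ≈⟨ +-cong (∂-* (lo e) p q) (-‿cong (∂-* (hi e) p q)) ⟩
    (∂ (lo e) p * q + p * ∂ (lo e) q) - (∂ (hi e) p * q + p * ∂ (hi e) q)
      ≈⟨ solve 6 (λ p q a b c d → (a :* q :+ p :* b) :- (c :* q :+ p :* d) := (a :- c) :* q :+ p :* (b :- d)) refl p q _ _ _ _ ⟩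
    δ e p * q + p * δ e q                                           ∎

  private module δ′ (e : E) = Derivation A (δ e) (δ-cong e) (δ-+ e) (δ-* e)

  δ-same : ∀ e {p} → ∂ (lo e) p ≈ ∂ (hi e) p → δ e p ≈ 0#
  δ-same e eq = trans (+-congʳ eq) (-‿inverseʳ _)

  same-δ : ∀ e {p} → δ e p ≈ 0# → ∂ (lo e) p ≈ ∂ (hi e) p
  same-δ e {p} eq = begin
    ∂ (lo e) p                              ≈⟨ solve 2 (λ a b → a := (a :- b) :+ b) refl _ _ ⟩
    δ e p + ∂ (hi e) p                      ≈⟨ +-congʳ eq ⟩
    0# + ∂ (hi e) p                         ≈⟨ +-identityˡ _ ⟩
    ∂ (hi e) p                              ∎

  -- These are the polynomials in which the variables of each component of `C` occur only through
  -- their sum, that is, the polynomials on the vertices of the contracted graph. They form a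
  -- subring closed under all `∂ i`.
  Annihilated : List E → Carrier → Set ℓ
  Annihilated C p = ∀ {e} → e ∈ C → ∂ (lo e) p ≈ ∂ (hi e) p

  ann-0 : ∀ {C} → Annihilated C 0#
  ann-0 {_} {e} _ = trans (∂′.D-0 (lo e)) (sym (∂′.D-0 (hi e)))

  ann-1 : ∀ {C} → Annihilated C 1#
  ann-1 {_} {e} _ = trans (∂′.D-1 (lo e)) (sym (∂′.D-1 (hi e)))

  ann-resp : ∀ {C p q} → p ≈ q → Annihilated C p → Annihilated C q
  ann-resp p≈q h {e} e∈ = trans (∂-cong (lo e) (sym p≈q)) (trans (h e∈) (∂-cong (hi e) p≈q))

  ann-+ : ∀ {C p q} → Annihilated C p → Annihilated C q → Annihilated C (p + q)
  ann-+ {_} {p} {q} hp hq {e} e∈ =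
    trans (∂-+ (lo e) p q) (trans (+-cong (hp e∈) (hq e∈)) (sym (∂-+ (hi e) p q)))

  ann-minus : ∀ {C p q} → Annihilated C p → Annihilated C q → Annihilated C (p - q)
  ann-minus {_} {p} {q} hp hq {e} e∈ =
    trans (∂′.D-minus (lo e) p q) (trans (+-cong (hp e∈) (-‿cong (hq e∈))) (sym (∂′.D-minus (hi e) p q)))

  ann-* : ∀ {C p q} → Annihilated C p → Annihilated C q → Annihilated C (p * q)
  ann-* {_} {p} {q} hp hq {e} e∈ =
    trans (∂-* (lo e) p q) (trans (+-cong (*-congʳ (hp e∈)) (*-congˡ (hq e∈))) (sym (∂-* (hi e) p q)))

  ann-^ : ∀ {C p} → Annihilated C p → ∀ k → Annihilated C (p ^ k)
  ann-^ hp zero    = ann-1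
  ann-^ hp (suc k) = ann-* hp (ann-^ hp k)

  ann-∂ : ∀ {C p} i → Annihilated C p → Annihilated C (∂ i p)
  ann-∂ i h {e} e∈ = trans (∂-comm (lo e) i _) (trans (∂-cong i (h e∈)) (∂-comm i (hi e) _))

  ann-δ : ∀ {C p} e → Annihilated C p → Annihilated C (δ e p)
  ann-δ e h = ann-minus (ann-∂ (lo e) h) (ann-∂ (hi e) h)

  ann-inv : ∀ {C} k → Annihilated C (inv k)
  ann-inv k {e} _ = trans (zero-at (lo e)) (sym (zero-at (hi e)))
    where
    zero-at : ∀ i → ∂ i (inv k) ≈ 0#
    zero-at i = ∂′.D-inverse i (inv-inverse k) (∂′.D-fromℕ i (suc k))

  ann-∷ : ∀ {C e p} → δ e p ≈ 0# → Annihilated C p → Annihilated (e ∷ C) p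
  ann-∷ h hs (here ≡.refl) = same-δ _ h
  ann-∷ h hs (there e∈)    = hs e∈

  ann-path : ∀ {C p u v} → Annihilated C p → Path C u v → ∂ u p ≈ ∂ v p
  ann-path h stay        = refl
  ann-path h (up e∈ q)   = trans (ann-path h q) (h e∈)
  ann-path h (down e∈ q) = trans (ann-path h q) (sym (h e∈))

  [_] : Bool → Carrier
  [ b ] = if b then 1# else 0#

  linear : (Fin (suc n) → Bool) → Carrier
  linear I = sum (λ i → if I i then x i else 0#)

  total : Carrier
  total = linear (λ _ → true)

  ∂-linear : ∀ i I → ∂ i (linear I) ≈ [ I i ]
  ∂-linear i I = trans (∂′.D-sum i term) (trans (sum-single (∂ i ∘ term) i off) on)
    where
    term : Fin (suc n) → Carrier
    term j = if I j then x j else 0#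
    off : ∀ j → i ≢ j → ∂ i (if I j then x j else 0#) ≈ 0#
    off j i≢j with I j
    ... | true  = ∂-x-other i≢j
    ... | false = ∂′.D-0 i
    on : ∂ i (if I i then x i else 0#) ≈ [ I i ]
    on with I i
    ... | true  = ∂-x-same i
    ... | false = ∂′.D-0 i

  ann-linear : ∀ {C I} → Closed C I → Annihilated C (linear I)
  ann-linear {_} {I} h {e} e∈ =
    trans (∂-linear (lo e) I) (trans (reflexive (≡.cong [_] (h e∈))) (sym (∂-linear (hi e) I)))

  ann-total : ∀ {C} → Annihilated C total
  ann-total = ann-linear {I = λ _ → true} (λ _ → ≡.refl)

  δ-linear : ∀ e I {a b} → I (lo e) ≡ a → I (hi e) ≡ b → δ e (linear I) ≈ [ a ] - [ b ]
  δ-linear e I ≡.refl ≡.refl = +-cong (∂-linear (lo e) I) (-‿cong (∂-linear (hi e) I))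

  δ-linear-same : ∀ e I → I (lo e) ≡ I (hi e) → δ e (linear I) ≈ 0#
  δ-linear-same e I eq = trans (δ-linear e I eq ≡.refl) (-‿inverseʳ _)

  origin-linear : ∀ I → AtOrigin0 (linear I)
  origin-linear I = go (λ i → if I i then x i else 0#) term
    where
    go : ∀ {k} (f : Fin k → Carrier) → (∀ i → AtOrigin0 (f i)) → AtOrigin0 (sum f)
    go {zero}  f h = origin-0
    go {suc k} f h = origin-+ (h zero) (go (f ∘ suc) (h ∘ suc))
    term : ∀ i → AtOrigin0 (if I i then x i else 0#)
    term i with I i
    ... | true  = origin-x i
    ... | false = origin-0

  -- The ideal of the graph with edges L on the vertices obtained by contracting C, inside
  -- the subring of polynomials annihilated by δ e for every e in C.
  data Ideal (C L : List E) : Carrier → Set (c ⊔ ℓ) where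
    ideal-resp  : ∀ {p q} → p ≈ q → Ideal C L p → Ideal C L q
    ideal-0     : Ideal C L 0#
    ideal-+     : ∀ {p q} → Ideal C L p → Ideal C L q → Ideal C L (p + q)
    ideal-cut   : ∀ I → Proper I → Closed C I → ∀ {q} → Annihilated C q → Ideal C L (q * linear I ^ cutSize L I)
    ideal-total : ∀ {q} → Annihilated C q → Ideal C L (q * total)

  Vanishes : List E → List E → Carrier → Set ℓ
  Vanishes = Vanishing δ AtOrigin0

  vanishes-resp : ∀ C L {p q} → p ≈ q → Vanishes C L p → Vanishes C L q
  vanishes-resp C L = vanishing-transport _≈_ δ-cong origin-resp C L

  vanishes-0 : ∀ C L → Vanishes C L 0#
  vanishes-0 C []      _ = origin-0
  vanishes-0 C (e ∷ L) = vanishes-resp C L (sym (δ′.D-0 e)) (vanishes-0 C L) , vanishes-0 (e ∷ C) L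

  vanishes-+ : ∀ C L {p q} → Vanishes C L p → Vanishes C L q → Vanishes C L (p + q)
  vanishes-+ C []      h h′ conn           = origin-+ (h conn) (h′ conn)
  vanishes-+ C (e ∷ L) (h , k) (h′ , k′) =
    vanishes-resp C L (sym (δ-+ e _ _)) (vanishes-+ C L h h′) , vanishes-+ (e ∷ C) L k k′

  origin-neg : ∀ {p} → AtOrigin0 p → AtOrigin0 (- p)
  origin-neg {p} h = origin-resp (solve 1 (λ p → (:- :1) :* p := :- p) refl p) (origin-* (- 1#) h)

  vanishes-neg : ∀ C L {p} → Vanishes C L p → Vanishes C L (- p)
  vanishes-neg C []      h conn  = origin-neg (h conn)
  vanishes-neg C (e ∷ L) (h , k) = vanishes-resp C L (sym (δ′.D-neg e _)) (vanishes-neg C L h) , vanishes-neg (e ∷ C) L k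

  δ-constant : ∀ e {q t} → δ e t ≈ 0# → δ e (q * t) ≈ δ e q * t
  δ-constant e {q} {t} h = trans (δ-* e q t) (trans (+-congˡ (trans (*-congˡ h) (zeroʳ q))) (+-identityʳ _))

  δ-power-same : ∀ e {t} → δ e t ≈ 0# → ∀ k → δ e (t ^ k) ≈ 0#
  δ-power-same e h zero    = δ′.D-1 e
  δ-power-same e {t} h (suc k) = trans (δ-constant e (δ-power-same e h k)) (trans (*-congʳ h) (zeroˡ _))

  -- Only differentiation along an edge crossing `I` can lower the exponent of `linear I`, and by
  -- one at most. The disjunction is the invariant. On the left, no crossing edge has been kept so
  -- far; if that lasts to the end, `I` is closed under the kept edges and they are not connected.
  -- On the right, some crossing edge was kept, so the exponent exceeds the number of crossing edges
  -- still to come, and a positive power of `linear I` is left to vanish at the origin.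
  vanishes-power : ∀ C L I → Proper I → ∀ k → (Closed C I × cutSize L I ≤ k) ⊎ (cutSize L I < k) →
    ∀ q → Vanishes C L (q * linear I ^ k)
  vanishes-power C [] I ((u , u∈) , (v , v∉)) k (inj₁ (closed , _)) q conn
    with ≡.trans (≡.sym u∈) (≡.trans (closed-path {I = I} closed (conn u v)) v∉)
  ... | ()
  vanishes-power C [] I _ (suc k) (inj₂ _) q _ =
    origin-resp (solve 3 (λ q t p → q :* p :* t := q :* (t :* p)) refl q (linear I) (linear I ^ k))
      (origin-* (q * linear I ^ k) (origin-linear I))
  vanishes-power C (e ∷ L) I prop k bound q with I (lo e) Bool.≟ I (hi e)
  ... | yes eq = deleted , contracted
    where
    bound′ : (Closed C I × cutSize L I ≤ k) ⊎ (cutSize L I < k)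
    bound′ = ≡.subst (λ d → (Closed C I × d ≤ k) ⊎ (d < k)) (cutSize-same L I eq) bound
    deleted : Vanishes C L (δ e (q * linear I ^ k))
    deleted = vanishes-resp C L (sym (δ-constant e (δ-power-same e (δ-linear-same e I eq) k)))
      (vanishes-power C L I prop k bound′ (δ e q))
    contracted : Vanishes (e ∷ C) L (q * linear I ^ k)
    contracted = vanishes-power (e ∷ C) L I prop k
      (Sum.map₁ (λ (closed , le) → closed-∷ {I = I} eq closed , le) bound′) q
  ... | no neq = deleted k bound′ , vanishes-power (e ∷ C) L I prop k (inj₂ (strict bound′)) q
    where
    bound′ : (Closed C I × suc (cutSize L I) ≤ k) ⊎ (suc (cutSize L I) < k)
    bound′ = ≡.subst (λ d → (Closed C I × d ≤ k) ⊎ (d < k)) (cutSize-different L I neq) bound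
    strict : (Closed C I × suc (cutSize L I) ≤ k) ⊎ (suc (cutSize L I) < k) → cutSize L I < k
    strict (inj₁ (_ , le)) = le
    strict (inj₂ lt)       = ℕP.<⇒≤ lt
    deleted : ∀ k → (Closed C I × suc (cutSize L I) ≤ k) ⊎ (suc (cutSize L I) < k) → Vanishes C L (δ e (q * linear I ^ k))
    deleted zero    (inj₂ ())
    deleted (suc k) bound = vanishes-resp C L (sym (begin
      δ e (q * linear I ^ suc k)
        ≈⟨ trans (δ-* e q _) (+-congˡ (*-congˡ (δ′.D-^ e (linear I) k))) ⟩
      δ e q * (linear I * linear I ^ k) + q * (fromℕ A (suc k) * (linear I ^ k * δ e (linear I)))
        ≈⟨ solve 6 (λ u t p q m d → u :* (t :* p) :+ q :* (m :* (p :* d)) := (u :* t :+ q :* (m :* d)) :* p) refl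
             (δ e q) (linear I) (linear I ^ k) q (fromℕ A (suc k)) (δ e (linear I)) ⟩
      (δ e q * linear I + q * (fromℕ A (suc k) * δ e (linear I))) * linear I ^ k ∎))
      (vanishes-power C L I prop k (Sum.map (λ { (closed , s≤s le) → closed , le }) ℕP.≤-pred bound) _)

  vanishes-total : ∀ C L q → Vanishes C L (q * total)
  vanishes-total C []      q _ = origin-* q (origin-linear (λ _ → true))
  vanishes-total C (e ∷ L) q =
    vanishes-resp C L (sym (δ-constant e (δ-linear-same e (λ _ → true) ≡.refl))) (vanishes-total C L (δ e q)) ,
    vanishes-total (e ∷ C) L q

  -- The easy inclusion. The converse uses it too: it shows that subtracting an element of the ideal
  -- preserves the vanishing condition.
  ideal-vanishes : ∀ {C L p} → Ideal C L p → Vanishes C L p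
  ideal-vanishes {C} {L} (ideal-resp p≈q h)            = vanishes-resp C L p≈q (ideal-vanishes h)
  ideal-vanishes {C} {L} ideal-0                       = vanishes-0 C L
  ideal-vanishes {C} {L} (ideal-+ h h′)                = vanishes-+ C L (ideal-vanishes h) (ideal-vanishes h′)
  ideal-vanishes {C} {L} (ideal-cut I prop closed {q} _) = vanishes-power C L I prop (cutSize L I) (inj₁ (closed , ℕP.≤-refl)) q
  ideal-vanishes {C} {L} (ideal-total {q} _)           = vanishes-total C L q

  ideal-annihilated : ∀ {C L p} → Ideal C L p → Annihilated C p
  ideal-annihilated (ideal-resp p≈q h)          = ann-resp p≈q (ideal-annihilated h)
  ideal-annihilated ideal-0                     = ann-0
  ideal-annihilated (ideal-+ h h′)              = ann-+ (ideal-annihilated h) (ideal-annihilated h′)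
  ideal-annihilated {L = L} (ideal-cut I _ closed h) = ann-* h (ann-^ (ann-linear {I = I} closed) (cutSize L I))
  ideal-annihilated (ideal-total h)             = ann-* h ann-total

  -- A vertex set closed under `e` is not crossed by `e`, so counting `e` among the edges again
  -- leaves the exponents unchanged, and the coefficients have one condition fewer to meet.
  ideal-uncontract : ∀ {C L e p} → Ideal (e ∷ C) L p → Ideal C (e ∷ L) p
  ideal-uncontract (ideal-resp p≈q h) = ideal-resp p≈q (ideal-uncontract h)
  ideal-uncontract ideal-0            = ideal-0
  ideal-uncontract (ideal-+ h h′)     = ideal-+ (ideal-uncontract h) (ideal-uncontract h′)
  ideal-uncontract {C} {L} {e} (ideal-cut I prop closed {q} h) =
    ≡.subst (λ d → Ideal C (e ∷ L) (q * linear I ^ d)) (cutSize-same L I (closed (here ≡.refl)))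
      (ideal-cut I prop (closed ∘ there) (h ∘ there))
  ideal-uncontract (ideal-total h)    = ideal-total (h ∘ there)

  ∂-[] : ∀ i b → ∂ i [ b ] ≈ 0#
  ∂-[] i true  = ∂′.D-1 i
  ∂-[] i false = ∂′.D-0 i

  sign : Bool → Bool → Carrier
  sign a b = [ a ] - [ b ]

  ∂-sign : ∀ i a b → ∂ i (sign a b) ≈ 0#
  ∂-sign i a b = trans (∂′.D-minus i [ a ] [ b ]) (trans (+-cong (∂-[] i a) (-‿cong (∂-[] i b))) (-‿inverseʳ 0#))

  sign-sign : ∀ {a b} → a ≢ b → sign a b * sign a b ≈ 1#
  sign-sign {true}  {true}  a≢b = ⊥-elim (a≢b ≡.refl)
  sign-sign {false} {false} a≢b = ⊥-elim (a≢b ≡.refl)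
  sign-sign {true}  {false} _   = solve 1 (λ z → (:1 :- :0) :* (:1 :- :0) := :1) refl 0#
  sign-sign {false} {true}  _   = solve 1 (λ z → (:0 :- :1) :* (:0 :- :1) := :1) refl 0#

  -- Because `e` crosses `I`, the derivative of `linear I` along `e` is a sign ±1, so `linear I` can
  -- be the variable of integration. Closedness of `I` under `C` puts that variable, and hence the
  -- result, in the subring of the contraction.
  integrate-δ : ∀ C e I → Closed C I → I (lo e) ≢ I (hi e) → ∀ d {q} → Annihilated C q →
    ∃ λ r → Annihilated C r × δ e (r * linear I ^ suc d) ≈ q * linear I ^ d
  integrate-δ C e I closed cut d {q} ann = integrate (proj₁ (degree-bound q)) d (proj₂ (degree-bound q)) ann
    where
    ε = sign (I (lo e)) (I (hi e))
    ∂-ε : ∀ i → ∂ i ε ≈ 0#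
    ∂-ε i = ∂-sign i (I (lo e)) (I (hi e))
    ann-ε : Annihilated C ε
    ann-ε {f} _ = trans (∂-ε (lo f)) (sym (∂-ε (hi f)))
    δ-degree : ∀ {k p} → Degree< (suc k) p → Degree< k (δ e p)
    δ-degree h = degree-minus (degree-∂ (lo e) h) (degree-∂ (hi e) h)
    open δ′.Integration e (Annihilated C) ann-0 ann-* ann-minus (ann-δ e) inv inv-inverse ann-inv
      Degree< degree-zero δ-degree (linear I) ε (δ-linear e I ≡.refl ≡.refl) (sign-sign cut)
      (δ-same e (trans (∂-ε (lo e)) (sym (∂-ε (hi e))))) (ann-linear {I = I} closed) ann-ε

  antiderivative : ∀ C e I → Closed C I → I (lo e) ≢ I (hi e) → ∀ {q} → Annihilated C q →
    ∃ λ r → Annihilated C r × δ e r ≈ q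
  antiderivative C e I closed cut {q} ann =
    let r , ann-r , eq = integrate-δ C e I closed cut 0 {q} ann
    in r * linear I ^ 1 , ann-* {p = r} {linear I ^ 1} ann-r (ann-^ {p = linear I} (ann-linear {I = I} closed) 1) , trans eq (*-identityʳ q)

  -- If `e` crosses the set of a generator, integrating raises the exponent by one, which is the
  -- exponent that the graph with `e` prescribes. Otherwise, and for `total`, the generator is
  -- constant along `e` and only its coefficient is integrated, with `linear I₀` as the variable.
  -- Such an `I₀` exists exactly when `e` is not a loop of the contraction.
  integrate-ideal : ∀ {C L} e I₀ → Closed C I₀ → I₀ (lo e) ≢ I₀ (hi e) → ∀ {q} → Ideal C L q →
    ∃ λ p → Ideal C (e ∷ L) p × δ e p ≈ q
  integrate-ideal e I₀ closed₀ cut₀ (ideal-resp p≈q h) =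
    let p , p∈ , eq = integrate-ideal e I₀ closed₀ cut₀ h
    in p , p∈ , trans eq p≈q
  integrate-ideal e I₀ closed₀ cut₀ ideal-0 = 0# , ideal-0 , δ′.D-0 e
  integrate-ideal e I₀ closed₀ cut₀ (ideal-+ h h′) =
    let p , p∈ , eq = integrate-ideal e I₀ closed₀ cut₀ h
        p′ , p′∈ , eq′ = integrate-ideal e I₀ closed₀ cut₀ h′
    in p + p′ , ideal-+ p∈ p′∈ , trans (δ-+ e p p′) (+-cong eq eq′)
  integrate-ideal {C} {L} e I₀ closed₀ cut₀ (ideal-cut I prop closed {q} ann) = by-cases (I (lo e) Bool.≟ I (hi e))
    where
    by-cases : Dec (I (lo e) ≡ I (hi e)) → ∃ λ p → Ideal C (e ∷ L) p × δ e p ≈ q * linear I ^ cutSize L I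
    by-cases (yes eq) =
      let r , ann-r , δr≈q = antiderivative C e I₀ closed₀ cut₀ {q} ann
      in r * linear I ^ cutSize L I ,
         ≡.subst (λ d → Ideal C (e ∷ L) (r * linear I ^ d)) (cutSize-same L I eq) (ideal-cut I prop closed ann-r) ,
         trans (δ-constant e (δ-power-same e (δ-linear-same e I eq) (cutSize L I))) (*-congʳ δr≈q)
    by-cases (no neq) =
      let r , ann-r , eq = integrate-δ C e I closed neq (cutSize L I) {q} ann
      in r * linear I ^ suc (cutSize L I) ,
         ≡.subst (λ d → Ideal C (e ∷ L) (r * linear I ^ d)) (cutSize-different L I neq) (ideal-cut I prop closed ann-r) ,
         eq
  integrate-ideal {C} e I₀ closed₀ cut₀ (ideal-total {q} ann) =
    let r , ann-r , δr≈q = antiderivative C e I₀ closed₀ cut₀ {q} ann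
    in r * total , ideal-total ann-r , trans (δ-constant e (δ-linear-same e (λ _ → true) ≡.refl)) (*-congʳ δr≈q)

  -- The contracted graph has one vertex, so all partial derivatives of `p` agree. Integrating one
  -- of them along `total` gives r · total with the same derivatives as `p`; the difference also
  -- vanishes at the origin, hence is zero.
  connected-ideal : ∀ {C p} → Connected C → Annihilated C p → AtOrigin0 p → Ideal C [] p
  connected-ideal {C} {p} conn ann origin = conclude (integrate (proj₁ (degree-bound (∂ zero p))) 0 (proj₂ (degree-bound (∂ zero p))) (ann-∂ zero ann))
    where
    open ∂′.Integration zero (Annihilated C) ann-0 ann-* ann-minus (ann-∂ zero) inv inv-inverse ann-inv
      Degree< degree-zero (degree-∂ zero) total 1# (∂-linear zero (λ _ → true)) (*-identityʳ 1#) (∂′.D-1 zero) ann-total ann-1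
    conclude : (∃ λ r → Annihilated C r × ∂ zero (r * total ^ 1) ≈ ∂ zero p * total ^ 0) → Ideal C [] p
    conclude (r , ann-r , eq) = ideal-resp (sym p≈) (ideal-total ann-r)
      where
      rest = p - r * total
      ann-rest : Annihilated C rest
      ann-rest = ann-minus ann (ann-* ann-r ann-total)
      ∂0-rest : ∂ zero rest ≈ 0#
      ∂0-rest = begin
        ∂ zero (p - r * total)                    ≈⟨ ∂′.D-minus zero p (r * total) ⟩
        ∂ zero p - ∂ zero (r * total)             ≈⟨ +-congˡ (-‿cong (∂-cong zero (*-congˡ (*-identityʳ total)))) ⟨
        ∂ zero p - ∂ zero (r * (total * 1#))      ≈⟨ +-congˡ (-‿cong (trans eq (*-identityʳ _))) ⟩
        ∂ zero p - ∂ zero p                       ≈⟨ -‿inverseʳ _ ⟩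
        0#                                        ∎
      p≈ : p ≈ r * total
      p≈ = begin
        p                       ≈⟨ solve 2 (λ p s → p := (p :- s) :+ s) refl p (r * total) ⟩
        rest + r * total        ≈⟨ +-congʳ (constant-zero (λ i → trans (ann-path ann-rest (conn i zero)) ∂0-rest)
                                     (origin-+ origin (origin-neg (origin-* r (origin-linear (λ _ → true)))))) ⟩
        0# + r * total          ≈⟨ +-identityˡ _ ⟩
        r * total               ∎

  -- The first half of the condition at `e` is the condition on `δ e p` for the deletion, and the
  -- second half is the condition on `p` for the contraction.
  vanishes-ideal : ∀ C L {p} → Annihilated C p → Vanishes C L p → Ideal C L p
  vanishes-ideal C [] {p} ann h with connected-or-cut C
  ... | inj₁ conn                = connected-ideal conn ann (h conn)
  -- With no edges left, the closed proper set `I` has cut size 0, so its generator is 1 and every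
  -- annihilated polynomial lies in the ideal.
  ... | inj₂ (I , prop , closed) = ideal-resp (*-identityʳ p) (ideal-cut I prop closed ann)
  vanishes-ideal C (e ∷ L) {p} ann (h , k) = by-cases (Component.member I₀ (hi e)) ≡.refl
    where
    I₀ = component C (lo e)
    open Component I₀
    by-cases : ∀ b → member (hi e) ≡ b → Ideal C (e ∷ L) p
    -- Here `e` is a loop of the contraction: its ends are joined by `C`, so `δ e` already kills
    -- `p`.
    by-cases true eq = ideal-uncontract (vanishes-ideal (e ∷ C) L
      (ann-∷ (δ-same e (ann-path ann (reachable (hi e) eq))) ann) k)
    by-cases false eq = remainder (integrate-ideal e member closed separated (vanishes-ideal C L (ann-δ e ann) h))
      where
      separated : member (lo e) ≢ member (hi e)
      separated same with ≡.trans (≡.sym root) (≡.trans same eq)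
      ... | ()
      remainder : (∃ λ p′ → Ideal C (e ∷ L) p′ × δ e p′ ≈ δ e p) → Ideal C (e ∷ L) p
      -- The difference p - p′ is killed by `δ e` and so belongs to the contraction. It satisfies
      -- the contraction half of the condition because `p` does by hypothesis and p′ does as an
      -- element of the ideal.
      remainder (p′ , p′∈ , δp′≈δp) = ideal-resp (solve 2 (λ p p′ → (p :- p′) :+ p′ := p) refl p p′)
        (ideal-+ (ideal-uncontract (vanishes-ideal (e ∷ C) L (ann-∷ δ-rest (ann-minus ann (ideal-annihilated p′∈)))
          (vanishes-+ (e ∷ C) L k (vanishes-neg (e ∷ C) L (proj₂ (ideal-vanishes p′∈)))))) p′∈)
        where
        δ-rest : δ e (p - p′) ≈ 0#
        δ-rest = trans (δ′.D-minus e p p′) (trans (+-congˡ (-‿cong δp′≈δp)) (-‿inverseʳ _))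

-- Ideals, quotient rings and the abstract polynomial interface

record RingIdeal {c ℓ : Level} (A : CommutativeRing c ℓ) (a : Level) : Set (c ⊔ ℓ ⊔ Level.suc a) where
  open CommutativeRing A
  field
    Member      : Carrier → Set a
    member-resp : ∀ {p q} → p ≈ q → Member p → Member q
    member-0    : Member 0#
    member-+    : ∀ {p q} → Member p → Member q → Member (p + q)
    member-*    : ∀ r {p} → Member p → Member (r * p)

module Quotient {c ℓ a : Level} (A : CommutativeRing c ℓ) (ideal : RingIdeal A a) where
  open CommutativeRing A
  open RingIdeal ideal
  open IntegerSolver A

  infix 4 _~_
  _~_ : Carrier → Carrier → Set a
  p ~ q = Member (p - q)

  ≈⇒~ : ∀ {p q} → p ≈ q → p ~ q
  ≈⇒~ {p} {q} p≈q = member-resp (sym (trans (+-congʳ p≈q) (-‿inverseʳ q))) member-0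

  ~-member : ∀ {p q} → p ~ q → Member q → Member p
  ~-member {p} {q} p~q q∈ = member-resp (solve 2 (λ p q → (p :- q) :+ q := p) refl p q) (member-+ p~q q∈)

  member⇒~0 : ∀ {p} → Member p → p ~ 0#
  member⇒~0 {p} = member-resp (solve 1 (λ p → p := p :- :0) refl p)

  ~0⇒member : ∀ {p} → p ~ 0# → Member p
  ~0⇒member {p} = member-resp (solve 1 (λ p → p :- :0 := p) refl p)

  ~-sym : ∀ {p q} → p ~ q → q ~ p
  ~-sym {p} {q} h = member-resp (solve 2 (λ p q → (:- :1) :* (p :- q) := q :- p) refl p q) (member-* (- 1#) h)

  ~-trans : ∀ {p q r} → p ~ q → q ~ r → p ~ r
  ~-trans {p} {q} {r} h k = member-resp (solve 3 (λ p q r → (p :- q) :+ (q :- r) := p :- r) refl p q r) (member-+ h k)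

  +-~ : ∀ {p p′ q q′} → p ~ p′ → q ~ q′ → p + q ~ p′ + q′
  +-~ {p} {p′} {q} {q′} h k = member-resp
    (solve 4 (λ p p′ q q′ → (p :- p′) :+ (q :- q′) := (p :+ q) :- (p′ :+ q′)) refl p p′ q q′) (member-+ h k)

  *-~ : ∀ {p p′ q q′} → p ~ p′ → q ~ q′ → p * q ~ p′ * q′
  *-~ {p} {p′} {q} {q′} h k = member-resp
    (solve 4 (λ p p′ q q′ → q :* (p :- p′) :+ p′ :* (q :- q′) := p :* q :- p′ :* q′) refl p p′ q q′)
    (member-+ (member-* q h) (member-* p′ k))

  neg-~ : ∀ {p q} → p ~ q → - p ~ - q
  neg-~ {p} {q} h = member-resp (solve 2 (λ p q → (:- :1) :* (p :- q) := (:- p) :- (:- q)) refl p q) (member-* (- 1#) h)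

  quotientRing : CommutativeRing c a
  quotientRing = record
    { Carrier = Carrier
    ; _≈_     = _~_
    ; _+_     = _+_
    ; _*_     = _*_
    ; -_      = -_
    ; 0#      = 0#
    ; 1#      = 1#
    ; isCommutativeRing = record
      { isRing = record
        { +-isAbelianGroup = record
          { isGroup = record
            { isMonoid = record
              { isSemigroup = record
                { isMagma = record
                  { isEquivalence = record { refl = ≈⇒~ refl ; sym = ~-sym ; trans = ~-trans }
                  ; ∙-cong = +-~
                  }
                ; assoc = λ p q r → ≈⇒~ (+-assoc p q r)
                }
              ; identity = (λ p → ≈⇒~ (+-identityˡ p)) , (λ p → ≈⇒~ (+-identityʳ p))
              }
            ; inverse = (λ p → ≈⇒~ (-‿inverseˡ p)) , (λ p → ≈⇒~ (-‿inverseʳ p))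
            ; ⁻¹-cong = neg-~
            }
          ; comm = λ p q → ≈⇒~ (+-comm p q)
          }
        ; *-cong = *-~
        ; *-assoc = λ p q r → ≈⇒~ (*-assoc p q r)
        ; *-identity = (λ p → ≈⇒~ (*-identityˡ p)) , (λ p → ≈⇒~ (*-identityʳ p))
        ; distrib = (λ p q r → ≈⇒~ (distribˡ p q r)) , (λ p q r → ≈⇒~ (distribʳ p q r))
        }
      ; *-comm = λ p q → ≈⇒~ (*-comm p q)
      }
    }

  open import Algebra.Properties.Semiring.Exp semiring using (_^_)
  open import Algebra.Properties.Semiring.Exp (CommutativeRing.semiring quotientRing) using () renaming (_^_ to _^~_)

  ^-quotient : ∀ p k → p ^~ k ≡ p ^ k
  ^-quotient p ℕ.zero    = ≡.refl
  ^-quotient p (ℕ.suc k) = ≡.cong (p *_) (^-quotient p k)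

  fromℕ-quotient : ∀ k → fromℕ quotientRing k ≡ fromℕ A k
  fromℕ-quotient ℕ.zero    = ≡.refl
  fromℕ-quotient (ℕ.suc k) = ≡.cong (1# +_) (fromℕ-quotient k)

-- Polynomial rings as an abstract interface: Agda can then infer the two sides of an equation,
-- which the coefficientwise equality _≈ₚ_ does not determine.
record PolynomialAlgebras (c ℓ s : Level) : Set (Level.suc (c ⊔ ℓ ⊔ s)) where
  field
    A        : ℕ → CommutativeRing c ℓ
    calculus : ∀ m → DifferentialPolynomials (A m) m
    Scalar   : Set s
    con      : ∀ {m} → Scalar → CommutativeRing.Carrier (A m)
    subst    : ∀ {k m} → CommutativeRing.Carrier (A k) → (Fin k → CommutativeRing.Carrier (A m)) → CommutativeRing.Carrier (A m)
  private
    module A {m : ℕ} = CommutativeRing (A m)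
    module D {m : ℕ} = DifferentialPolynomials (calculus m)
  open A
  open D
  field
    ∂-con        : ∀ {m} (i : Fin m) a → ∂ i (con a) ≈ 0#
    subst-cong   : ∀ {k m} {p q : Carrier {k}} (v : Fin k → Carrier {m}) → p ≈ q → subst p v ≈ subst q v
    subst-+      : ∀ {k m} (p q : Carrier {k}) (v : Fin k → Carrier {m}) → subst (p + q) v ≈ subst p v + subst q v
    subst-*      : ∀ {k m} (p q : Carrier {k}) (v : Fin k → Carrier {m}) → subst (p * q) v ≈ subst p v * subst q v
    subst-0      : ∀ {k m} (v : Fin k → Carrier {m}) → subst 0# v ≈ 0#
    subst-1      : ∀ {k m} (v : Fin k → Carrier {m}) → subst 1# v ≈ 1#
    subst-con    : ∀ {k m} a (v : Fin k → Carrier {m}) → subst (con a) v ≈ con a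
    subst-x      : ∀ {k m} i (v : Fin k → Carrier {m}) → subst (x i) v ≈ v i
    origin-subst : ∀ {k m} (p : Carrier {k}) (v : Fin k → Carrier {m}) →
      (∀ i → AtOrigin0 (v i)) → AtOrigin0 (subst p v) → AtOrigin0 p
    induction    : ∀ {m} (Q : Carrier {m} → Set (c ⊔ ℓ)) → (∀ {p q} → p ≈ q → Q p → Q q) →
      (∀ a → Q (con a)) → (∀ i → Q (x i)) →
      (∀ {p q} → Q p → Q q → Q (p + q)) → (∀ {p q} → Q p → Q q → Q (p * q)) → ∀ p → Q p

-- Powers of signed sums of square-zero elements

module SquareZero {c ℓ : Level} (R : CommutativeRing c ℓ) {E : Set} (φ sgn : E → CommutativeRing.Carrier R)
  (φ-square : ∀ e → CommutativeRing._≈_ R (CommutativeRing._*_ R (φ e) (φ e)) (CommutativeRing.0# R))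
  (cut : E → Bool) (sgn-uncut : ∀ e → cut e ≡ false → CommutativeRing._≈_ R (sgn e) (CommutativeRing.0# R))
  where
  open CommutativeRing R hiding (zero)
  open IntegerSolver R
  open import Algebra.Properties.Semiring.Exp semiring using (_^_; ^-congˡ)
  open import Relation.Binary.Reasoning.Setoid setoid

  signedSum : List E → Carrier
  signedSum []      = 0#
  signedSum (e ∷ L) = sgn e * φ e + signedSum L

  cutProduct : List E → Carrier
  cutProduct []      = 1#
  cutProduct (e ∷ L) = (if cut e then φ e else 1#) * cutProduct L

  cutCount : List E → ℕ
  cutCount L = NL.sum (List.map (λ e → if cut e then 1 else 0) L)

  -- The binomial expansion stops after the term linear in `a`; the witness is k + 1.
  squareZero-power : ∀ {a} b → a * a ≈ 0# → ∀ k → ∃ λ s → (a + b) ^ suc k ≈ b * b ^ k + s * (a * b ^ k)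
  squareZero-power {a} b a²≈0 zero    = 1# , solve 2 (λ a b → (a :+ b) :* :1 := b :* :1 :+ :1 :* (a :* :1)) refl a b
  squareZero-power {a} b a²≈0 (suc k) with squareZero-power b a²≈0 k
  ... | s , eq = 1# + s , (begin
    (a + b) * (a + b) ^ suc k                         ≈⟨ *-congˡ eq ⟩
    (a + b) * (b * b ^ k + s * (a * b ^ k))
      ≈⟨ solve 4 (λ a b p s → (a :+ b) :* (b :* p :+ s :* (a :* p))
           := (b :* (b :* p) :+ (:1 :+ s) :* (a :* (b :* p))) :+ (a :* a) :* (s :* p)) refl a b (b ^ k) s ⟩
    (b * (b * b ^ k) + (1# + s) * (a * (b * b ^ k))) + a * a * (s * b ^ k)
      ≈⟨ +-congˡ (trans (*-congʳ a²≈0) (zeroˡ _)) ⟩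
    (b * (b * b ^ k) + (1# + s) * (a * (b * b ^ k))) + 0#   ≈⟨ +-identityʳ _ ⟩
    b * (b * b ^ k) + (1# + s) * (a * (b * b ^ k))          ∎)

  -- Adding a cut edge to a sum b with d cut edges and expanding leaves the term b^(d+1), one power
  -- beyond what the induction hypothesis describes. The second component, proved along with the
  -- first, kills it: each summand of b contains a square-zero factor that already occurs in the
  -- product.
  signedSum-power : ∀ L → (∃ λ r → signedSum L ^ cutCount L ≈ r * cutProduct L) × signedSum L * cutProduct L ≈ 0#
  signedSum-power [] = (1# , sym (*-identityʳ 1#)) , zeroˡ 1#
  signedSum-power (e ∷ L) with signedSum-power L | cut e in eq
  ... | (r , power) , annihilates | false = (r , (begin
      signedSum (e ∷ L) ^ cutCount L      ≈⟨ ^-congˡ (cutCount L) drop ⟩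
      signedSum L ^ cutCount L            ≈⟨ power ⟩
      r * cutProduct L                    ≈⟨ *-congˡ (*-identityˡ _) ⟨
      r * (1# * cutProduct L)             ∎)) , (begin
      signedSum (e ∷ L) * (1# * cutProduct L)   ≈⟨ *-cong drop (*-identityˡ _) ⟩
      signedSum L * cutProduct L                ≈⟨ annihilates ⟩
      0#                                        ∎)
    where
    drop : signedSum (e ∷ L) ≈ signedSum L
    drop = trans (+-congʳ (trans (*-congʳ (sgn-uncut e eq)) (zeroˡ _))) (+-identityˡ _)
  ... | (r , power) , annihilates | true = added (squareZero-power b a²≈0 (cutCount L)) , (begin
      (a + b) * (φ e * cutProduct L)
        ≈⟨ solve 4 (λ s f b p → (s :* f :+ b) :* (f :* p) := s :* p :* (f :* f) :+ f :* (b :* p)) refl (sgn e) (φ e) b (cutProduct L) ⟩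
      sgn e * cutProduct L * (φ e * φ e) + φ e * (b * cutProduct L)
        ≈⟨ +-cong (trans (*-congˡ (φ-square e)) (zeroʳ _)) (trans (*-congˡ annihilates) (zeroʳ _)) ⟩
      0# + 0#     ≈⟨ +-identityʳ 0# ⟩
      0#          ∎)
    where
    a = sgn e * φ e
    b = signedSum L
    a²≈0 : a * a ≈ 0#
    a²≈0 = begin
      sgn e * φ e * (sgn e * φ e)     ≈⟨ solve 2 (λ s f → s :* f :* (s :* f) := s :* s :* (f :* f)) refl (sgn e) (φ e) ⟩
      sgn e * sgn e * (φ e * φ e)     ≈⟨ trans (*-congˡ (φ-square e)) (zeroʳ _) ⟩
      0#                              ∎
    added : (∃ λ s → (a + b) ^ suc (cutCount L) ≈ b * b ^ cutCount L + s * (a * b ^ cutCount L)) →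
      ∃ λ r → (a + b) ^ suc (cutCount L) ≈ r * (φ e * cutProduct L)
    added (s , expand) = s * sgn e * r , (begin
      (a + b) ^ suc (cutCount L)                          ≈⟨ expand ⟩
      b * b ^ cutCount L + s * (a * b ^ cutCount L)       ≈⟨ +-cong (*-congˡ power) (*-congˡ (*-congˡ power)) ⟩
      b * (r * cutProduct L) + s * (a * (r * cutProduct L))
        ≈⟨ solve 6 (λ b r p s g f → b :* (r :* p) :+ s :* (g :* f :* (r :* p)) := r :* (b :* p) :+ s :* g :* r :* (f :* p))
             refl b r (cutProduct L) s (sgn e) (φ e) ⟩
      r * (b * cutProduct L) + s * sgn e * r * (φ e * cutProduct L)
        ≈⟨ trans (+-congʳ (trans (*-congˡ annihilates) (zeroʳ r))) (+-identityˡ _) ⟩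
      s * sgn e * r * (φ e * cutProduct L)                ∎)

-- Substitution as a ring homomorphism

module Substitution {c ℓ s : Level} (algebras : PolynomialAlgebras c ℓ s) where
  open PolynomialAlgebras algebras
  private
    module R {m : ℕ} = CommutativeRing (A m)
    module D {m : ℕ} = DifferentialPolynomials (calculus m)
    module S {m : ℕ} = Algebra.Properties.Semiring.Exp (R.semiring {m})
    module Sum₊ {m : ℕ} = Algebra.Properties.Monoid.Sum (R.+-monoid {m})
    module Sum* {m : ℕ} = Algebra.Properties.Monoid.Sum (R.*-monoid {m})
    module I {m : ℕ} = IntegerSolver (A m)
  open R hiding (zero)
  open D using (x)
  open S using (_^_)
  open Sum₊ using (sum)
  open Sum* using () renaming (sum to product)
  open I using (solve; _:=_; _:+_; _:-_)

  subst-neg : ∀ {k m} (p : Carrier {k}) (v : Fin k → Carrier {m}) → subst (- p) v ≈ - subst p v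
  subst-neg p v = trans (solve 2 (λ a b → b := (a :+ b) :- a) refl (subst p v) (subst (- p) v))
    (trans (+-congʳ (trans (sym (subst-+ p (- p) v)) (trans (subst-cong v (-‿inverseʳ p)) (subst-0 v)))) (+-identityˡ _))

  subst-minus : ∀ {k m} (p q : Carrier {k}) (v : Fin k → Carrier {m}) → subst (p - q) v ≈ subst p v - subst q v
  subst-minus p q v = trans (subst-+ p (- q) v) (+-congˡ (subst-neg q v))

  subst-^ : ∀ {k m} (p : Carrier {k}) (v : Fin k → Carrier {m}) d → subst (p ^ d) v ≈ subst p v ^ d
  subst-^ p v zero    = subst-1 v
  subst-^ p v (suc d) = trans (subst-* p (p ^ d) v) (*-congˡ (subst-^ p v d))

  subst-sum : ∀ {k m d} (f : Fin d → Carrier {k}) (v : Fin k → Carrier {m}) → subst (sum f) v ≈ sum (λ i → subst (f i) v)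
  subst-sum {d = zero}  f v = subst-0 v
  subst-sum {d = suc d} f v = trans (subst-+ _ _ v) (+-congˡ (subst-sum (f ∘ suc) v))

  subst-product : ∀ {k m d} (f : Fin d → Carrier {k}) (v : Fin k → Carrier {m}) →
    subst (product f) v ≈ product (λ i → subst (f i) v)
  subst-product {d = zero}  f v = subst-1 v
  subst-product {d = suc d} f v = trans (subst-* _ _ v) (*-congˡ (subst-product (f ∘ suc) v))

  subst-subst : ∀ {j k m} (p : Carrier {j}) (v : Fin j → Carrier {k}) (w : Fin k → Carrier {m}) →
    subst (subst p v) w ≈ subst p (λ i → subst (v i) w)
  subst-subst {j} {k} {m} p v w = lower (induction Q
    (λ p≈q (lift h) → lift (trans (subst-cong w (subst-cong v (sym p≈q))) (trans h (subst-cong vw p≈q))))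
    (λ a → lift (trans (subst-cong w (subst-con a v)) (trans (subst-con a w) (sym (subst-con a vw)))))
    (λ i → lift (trans (subst-cong w (subst-x i v)) (sym (subst-x i vw))))
    (λ {p} {q} (lift h) (lift k) → lift (trans (subst-cong w (subst-+ p q v)) (trans (subst-+ _ _ w) (trans (+-cong h k) (sym (subst-+ p q vw))))))
    (λ {p} {q} (lift h) (lift k) → lift (trans (subst-cong w (subst-* p q v)) (trans (subst-* _ _ w) (trans (*-cong h k) (sym (subst-* p q vw))))))
    p)
    where
    vw : Fin j → Carrier {m}
    vw i = subst (v i) w
    Q : Carrier {j} → Set (c ⊔ ℓ)
    Q p = Lift c (subst (subst p v) w ≈ subst p vw)

  subst-identity : ∀ {m} (p : Carrier {m}) → subst p x ≈ p
  subst-identity {m} p = lower (induction Q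
    (λ p≈q (lift h) → lift (trans (subst-cong x (sym p≈q)) (trans h p≈q)))
    (λ a → lift (subst-con a x))
    (λ i → lift (subst-x i x))
    (λ {p} {q} (lift h) (lift k) → lift (trans (subst-+ p q x) (+-cong h k)))
    (λ {p} {q} (lift h) (lift k) → lift (trans (subst-* p q x) (*-cong h k)))
    p)
    where
    Q : Carrier {m} → Set (c ⊔ ℓ)
    Q p = Lift c (subst p x ≈ p)

  module _ {m : ℕ} (ideal : RingIdeal (A m) (c ⊔ ℓ)) where
    open Quotient (A m) ideal

    subst-~ : ∀ {k} (p : Carrier {k}) {v w : Fin k → Carrier {m}} → (∀ i → v i ~ w i) → subst p v ~ subst p w
    subst-~ {k} p {v} {w} v~w = induction Q
      (λ p≈q h → ~-trans (≈⇒~ (subst-cong v (sym p≈q))) (~-trans h (≈⇒~ (subst-cong w p≈q))))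
      (λ a → ≈⇒~ (trans (subst-con a v) (sym (subst-con a w))))
      (λ i → ~-trans (≈⇒~ (subst-x i v)) (~-trans (v~w i) (≈⇒~ (sym (subst-x i w)))))
      (λ {p} {q} h k → ~-trans (≈⇒~ (subst-+ p q v)) (~-trans (+-~ h k) (≈⇒~ (sym (subst-+ p q w)))))
      (λ {p} {q} h k → ~-trans (≈⇒~ (subst-* p q v)) (~-trans (*-~ h k) (≈⇒~ (sym (subst-* p q w)))))
      p
      where
      Q : Carrier {k} → Set (c ⊔ ℓ)
      Q p = subst p v ~ subst p w

-- Comparison of the multiplicative and the additive relations

module GraphSigns {c ℓ : Level} (R : CommutativeRing c ℓ) {V E : Set} (_≟_ : (u v : V) → Dec (u ≡ v)) (lo hi : E → V) where
  open CommutativeRing R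

  -- The sign c_{i,e}, taken in the polynomial ring itself because the scalars of the abstract
  -- interface carry no arithmetic.
  incidence : V → E → Carrier
  incidence i e = if does (lo e ≟ i) then 1# else (if does (hi e ≟ i) then - 1# else 0#)

-- `Φ-square` and `Φ-cut` bound `Φ` from below and `Φ-vanishing` bounds it from above; for `D` the
-- upper bound is `D-least`. Of the squarefree relations only those of edge cuts are recorded.
-- Vertex sets are Boolean functions, to match the components computed above.
record GraphIdeals {c ℓ s : Level} (algebras : PolynomialAlgebras c ℓ s) {n m : ℕ} (lo hi : Fin m → Fin (suc n)) :
  Set (Level.suc (c ⊔ ℓ ⊔ s)) where
  open PolynomialAlgebras algebras
  private
    module P = CommutativeRing (A (suc n))
    module F = CommutativeRing (A m)
    module DP = DifferentialPolynomials (calculus (suc n))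
    module DF = DifferentialPolynomials (calculus m)
  open Connectivity lo hi
  open GraphSigns (A m) Fin._≟_ lo hi
  open Algebra.Properties.Monoid.Sum P.*-monoid using () renaming (sum to productᴾ)
  open Algebra.Properties.Monoid.Sum F.*-monoid using () renaming (sum to productᶠ)
  open Algebra.Properties.Semiring.Exp P.semiring using (_^_)

  monomial : (Fin (suc n) → Bool) → P.Carrier
  monomial I = productᴾ (λ i → if I i then DP.x i else P.1#)

  field
    lo≢hi       : ∀ e → lo e ≢ hi e
    Y           : Fin (suc n) → F.Carrier
    Y-product   : ∀ i → Y i F.≈ productᶠ (λ e → F.1# F.+ incidence i e F.* DF.x e)
    Φ           : RingIdeal (A m) (c ⊔ ℓ)
    Φ-square    : ∀ e → RingIdeal.Member Φ (DF.x e F.* DF.x e)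
    Φ-cut       : ∀ I → Proper I →
      RingIdeal.Member Φ (productᶠ (λ e → if I (lo e) xor I (hi e) then DF.x e else F.1#))
    Φ-vanishing : ∀ {g} → RingIdeal.Member Φ g → Vanishing DF.∂ DF.AtOrigin0 [] (allFin m) g
    D           : RingIdeal (A (suc n)) (c ⊔ ℓ)
    D-cut       : ∀ I → Proper I → RingIdeal.Member D ((monomial I P.- P.1#) ^ cutSize (allFin m) I)
    D-total     : RingIdeal.Member D (monomial (λ _ → true) P.- P.1#)
    D-least     : (J : RingIdeal (A (suc n)) (c ⊔ ℓ)) →
      (∀ I → Proper I → RingIdeal.Member J ((monomial I P.- P.1#) ^ cutSize (allFin m) I)) →
      RingIdeal.Member J (monomial (λ _ → true) P.- P.1#) →
      ∀ {p} → RingIdeal.Member D p → RingIdeal.Member J p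

module Comparison {c ℓ s : Level} (algebras : PolynomialAlgebras c ℓ s) {n m : ℕ} (lo hi : Fin m → Fin (suc n))
  (ideals : GraphIdeals algebras lo hi) where
  open PolynomialAlgebras algebras
  open GraphIdeals ideals
  open Substitution algebras
  private
    module P = CommutativeRing (A (suc n))
    module F = CommutativeRing (A m)
    module DP = DifferentialPolynomials (calculus (suc n))
    module DF = DifferentialPolynomials (calculus m)
    module Φ = RingIdeal Φ
    module D = RingIdeal D
    module QΦ = Quotient (A m) Φ
    module QD = Quotient (A (suc n)) D
    module Φᴿ = CommutativeRing QΦ.quotientRing
    module Dᴿ = CommutativeRing QD.quotientRing
    module SP = IntegerSolver (A (suc n))
    module SF = IntegerSolver (A m)

    invΦ-inverse : ∀ k → fromℕ QΦ.quotientRing (suc k) Φᴿ.* DF.inv k Φᴿ.≈ Φᴿ.1#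
    invΦ-inverse k = QΦ.≈⇒~ (F.trans (F.*-congʳ (F.reflexive (QΦ.fromℕ-quotient (suc k)))) (DF.inv-inverse k))

    invD-inverse : ∀ k → fromℕ QD.quotientRing (suc k) Dᴿ.* DP.inv k Dᴿ.≈ Dᴿ.1#
    invD-inverse k = QD.≈⇒~ (P.trans (P.*-congʳ (P.reflexive (QD.fromℕ-quotient (suc k)))) (DP.inv-inverse k))

    module EP = Exponential (A (suc n)) DP.inv DP.inv-inverse
    module EΦ = Exponential QΦ.quotientRing DF.inv invΦ-inverse
    module ED = Exponential QD.quotientRing DP.inv invD-inverse
    module G = PowerIdeal (A (suc n)) (calculus (suc n)) lo hi

  open Connectivity lo hi
  open GraphSigns (A m) Fin._≟_ lo hi
  open Algebra.Properties.CommutativeMonoid.Sum F.+-commutativeMonoid using (sum; sum-cong-≋; ∑-comm; ∑-distrib-+)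
  open Algebra.Properties.Monoid.Sum F.*-monoid using () renaming (sum to product; sum-cong-≋ to product-cong)
  open FiniteSums F.+-monoid
  open Algebra.Properties.Semiring.Sum F.semiring using (*-distribʳ-sum)

  [_] : Bool → F.Carrier
  [ b ] = if b then F.1# else F.0#

  sign : (Fin (suc n) → Bool) → Fin m → F.Carrier
  sign I e = [ I (lo e) ] F.- [ I (hi e) ]

  X : Fin (suc n) → F.Carrier
  X i = sum (λ e → incidence i e F.* DF.x e)

  Xᴵ : (Fin (suc n) → Bool) → F.Carrier
  Xᴵ I = sum (λ i → if I i then X i else F.0#)

  sum-incidence : ∀ I e → sum (λ i → if I i then incidence i e else F.0#) F.≈ sign I e
  sum-incidence I e = F.trans (sum-cong-≋ split) (F.trans (∑-distrib-+ low high)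
    (F.+-cong (F.trans (sum-single low (lo e) low-off) low-on) (F.trans (sum-single high (hi e) high-off) high-on)))
    where
    low high : Fin (suc n) → F.Carrier
    low i = if does (lo e Fin.≟ i) then [ I i ] else F.0#
    high i = if does (hi e Fin.≟ i) then F.- [ I i ] else F.0#

    split : ∀ i → (if I i then incidence i e else F.0#) F.≈ low i F.+ high i
    split i with I i | lo e Fin.≟ i | hi e Fin.≟ i
    ... | _     | yes p | yes q = ⊥-elim (lo≢hi e (≡.trans p (≡.sym q)))
    ... | true  | yes _ | no _  = F.sym (F.+-identityʳ _)
    ... | true  | no _  | yes _ = F.sym (F.+-identityˡ _)
    ... | true  | no _  | no _  = F.sym (F.+-identityˡ _)
    ... | false | yes _ | no _  = F.sym (F.+-identityʳ _)
    ... | false | no _  | yes _ = SF.solve 1 (λ z → SF.:0 SF.:= SF.:0 SF.:+ (SF.:- SF.:0)) F.refl F.0#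
    ... | false | no _  | no _  = F.sym (F.+-identityˡ _)

    low-off : ∀ j → lo e ≢ j → low j F.≈ F.0#
    low-off j neq with lo e Fin.≟ j
    ... | yes eq = ⊥-elim (neq eq)
    ... | no _   = F.refl
    high-off : ∀ j → hi e ≢ j → high j F.≈ F.0#
    high-off j neq with hi e Fin.≟ j
    ... | yes eq = ⊥-elim (neq eq)
    ... | no _   = F.refl
    low-on : low (lo e) F.≈ [ I (lo e) ]
    low-on with lo e Fin.≟ lo e
    ... | yes _  = F.refl
    ... | no neq = ⊥-elim (neq ≡.refl)
    high-on : high (hi e) F.≈ F.- [ I (hi e) ]
    high-on with hi e Fin.≟ hi e
    ... | yes _  = F.refl
    ... | no neq = ⊥-elim (neq ≡.refl)

  -- After exchanging the sums, an edge with both ends in `I` contributes 1 - 1 and one with no end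
  -- in `I` contributes nothing. Only the D_I edges of the cut remain, each with a sign.
  Xᴵ-signs : ∀ I → Xᴵ I F.≈ sum (λ e → sign I e F.* DF.x e)
  Xᴵ-signs I = begin
    sum (λ i → if I i then X i else F.0#)                                       ≈⟨ sum-cong-≋ inside ⟩
    sum (λ i → sum (λ e → (if I i then incidence i e else F.0#) F.* DF.x e))    ≈⟨ ∑-comm (λ i e → (if I i then incidence i e else F.0#) F.* DF.x e) ⟩
    sum (λ e → sum (λ i → (if I i then incidence i e else F.0#) F.* DF.x e))
      ≈⟨ sum-cong-≋ (λ e → F.trans (F.sym (*-distribʳ-sum (DF.x e) (λ i → if I i then incidence i e else F.0#))) (F.*-congʳ (sum-incidence I e))) ⟩
    sum (λ e → sign I e F.* DF.x e)                                             ∎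
    where
    open import Relation.Binary.Reasoning.Setoid F.setoid
    inside : ∀ i → (if I i then X i else F.0#) F.≈ sum (λ e → (if I i then incidence i e else F.0#) F.* DF.x e)
    inside i with I i
    ... | true  = F.refl
    ... | false = F.sym (sum-ε _ (λ e → F.zeroˡ (DF.x e)))

  isExp-Y : ∀ i → EΦ.IsExp (X i) (Y i)
  isExp-Y i = EΦ.isExp-resp Φᴿ.refl (QΦ.≈⇒~ (F.sym (Y-product i)))
    (EΦ.isExp-sum _ _ (λ e → EΦ.isExp-squareZero (square e)))
    where
    square : ∀ e → incidence i e F.* DF.x e F.* (incidence i e F.* DF.x e) Φᴿ.≈ F.0#
    square e = QΦ.member⇒~0 (Φ.member-resp
      (SF.solve 2 (λ a b → a SF.:* a SF.:* (b SF.:* b) SF.:= a SF.:* b SF.:* (a SF.:* b)) F.refl (incidence i e) (DF.x e))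
      (Φ.member-* _ (Φ-square e)))

  Yᴵ : (Fin (suc n) → Bool) → F.Carrier
  Yᴵ I = product (λ i → if I i then Y i else F.1#)

  isExp-Yᴵ : ∀ I → EΦ.IsExp (Xᴵ I) (Yᴵ I)
  isExp-Yᴵ I = EΦ.isExp-sum _ _ factor
    where
    factor : ∀ i → EΦ.IsExp (if I i then X i else F.0#) (if I i then Y i else F.1#)
    factor i with I i
    ... | true  = isExp-Y i
    ... | false = EΦ.isExp-0

  subst-monomial : ∀ I → subst (monomial I) Y F.≈ Yᴵ I
  subst-monomial I = F.trans (subst-product (λ i → if I i then DP.x i else P.1#) Y) (product-cong factor)
    where
    factor : ∀ i → subst (if I i then DP.x i else P.1#) Y F.≈ (if I i then Y i else F.1#)
    factor i with I i
    ... | true  = subst-x i Y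
    ... | false = subst-1 Y

  isCut : (Fin (suc n) → Bool) → Fin m → Bool
  isCut I e = I (lo e) xor I (hi e)

  sign-uncut : ∀ I e → isCut I e ≡ false → sign I e Φᴿ.≈ F.0#
  sign-uncut I e eq with I (lo e) | I (hi e)
  ... | true  | true  = QΦ.≈⇒~ (F.-‿inverseʳ _)
  ... | false | false = QΦ.≈⇒~ (F.-‿inverseʳ _)

  x-square : ∀ e → DF.x e F.* DF.x e Φᴿ.≈ F.0#
  x-square e = QΦ.member⇒~0 (Φ-square e)

  module SZ (I : Fin (suc n) → Bool) = SquareZero QΦ.quotientRing DF.x (sign I) x-square (isCut I) (sign-uncut I)

  private
    module ^Φ = Algebra.Properties.Semiring.Exp Φᴿ.semiring
    module ^D = Algebra.Properties.Semiring.Exp Dᴿ.semiring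
    module ^F = Algebra.Properties.Semiring.Exp F.semiring
    module ^P = Algebra.Properties.Semiring.Exp P.semiring
    module ^Φ* = Algebra.Properties.CommutativeSemiring.Exp Φᴿ.commutativeSemiring
    module ^D* = Algebra.Properties.CommutativeSemiring.Exp Dᴿ.commutativeSemiring

  signedSum-sum : ∀ I {k} (f : Fin k → Fin m) →
    SZ.signedSum I (List.tabulate f) ≡ sum (λ i → sign I (f i) F.* DF.x (f i))
  signedSum-sum I {zero}  f = ≡.refl
  signedSum-sum I {suc k} f = ≡.cong (sign I (f zero) F.* DF.x (f zero) F.+_) (signedSum-sum I (f ∘ suc))

  cutProduct-product : ∀ I {k} (f : Fin k → Fin m) →
    SZ.cutProduct I (List.tabulate f) ≡ product (λ i → if I (lo (f i)) xor I (hi (f i)) then DF.x (f i) else F.1#)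
  cutProduct-product I {zero}  f = ≡.refl
  cutProduct-product I {suc k} f = ≡.cong ((if isCut I (f zero) then DF.x (f zero) else F.1#) F.*_) (cutProduct-product I (f ∘ suc))

  -- A signed sum of D_I square-zero elements has its D_I-th power divisible by their product, and
  -- that product is the relation of the cut.
  Xᴵ-power : ∀ I → Proper I → Xᴵ I ^Φ.^ cutSize (allFin m) I Φᴿ.≈ F.0#
  Xᴵ-power I prop = Φᴿ.trans
    (^Φ.^-congˡ (cutSize (allFin m) I) (QΦ.≈⇒~ (F.trans (Xᴵ-signs I) (F.reflexive (≡.sym (signedSum-sum I (λ e → e)))))))
    (vanish (proj₁ (SZ.signedSum-power I (allFin m))))
    where
    vanish : (∃ λ r → SZ.signedSum I (allFin m) ^Φ.^ cutSize (allFin m) I Φᴿ.≈ r F.* SZ.cutProduct I (allFin m)) →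
      SZ.signedSum I (allFin m) ^Φ.^ cutSize (allFin m) I Φᴿ.≈ F.0#
    vanish (r , eq) = Φᴿ.trans eq (QΦ.member⇒~0 (Φ.member-* r
      (Φ.member-resp (F.reflexive (≡.sym (cutProduct-product I (λ e → e)))) (Φ-cut I prop))))

  -- exp a - 1 is a multiple of a, so the relation passes from X_I to Y_I - 1 with the same
  -- exponent.
  Yᴵ-power : ∀ I → Proper I → Φ.Member ((Yᴵ I F.- F.1#) ^F.^ cutSize (allFin m) I)
  Yᴵ-power I prop = divide (EΦ.isExp-multiple (isExp-Yᴵ I))
    where
    d = cutSize (allFin m) I
    divide : (∃ λ q → Yᴵ I F.- F.1# Φᴿ.≈ Xᴵ I F.* q) → Φ.Member ((Yᴵ I F.- F.1#) ^F.^ d)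
    divide (q , eq) = Φ.member-resp (F.reflexive (QΦ.^-quotient (Yᴵ I F.- F.1#) d)) (QΦ.~0⇒member (begin
      (Yᴵ I F.- F.1#) ^Φ.^ d            ≈⟨ ^Φ.^-congˡ d eq ⟩
      (Xᴵ I F.* q) ^Φ.^ d               ≈⟨ ^Φ*.^-distrib-* (Xᴵ I) q d ⟩
      Xᴵ I ^Φ.^ d F.* q ^Φ.^ d          ≈⟨ Φᴿ.*-congʳ (Xᴵ-power I prop) ⟩
      F.0# F.* q ^Φ.^ d                 ≈⟨ Φᴿ.zeroˡ _ ⟩
      F.0#                              ∎))
      where open import Relation.Binary.Reasoning.Setoid Φᴿ.setoid

  everything : Fin (suc n) → Bool
  everything _ = true

  -- Each edge adds 1 at one end and -1 at the other, so the X_i sum to 0 and the product of the Y_i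
  -- is exp 0.
  Y-total : Φ.Member (Yᴵ everything F.- F.1#)
  Y-total = EΦ.isExp-unique (isExp-Yᴵ everything) (EΦ.isExp-resp (QΦ.≈⇒~ (F.sym X-total)) Φᴿ.refl EΦ.isExp-0)
    where
    X-total : Xᴵ everything F.≈ F.0#
    X-total = F.trans (Xᴵ-signs everything)
      (sum-ε _ (λ e → F.trans (F.*-congʳ (F.-‿inverseʳ F.1#)) (F.zeroˡ (DF.x e))))

  preimage : RingIdeal (A (suc n)) (c ⊔ ℓ)
  preimage = record
    { Member      = λ p → Φ.Member (subst p Y)
    ; member-resp = λ p≈q → Φ.member-resp (subst-cong Y p≈q)
    ; member-0    = Φ.member-resp (F.sym (subst-0 Y)) Φ.member-0
    ; member-+    = λ {p} {q} h k → Φ.member-resp (F.sym (subst-+ p q Y)) (Φ.member-+ h k)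
    ; member-*    = λ r {p} h → Φ.member-resp (F.sym (subst-* r p Y)) (Φ.member-* (subst r Y) h)
    }

  subst-minus-1 : ∀ I → subst (monomial I P.- P.1#) Y F.≈ Yᴵ I F.- F.1#
  subst-minus-1 I = F.trans (subst-minus (monomial I) P.1# Y) (F.+-cong (subst-monomial I) (F.-‿cong (subst-1 Y)))

  -- By minimality of `D` it is enough to check the two kinds of generators; this is what makes the
  -- map on quotients well defined.
  D⊆preimage : ∀ {p} → D.Member p → Φ.Member (subst p Y)
  D⊆preimage = D-least preimage
    (λ I prop → Φ.member-resp
      (F.sym (F.trans (subst-^ (monomial I P.- P.1#) Y (cutSize (allFin m) I)) (^F.^-congˡ (cutSize (allFin m) I) (subst-minus-1 I))))
      (Yᴵ-power I prop))
    (Φ.member-resp (F.sym (subst-minus-1 everything)) Y-total)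

  upper-bound : ∀ {k} (f : Fin k → ℕ) → ∃ λ N → ∀ i → f i ≤ N
  upper-bound {zero}  f = 0 , λ ()
  upper-bound {suc k} f = let N , h = upper-bound (f ∘ suc) in
    f zero ℕ.+ N , λ { zero → ℕP.m≤m+n (f zero) N ; (suc i) → ℕP.≤-trans (h i) (ℕP.m≤n+m N (f zero)) }

  open Algebra.Properties.Monoid.Sum P.+-monoid using () renaming (sum to sumᴾ)
  open Algebra.Properties.Monoid.Sum P.*-monoid using () renaming (sum-cong-≋ to productᴾ-cong)

  singleton : Fin (suc n) → Fin (suc n) → Bool
  singleton i j = does (i Fin.≟ j)

  monomial-singleton : ∀ i → monomial (singleton i) P.≈ DP.x i
  monomial-singleton i = P.trans (FiniteSums.sum-single P.*-monoid (λ j → if singleton i j then DP.x j else P.1#) i off) on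
    where
    off : ∀ j → i ≢ j → (if singleton i j then DP.x j else P.1#) P.≈ P.1#
    off j i≢j with i Fin.≟ j
    ... | yes i≡j = ⊥-elim (i≢j i≡j)
    ... | no _    = P.refl
    on : (if singleton i i then DP.x i else P.1#) P.≈ DP.x i
    on with i Fin.≟ i
    ... | yes _   = P.refl
    ... | no  i≢i = ⊥-elim (i≢i ≡.refl)

  singleton-self : ∀ i → singleton i i ≡ true
  singleton-self i with i Fin.≟ i
  ... | yes _   = ≡.refl
  ... | no  i≢i = ⊥-elim (i≢i ≡.refl)

  -- With at least two vertices, the vertex i alone is a proper set and its cut relation is a power
  -- of y_i - 1. With a single vertex that set is everything, and the total relation says y_i = 1.
  x-1-nilpotent : ∀ i → ∃ λ N → (DP.x i P.- P.1#) ^D.^ N Dᴿ.≈ P.0#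
  x-1-nilpotent i with FinP.any? (λ j → singleton i j Bool.≟ false)
  ... | yes (j , j∉) = d , (begin
    (DP.x i P.- P.1#) ^D.^ d                        ≡⟨ QD.^-quotient (DP.x i P.- P.1#) d ⟩
    (DP.x i P.- P.1#) ^P.^ d                        ≈⟨ QD.≈⇒~ (^P.^-congˡ d (P.+-congʳ (monomial-singleton i))) ⟨
    (monomial (singleton i) P.- P.1#) ^P.^ d        ≈⟨ QD.member⇒~0 (D-cut (singleton i) ((i , singleton-self i) , (j , j∉))) ⟩
    P.0#                                            ∎)
    where
    d = cutSize (allFin m) (singleton i)
    open import Relation.Binary.Reasoning.Setoid Dᴿ.setoid
  ... | no full = 1 , (begin
    (DP.x i P.- P.1#) P.* P.1#                      ≈⟨ Dᴿ.*-identityʳ _ ⟩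
    DP.x i P.- P.1#                                 ≈⟨ QD.≈⇒~ (P.+-congʳ (P.trans (P.sym (monomial-singleton i)) (productᴾ-cong same))) ⟩
    monomial everything P.- P.1#                    ≈⟨ QD.member⇒~0 D-total ⟩
    P.0#                                            ∎)
    where
    open import Relation.Binary.Reasoning.Setoid Dᴿ.setoid
    same : ∀ j → (if singleton i j then DP.x j else P.1#) P.≈ DP.x j
    same j with singleton i j in eq
    ... | true  = P.refl
    ... | false = ⊥-elim (full (j , eq))

  logarithm : ∀ i → ∃ λ l → ED.IsExp l (DP.x i)
  logarithm i =
    let N , nilpotent = x-1-nilpotent i
        l , E = ED.exp-surjective {N = N} nilpotent
    in l , ED.isExp-resp Dᴿ.refl (QD.≈⇒~ (SP.solve 1 (λ y → SP.:1 SP.:+ (y SP.:- SP.:1) SP.:= y) P.refl (DP.x i))) E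

  l : Fin (suc n) → P.Carrier
  l i = proj₁ (logarithm i)

  lᴵ : (Fin (suc n) → Bool) → P.Carrier
  lᴵ I = sumᴾ (λ i → if I i then l i else P.0#)

  isExp-lᴵ : ∀ I → ED.IsExp (lᴵ I) (monomial I)
  isExp-lᴵ I = ED.isExp-sum _ _ factor
    where
    factor : ∀ i → ED.IsExp (if I i then l i else P.0#) (if I i then DP.x i else P.1#)
    factor i with I i
    ... | true  = proj₂ (logarithm i)
    ... | false = ED.isExp-0

  -- The mirror image of `Yᴵ-power`: a logarithm of u is a multiple of u - 1, so the relation passes
  -- from y_I - 1 back to l_I.
  lᴵ-power : ∀ I → Proper I → D.Member (lᴵ I ^P.^ cutSize (allFin m) I)
  lᴵ-power I prop = divide (ED.isExp-divides (isExp-lᴵ I))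
    where
    d = cutSize (allFin m) I
    divide : (∃ λ q → lᴵ I Dᴿ.≈ (monomial I P.- P.1#) P.* q) → D.Member (lᴵ I ^P.^ d)
    divide (q , eq) = D.member-resp (P.reflexive (QD.^-quotient (lᴵ I) d)) (QD.~0⇒member (begin
      lᴵ I ^D.^ d                                         ≈⟨ ^D.^-congˡ d eq ⟩
      ((monomial I P.- P.1#) P.* q) ^D.^ d                ≈⟨ ^D*.^-distrib-* (monomial I P.- P.1#) q d ⟩
      (monomial I P.- P.1#) ^D.^ d P.* q ^D.^ d           ≡⟨ ≡.cong (P._* q ^D.^ d) (QD.^-quotient (monomial I P.- P.1#) d) ⟩
      (monomial I P.- P.1#) ^P.^ d P.* q ^D.^ d           ≈⟨ Dᴿ.*-congʳ (QD.member⇒~0 (D-cut I prop)) ⟩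
      P.0# P.* q ^D.^ d                                   ≈⟨ Dᴿ.zeroˡ _ ⟩
      P.0#                                                ∎))
      where open import Relation.Binary.Reasoning.Setoid Dᴿ.setoid

  l-total : D.Member (lᴵ everything)
  l-total = divide (ED.isExp-divides (isExp-lᴵ everything))
    where
    divide : (∃ λ q → lᴵ everything Dᴿ.≈ (monomial everything P.- P.1#) P.* q) → D.Member (lᴵ everything)
    divide (q , eq) = QD.~-member eq (D.member-resp (P.*-comm q _) (D.member-* q D-total))

  subst-linear : ∀ I → subst (G.linear I) l P.≈ lᴵ I
  subst-linear I = P.trans (subst-sum (λ i → if I i then DP.x i else P.0#) l) (sumᴾ-cong term)
    where
    open Algebra.Properties.Monoid.Sum P.+-monoid using () renaming (sum-cong-≋ to sumᴾ-cong)
    term : ∀ i → subst (if I i then DP.x i else P.0#) l P.≈ (if I i then l i else P.0#)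
    term i with I i
    ... | true  = subst-x i l
    ... | false = subst-0 l

  powerIdeal-subst : ∀ {p} → G.Ideal [] (allFin m) p → D.Member (subst p l)
  powerIdeal-subst (G.ideal-resp p≈q h) = D.member-resp (subst-cong l p≈q) (powerIdeal-subst h)
  powerIdeal-subst G.ideal-0 = D.member-resp (P.sym (subst-0 l)) D.member-0
  powerIdeal-subst (G.ideal-+ {p} {q} h k) =
    D.member-resp (P.sym (subst-+ p q l)) (D.member-+ (powerIdeal-subst h) (powerIdeal-subst k))
  powerIdeal-subst (G.ideal-cut I prop _ {q} _) = D.member-resp
    (P.sym (P.trans (subst-* q (G.linear I ^P.^ d) l) (P.*-congˡ (P.trans (subst-^ (G.linear I) l d) (^P.^-congˡ d (subst-linear I))))))
    (D.member-* (subst q l) (lᴵ-power I prop))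
    where d = cutSize (allFin m) I
  powerIdeal-subst (G.ideal-total {q} _) = D.member-resp
    (P.sym (P.trans (subst-* q G.total l) (P.*-congˡ (subst-linear everything))))
    (D.member-* (subst q l) l-total)

  private
    module ∂F (e : Fin m) = Derivation (A m) (DF.∂ e) (DF.∂-cong e) (DF.∂-+ e) (DF.∂-* e)

  ∂-incidence : ∀ e i f → DF.∂ e (incidence i f) F.≈ F.0#
  ∂-incidence e i f with lo f Fin.≟ i | hi f Fin.≟ i
  ... | yes _ | _     = ∂F.D-1 e
  ... | no _  | yes _ = F.trans (∂F.D-neg e F.1#) (F.trans (F.-‿cong (∂F.D-1 e)) (SF.solve 1 (λ z → SF.:- SF.:0 SF.:= SF.:0) F.refl F.0#))
  ... | no _  | no _  = ∂F.D-0 e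

  ∂-X : ∀ e i → DF.∂ e (X i) F.≈ incidence i e
  ∂-X e i = F.trans (∂F.D-sum e (λ f → incidence i f F.* DF.x f))
    (F.trans (sum-cong-≋ leibniz) (F.trans (sum-single (λ f → incidence i f F.* DF.∂ e (DF.x f)) e off)
      (F.trans (F.*-congˡ (DF.∂-x-same e)) (F.*-identityʳ _))))
    where
    leibniz : ∀ f → DF.∂ e (incidence i f F.* DF.x f) F.≈ incidence i f F.* DF.∂ e (DF.x f)
    leibniz f = F.trans (DF.∂-* e (incidence i f) (DF.x f))
      (F.trans (F.+-congʳ (F.trans (F.*-congʳ (∂-incidence e i f)) (F.zeroˡ _))) (F.+-identityˡ _))
    off : ∀ f → e ≢ f → incidence i f F.* DF.∂ e (DF.x f) F.≈ F.0#
    off f e≢f = F.trans (F.*-congˡ (DF.∂-x-other e≢f)) (F.zeroʳ _)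

  δ-x : ∀ e i → subst (G.δ e (DP.x i)) X F.≈ incidence i e
  δ-x e i with lo e Fin.≟ i | hi e Fin.≟ i
  ... | yes ≡.refl | yes q = ⊥-elim (lo≢hi e (≡.sym q))
  ... | yes ≡.refl | no q  = F.trans (subst-cong X (P.trans (P.+-cong (DP.∂-x-same i) (P.-‿cong (DP.∂-x-other q)))
          (SP.solve 1 (λ z → SP.:1 SP.:- SP.:0 SP.:= SP.:1) P.refl P.0#))) (subst-1 X)
  ... | no p | yes ≡.refl  = F.trans (subst-cong X (P.trans (P.+-cong (DP.∂-x-other p) (P.-‿cong (DP.∂-x-same i))) (P.+-identityˡ _)))
          (F.trans (subst-neg P.1# X) (F.-‿cong (subst-1 X)))
  ... | no p | no q        = F.trans (subst-cong X (P.trans (P.+-cong (DP.∂-x-other p) (P.-‿cong (DP.∂-x-other q))) (P.-‿inverseʳ _))) (subst-0 X)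

  -- The derivative of X_i by φ_e is c_{i,e}, that is 1 at the lower end of e, -1 at the upper end
  -- and 0 elsewhere. This is where the difference of partial derivatives in `δ` comes from.
  chain-rule : ∀ e p → DF.∂ e (subst p X) F.≈ subst (G.δ e p) X
  chain-rule e p = lower (induction Q
    (λ {p} {q} p≈q (lift h) → lift (F.trans (DF.∂-cong e (subst-cong X (P.sym p≈q))) (F.trans h (subst-cong X (G.δ-cong e p≈q)))))
    (λ a → lift (F.trans (DF.∂-cong e (subst-con a X)) (F.trans (∂-con e a) (F.sym (F.trans (subst-cong X
      (P.trans (P.+-cong (∂-con (lo e) a) (P.-‿cong (∂-con (hi e) a))) (P.-‿inverseʳ _))) (subst-0 X))))))
    (λ i → lift (F.trans (DF.∂-cong e (subst-x i X)) (F.trans (∂-X e i) (F.sym (δ-x e i)))))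
    (λ {p} {q} (lift h) (lift k) → lift (F.trans (DF.∂-cong e (subst-+ p q X)) (F.trans (DF.∂-+ e _ _) (F.trans (F.+-cong h k)
      (F.sym (F.trans (subst-cong X (G.δ-+ e p q)) (subst-+ _ _ X)))))))
    (λ {p} {q} (lift h) (lift k) → lift (F.trans (DF.∂-cong e (subst-* p q X)) (F.trans (DF.∂-* e _ _)
      (F.trans (F.+-cong (F.*-congʳ h) (F.*-congˡ k))
      (F.sym (F.trans (subst-cong X (G.δ-* e p q)) (F.trans (subst-+ _ _ X) (F.+-cong (subst-* _ q X) (subst-* p _ X)))))))))
    p)
    where
    Q : P.Carrier → Set (c ⊔ ℓ)
    Q p = Lift c (DF.∂ e (subst p X) F.≈ subst (G.δ e p) X)

  origin-X : ∀ i → DF.AtOrigin0 (X i)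
  origin-X i = go (λ e → incidence i e F.* DF.x e) (λ e → DF.origin-* _ (DF.origin-x e))
    where
    go : ∀ {k} (f : Fin k → F.Carrier) → (∀ i → DF.AtOrigin0 (f i)) → DF.AtOrigin0 (sum f)
    go {zero}  f h = DF.origin-0
    go {suc k} f h = DF.origin-+ (h zero) (go (f ∘ suc) (h ∘ suc))

  -- Membership in `Φ` enters only through the vanishing of derivatives at the origin. The chain
  -- rule moves these derivatives to `p`, and since the X_i have no constant term, evaluation at the
  -- origin moves as well; then deletion and contraction apply.
  additive-kernel : ∀ p → Φ.Member (subst p X) → G.Ideal [] (allFin m) p
  additive-kernel p h = G.vanishes-ideal [] (allFin m) (λ ())
    (vanishing-transport (λ g p → g F.≈ subst p X)
      (λ e {g} {p} eq → F.trans (DF.∂-cong e eq) (chain-rule e p))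
      (λ {g} {p} eq z → origin-subst p X origin-X (DF.origin-resp eq z))
      [] (allFin m) F.refl (Φ-vanishing h))

  -- Injectivity. Let p̂ be p with each variable replaced by its truncated exponential. Modulo `Φ`,
  -- p̂(X) is p(Y), so p̂ lies in the power ideal and p̂(l) lies in `D`; but modulo `D`, p̂(l) is
  -- p(exp l) = p.
  preimage⊆D : ∀ p → Φ.Member (subst p Y) → D.Member p
  preimage⊆D p h = D.member-resp (subst-identity p) (QD.~-member (QD.~-sym p̂[l]~p) (powerIdeal-subst (additive-kernel p̂ p̂[X]∈Φ)))
    where
    N₁ = proj₁ (upper-bound (λ i → proj₁ (isExp-Y i)))
    N₂ = proj₁ (upper-bound (λ i → proj₁ (proj₂ (logarithm i))))
    -- One polynomial p̂ has to serve both quotients, so the truncation lies beyond the bounds of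
    -- all the X_i and of all the logarithms.
    N = N₁ ℕ.+ N₂
    p̂ = subst p (λ i → EP.exp< N (DP.x i))

    module φX = ExponentialHomomorphism (A (suc n)) QΦ.quotientRing DP.inv DP.inv-inverse DF.inv invΦ-inverse
      (λ q → subst q X) (λ eq → QΦ.≈⇒~ (subst-cong X eq)) (λ a b → QΦ.≈⇒~ (subst-+ a b X)) (λ a b → QΦ.≈⇒~ (subst-* a b X))
      (QΦ.≈⇒~ (subst-0 X)) (QΦ.≈⇒~ (subst-1 X))
    module φl = ExponentialHomomorphism (A (suc n)) QD.quotientRing DP.inv DP.inv-inverse DP.inv invD-inverse
      (λ q → subst q l) (λ eq → QD.≈⇒~ (subst-cong l eq)) (λ a b → QD.≈⇒~ (subst-+ a b l)) (λ a b → QD.≈⇒~ (subst-* a b l))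
      (QD.≈⇒~ (subst-0 l)) (QD.≈⇒~ (subst-1 l))

    exp-X : ∀ i → subst (EP.exp< N (DP.x i)) X QΦ.~ Y i
    exp-X i = Φᴿ.trans (φX.φ-exp< N (DP.x i)) (Φᴿ.trans
      (EΦ.sum<-cong N (EΦ.divided-power-cong (QΦ.≈⇒~ (subst-x i X))))
      (Φᴿ.sym (EΦ.isExp-exp< (isExp-Y i) (ℕP.≤-trans (proj₂ (upper-bound (λ i → proj₁ (isExp-Y i))) i) (ℕP.m≤m+n N₁ N₂)))))

    exp-l : ∀ i → subst (EP.exp< N (DP.x i)) l QD.~ DP.x i
    exp-l i = Dᴿ.trans (φl.φ-exp< N (DP.x i)) (Dᴿ.trans
      (ED.sum<-cong N (ED.divided-power-cong (QD.≈⇒~ (subst-x i l))))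
      (Dᴿ.sym (ED.isExp-exp< (proj₂ (logarithm i))
        (ℕP.≤-trans (proj₂ (upper-bound (λ i → proj₁ (proj₂ (logarithm i)))) i) (ℕP.m≤n+m N₂ N₁)))))

    p̂[X]∈Φ : Φ.Member (subst p̂ X)
    p̂[X]∈Φ = QΦ.~-member (Φᴿ.trans (QΦ.≈⇒~ (subst-subst p _ X)) (subst-~ Φ p exp-X)) h

    p̂[l]~p : subst p̂ l QD.~ subst p DP.x
    p̂[l]~p = Dᴿ.trans (QD.≈⇒~ (subst-subst p _ l)) (subst-~ D p exp-l)

-- The ring of polynomials given as lists of terms

module PolynomialRing {c ℓ : Level} (K : CommutativeRing c ℓ) where
  open CommutativeRing K hiding (zero)
  open Poly K
  open IntegerSolver K hiding (con)
  open import Relation.Binary.Reasoning.Setoid setoid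

  infixl 6 _⊕_
  _⊕_ : ∀ {m} → Mono m → Mono m → Mono m
  _⊕_ = Vec.zipWith ℕ._+_

  -- Equality of polynomials is equality of all these linear functionals, which turns the ring laws
  -- into statements about monomials.
  pair : ∀ {m} → Pol m → (Mono m → Carrier) → Carrier
  pair []            F = 0#
  pair ((a , β) ∷ p) F = a * F β + pair p F

  dirac : ∀ {m} → Mono m → Mono m → Carrier
  dirac α β = if does (VecP.≡-dec ℕ._≟_ β α) then 1# else 0#

  dirac-same : ∀ {m} (α : Mono m) → dirac α α ≈ 1#
  dirac-same α with VecP.≡-dec ℕ._≟_ α α
  ... | yes _   = refl
  ... | no  α≢α = ⊥-elim (α≢α ≡.refl)

  dirac-other : ∀ {m} {α β : Mono m} → β ≢ α → dirac α β ≈ 0#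
  dirac-other {_} {α} {β} β≢α with VecP.≡-dec ℕ._≟_ β α
  ... | yes β≡α = ⊥-elim (β≢α β≡α)
  ... | no  _   = refl

  coeff-pair : ∀ {m} (p : Pol m) α → coeff p α ≈ pair p (dirac α)
  coeff-pair []            α = refl
  coeff-pair ((a , β) ∷ p) α with VecP.≡-dec ℕ._≟_ β α
  ... | yes _ = +-cong (sym (*-identityʳ a)) (coeff-pair p α)
  ... | no  _ = trans (coeff-pair p α) (solve 2 (λ a x → x := a :* :0 :+ x) refl a _)

  pair-cong : ∀ {m} (p : Pol m) {F G} → (∀ β → F β ≈ G β) → pair p F ≈ pair p G
  pair-cong []            h = refl
  pair-cong ((a , β) ∷ p) h = +-cong (*-congˡ (h β)) (pair-cong p h)

  pair-+ : ∀ {m} (p : Pol m) F G → pair p (λ β → F β + G β) ≈ pair p F + pair p G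
  pair-+ []            F G = sym (+-identityʳ 0#)
  pair-+ ((a , β) ∷ p) F G = trans (+-congˡ (pair-+ p F G))
    (solve 5 (λ a x y u v → a :* (x :+ y) :+ (u :+ v) := (a :* x :+ u) :+ (a :* y :+ v)) refl a (F β) (G β) _ _)

  pair-scale : ∀ {m} (p : Pol m) b F → pair p (λ β → b * F β) ≈ b * pair p F
  pair-scale []            b F = sym (zeroʳ b)
  pair-scale ((a , β) ∷ p) b F = trans (+-congˡ (pair-scale p b F))
    (solve 4 (λ a b x u → a :* (b :* x) :+ b :* u := b :* (a :* x :+ u)) refl a b (F β) _)

  pair-0 : ∀ {m} (p : Pol m) → pair p (λ _ → 0#) ≈ 0#
  pair-0 []            = refl
  pair-0 ((a , β) ∷ p) = trans (+-cong (zeroʳ a) (pair-0 p)) (+-identityʳ 0#)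

  pair-swap : ∀ {m k} (p : Pol m) (q : Pol k) (H : Mono m → Mono k → Carrier) →
    pair p (λ β → pair q (H β)) ≈ pair q (λ γ → pair p (λ β → H β γ))
  pair-swap []            q H = sym (pair-0 q)
  pair-swap ((a , β) ∷ p) q H = begin
    a * pair q (H β) + pair p (λ β → pair q (H β))                          ≈⟨ +-cong (sym (pair-scale q a (H β))) (pair-swap p q H) ⟩
    pair q (λ γ → a * H β γ) + pair q (λ γ → pair p (λ β → H β γ))          ≈⟨ pair-+ q _ _ ⟨
    pair q (λ γ → a * H β γ + pair p (λ β → H β γ))                         ∎

  pair-++ : ∀ {m} (p q : Pol m) F → pair (p ++ q) F ≈ pair p F + pair q F
  pair-++ []            q F = sym (+-identityˡ _)
  pair-++ ((a , β) ∷ p) q F = trans (+-congˡ (pair-++ p q F)) (sym (+-assoc _ _ _))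

  pair-neg : ∀ {m} (p : Pol m) F → pair (-ₚ p) F ≈ - pair p F
  pair-neg []            F = solve 1 (λ x → :0 := :- :0) refl 0#
  pair-neg ((a , β) ∷ p) F = trans (+-congˡ (pair-neg p F))
    (solve 3 (λ a x u → (:- a) :* x :+ (:- u) := :- (a :* x :+ u)) refl a (F β) _)

  pair-* : ∀ {m} (p q : Pol m) F → pair (p *ₚ q) F ≈ pair p (λ β → pair q (λ γ → F (β ⊕ γ)))
  pair-* []            q F = refl
  pair-* ((a , β) ∷ p) q F = trans (pair-++ (List.map _ q) (p *ₚ q) F) (+-cong (scaled q) (pair-* p q F))
    where
    scaled : ∀ q → pair (List.map (λ t → (a * proj₁ t , β ⊕ proj₂ t)) q) F ≈ a * pair q (λ γ → F (β ⊕ γ))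
    scaled []            = sym (zeroʳ a)
    scaled ((b , γ) ∷ q) = trans (+-congˡ (scaled q))
      (solve 4 (λ a b x u → a :* b :* x :+ a :* u := a :* (b :* x :+ u)) refl a b (F (β ⊕ γ)) _)

  pair-single : ∀ {m} a (β : Mono m) F → pair ((a , β) ∷ []) F ≈ a * F β
  pair-single a β F = +-identityʳ _

  ≈-from-pair : ∀ {m} (p q : Pol m) → (∀ F → pair p F ≈ pair q F) → p ≈ₚ q
  ≈-from-pair p q h α = trans (coeff-pair p α) (trans (h (dirac α)) (sym (coeff-pair q α)))

  remove : ∀ {m} → Mono m → Pol m → Pol m
  remove β = List.filter (λ t → ¬? (VecP.≡-dec ℕ._≟_ (proj₂ t) β))

  pair-remove : ∀ {m} (β : Mono m) p F → pair p F ≈ coeff p β * F β + pair (remove β p) F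
  pair-remove β []            F = sym (trans (+-identityʳ _) (zeroˡ _))
  pair-remove β ((a , γ) ∷ p) F with VecP.≡-dec ℕ._≟_ γ β
  ... | yes ≡.refl = trans (+-congˡ (pair-remove β p F))
    (solve 4 (λ a x k u → a :* x :+ (k :* x :+ u) := (a :+ k) :* x :+ u) refl a (F β) _ _)
  ... | no _       = trans (+-congˡ (pair-remove β p F))
    (solve 3 (λ y k u → y :+ (k :+ u) := k :+ (y :+ u)) refl (a * F γ) _ _)

  remove-shrinks : ∀ {m} (β : Mono m) p → List.length (remove β p) ≤ List.length p
  remove-shrinks β []            = z≤n
  remove-shrinks β ((a , γ) ∷ p) with VecP.≡-dec ℕ._≟_ γ β
  ... | yes _ = ℕP.m≤n⇒m≤1+n (remove-shrinks β p)
  ... | no _  = s≤s (remove-shrinks β p)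

  coeff-remove : ∀ {m} (β : Mono m) p α → (∀ α → coeff p α ≈ 0#) → coeff (remove β p) α ≈ 0#
  coeff-remove β p α h with VecP.≡-dec ℕ._≟_ α β
  ... | yes ≡.refl = absent p
    where
    absent : ∀ p → coeff (remove β p) β ≈ 0#
    absent []            = refl
    absent ((a , γ) ∷ p) with VecP.≡-dec ℕ._≟_ γ β
    ... | yes _ = absent p
    ... | no γ≢β with VecP.≡-dec ℕ._≟_ γ β
    ...   | yes γ≡β = ⊥-elim (γ≢β γ≡β)
    ...   | no _    = absent p
  ... | no α≢β = trans (unchanged p) (h α)
    where
    unchanged : ∀ p → coeff (remove β p) α ≈ coeff p α
    unchanged []            = refl
    unchanged ((a , γ) ∷ p) with VecP.≡-dec ℕ._≟_ γ β
    ... | yes ≡.refl with VecP.≡-dec ℕ._≟_ γ α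
    ...   | yes ≡.refl = ⊥-elim (α≢β ≡.refl)
    ...   | no _       = unchanged p
    unchanged ((a , γ) ∷ p) | no _ with VecP.≡-dec ℕ._≟_ γ α
    ...   | yes _ = +-congˡ (unchanged p)
    ...   | no _  = unchanged p

  -- Terms with the same exponent may be scattered over the list and cancel, so no recursion term by
  -- term works. Instead all terms with the exponent of the head are removed together: their total
  -- is a coefficient, hence 0, and the rest still has zero coefficients. The bound `k` on the
  -- length makes the recursion terminate.
  pair-zero : ∀ {m} k (p : Pol m) → List.length p ≤ k → (∀ α → coeff p α ≈ 0#) → ∀ F → pair p F ≈ 0#
  pair-zero k       []              _         h F = refl
  pair-zero (suc k) p@((a , β) ∷ p′) (s≤s le) h F = begin
    pair p F                                    ≈⟨ pair-remove β p F ⟩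
    coeff p β * F β + pair (remove β p) F       ≈⟨ +-cong (*-congʳ (h β)) (pair-zero k (remove β p) shorter (λ α → coeff-remove β p α h) F) ⟩
    0# * F β + 0#                               ≈⟨ trans (+-identityʳ _) (zeroˡ _) ⟩
    0#                                          ∎
    where
    shorter : List.length (remove β p) ≤ k
    shorter with VecP.≡-dec ℕ._≟_ β β
    ... | yes _   = ℕP.≤-trans (remove-shrinks β p′) le
    ... | no  β≢β = ⊥-elim (β≢β ≡.refl)

  coeff-+ : ∀ {m} (p q : Pol m) α → coeff (p +ₚ q) α ≈ coeff p α + coeff q α
  coeff-+ p q α = trans (coeff-pair (p +ₚ q) α) (trans (pair-++ p q _) (sym (+-cong (coeff-pair p α) (coeff-pair q α))))

  coeff-neg : ∀ {m} (p : Pol m) α → coeff (-ₚ p) α ≈ - coeff p α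
  coeff-neg p α = trans (coeff-pair (-ₚ p) α) (trans (pair-neg p _) (sym (-‿cong (coeff-pair p α))))

  -- The converse of `≈-from-pair`. Together they show that any operation whose effect on
  -- functionals is known respects equality of polynomials.
  pair-respects-≈ : ∀ {m} (p q : Pol m) → p ≈ₚ q → ∀ F → pair p F ≈ pair q F
  pair-respects-≈ p q p≈q F = begin
    pair p F                              ≈⟨ solve 2 (λ x y → x := (x :- y) :+ y) refl _ _ ⟩
    (pair p F - pair q F) + pair q F      ≈⟨ +-congʳ (trans (+-congˡ (sym (pair-neg q F))) (sym (pair-++ p (-ₚ q) F))) ⟩
    pair (p -ₚ q) F + pair q F            ≈⟨ +-congʳ (pair-zero _ (p -ₚ q) ℕP.≤-refl difference F) ⟩
    0# + pair q F                         ≈⟨ +-identityˡ _ ⟩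
    pair q F                              ∎
    where
    difference : ∀ α → coeff (p -ₚ q) α ≈ 0#
    difference α = trans (coeff-+ p (-ₚ q) α)
      (trans (+-cong (p≈q α) (coeff-neg q α)) (-‿inverseʳ _))

  ⊕-assoc : ∀ {m} (α β γ : Mono m) → (α ⊕ β) ⊕ γ ≡ α ⊕ (β ⊕ γ)
  ⊕-assoc = VecP.zipWith-assoc ℕP.+-assoc

  ⊕-comm : ∀ {m} (α β : Mono m) → α ⊕ β ≡ β ⊕ α
  ⊕-comm = VecP.zipWith-comm ℕP.+-comm

  ⊕-identityˡ : ∀ {m} (α : Mono m) → zeroMono ⊕ α ≡ α
  ⊕-identityˡ = VecP.zipWith-identityˡ ℕP.+-identityˡ

  *ₚ-cong : ∀ {m} {p p′ q q′ : Pol m} → p ≈ₚ p′ → q ≈ₚ q′ → (p *ₚ q) ≈ₚ (p′ *ₚ q′)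
  *ₚ-cong {_} {p} {p′} {q} {q′} hp hq = ≈-from-pair (p *ₚ q) (p′ *ₚ q′) λ F → begin
    pair (p *ₚ q) F                                   ≈⟨ pair-* p q F ⟩
    pair p (λ β → pair q (λ γ → F (β ⊕ γ)))           ≈⟨ pair-respects-≈ p p′ hp _ ⟩
    pair p′ (λ β → pair q (λ γ → F (β ⊕ γ)))          ≈⟨ pair-cong p′ (λ β → pair-respects-≈ q q′ hq _) ⟩
    pair p′ (λ β → pair q′ (λ γ → F (β ⊕ γ)))         ≈⟨ pair-* p′ q′ F ⟨
    pair (p′ *ₚ q′) F                                 ∎

  *ₚ-assoc : ∀ {m} (p q r : Pol m) → ((p *ₚ q) *ₚ r) ≈ₚ (p *ₚ (q *ₚ r))
  *ₚ-assoc p q r = ≈-from-pair ((p *ₚ q) *ₚ r) (p *ₚ (q *ₚ r)) λ F → begin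
    pair ((p *ₚ q) *ₚ r) F                                            ≈⟨ trans (pair-* (p *ₚ q) r F) (pair-* p q _) ⟩
    pair p (λ α → pair q (λ β → pair r (λ γ → F ((α ⊕ β) ⊕ γ))))
      ≈⟨ pair-cong p (λ α → pair-cong q (λ β → pair-cong r (λ γ → reflexive (≡.cong F (⊕-assoc α β γ))))) ⟩
    pair p (λ α → pair q (λ β → pair r (λ γ → F (α ⊕ (β ⊕ γ)))))      ≈⟨ pair-cong p (λ α → pair-* q r _) ⟨
    pair p (λ α → pair (q *ₚ r) (λ β → F (α ⊕ β)))                    ≈⟨ pair-* p (q *ₚ r) F ⟨
    pair (p *ₚ (q *ₚ r)) F                                            ∎

  *ₚ-comm : ∀ {m} (p q : Pol m) → (p *ₚ q) ≈ₚ (q *ₚ p)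
  *ₚ-comm p q = ≈-from-pair (p *ₚ q) (q *ₚ p) λ F → begin
    pair (p *ₚ q) F                               ≈⟨ pair-* p q F ⟩
    pair p (λ β → pair q (λ γ → F (β ⊕ γ)))       ≈⟨ pair-swap p q (λ β γ → F (β ⊕ γ)) ⟩
    pair q (λ γ → pair p (λ β → F (β ⊕ γ)))       ≈⟨ pair-cong q (λ γ → pair-cong p (λ β → reflexive (≡.cong F (⊕-comm β γ)))) ⟩
    pair q (λ γ → pair p (λ β → F (γ ⊕ β)))       ≈⟨ pair-* q p F ⟨
    pair (q *ₚ p) F                               ∎

  *ₚ-identityˡ : ∀ {m} (p : Pol m) → (oneP *ₚ p) ≈ₚ p
  *ₚ-identityˡ p = ≈-from-pair (oneP *ₚ p) p λ F → begin
    pair (oneP *ₚ p) F                                ≈⟨ pair-* oneP p F ⟩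
    1# * pair p (λ γ → F (zeroMono ⊕ γ)) + 0#         ≈⟨ trans (+-identityʳ _) (*-identityˡ _) ⟩
    pair p (λ γ → F (zeroMono ⊕ γ))                   ≈⟨ pair-cong p (λ γ → reflexive (≡.cong F (⊕-identityˡ γ))) ⟩
    pair p F                                          ∎

  *ₚ-distribʳ : ∀ {m} (r p q : Pol m) → ((p +ₚ q) *ₚ r) ≈ₚ ((p *ₚ r) +ₚ (q *ₚ r))
  *ₚ-distribʳ r p q = ≈-from-pair ((p +ₚ q) *ₚ r) ((p *ₚ r) +ₚ (q *ₚ r)) λ F → begin
    pair ((p +ₚ q) *ₚ r) F                        ≈⟨ trans (pair-* (p +ₚ q) r F) (pair-++ p q _) ⟩
    pair p (λ β → pair r (λ γ → F (β ⊕ γ))) + pair q (λ β → pair r (λ γ → F (β ⊕ γ)))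
                                                  ≈⟨ +-cong (pair-* p r F) (pair-* q r F) ⟨
    pair (p *ₚ r) F + pair (q *ₚ r) F             ≈⟨ pair-++ (p *ₚ r) (q *ₚ r) F ⟨
    pair ((p *ₚ r) +ₚ (q *ₚ r)) F                 ∎

  +ₚ-cong : ∀ {m} {p p′ q q′ : Pol m} → p ≈ₚ p′ → q ≈ₚ q′ → (p +ₚ q) ≈ₚ (p′ +ₚ q′)
  +ₚ-cong {_} {p} {p′} {q} {q′} hp hq α = trans (coeff-+ p q α) (trans (+-cong (hp α) (hq α)) (sym (coeff-+ p′ q′ α)))

  +ₚ-assoc : ∀ {m} (p q r : Pol m) → ((p +ₚ q) +ₚ r) ≈ₚ (p +ₚ (q +ₚ r))
  +ₚ-assoc p q r α = trans (trans (coeff-+ (p +ₚ q) r α) (+-congʳ (coeff-+ p q α)))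
    (trans (+-assoc _ _ _) (sym (trans (coeff-+ p (q +ₚ r) α) (+-congˡ (coeff-+ q r α)))))

  +ₚ-comm : ∀ {m} (p q : Pol m) → (p +ₚ q) ≈ₚ (q +ₚ p)
  +ₚ-comm p q α = trans (coeff-+ p q α) (trans (+-comm _ _) (sym (coeff-+ q p α)))

  -ₚ-cong : ∀ {m} {p q : Pol m} → p ≈ₚ q → (-ₚ p) ≈ₚ (-ₚ q)
  -ₚ-cong {_} {p} {q} h α = trans (coeff-neg p α) (trans (-‿cong (h α)) (sym (coeff-neg q α)))

  -ₚ-inverseʳ : ∀ {m} (p : Pol m) → (p -ₚ p) ≈ₚ []
  -ₚ-inverseʳ p α = trans (coeff-+ p (-ₚ p) α) (trans (+-congˡ (coeff-neg p α)) (-‿inverseʳ _))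

  polynomialRing : ℕ → CommutativeRing c ℓ
  polynomialRing m = record
    { Carrier = Pol m
    ; _≈_     = _≈ₚ_
    ; _+_     = _+ₚ_
    ; _*_     = _*ₚ_
    ; -_      = -ₚ_
    ; 0#      = []
    ; 1#      = oneP
    ; isCommutativeRing = record
      { isRing = record
        { +-isAbelianGroup = record
          { isGroup = record
            { isMonoid = record
              { isSemigroup = record
                { isMagma = record
                  { isEquivalence = record
                    { refl  = λ α → refl
                    ; sym   = λ h α → sym (h α)
                    ; trans = λ h k α → trans (h α) (k α)
                    }
                  ; ∙-cong = λ {p} {p′} {q} {q′} → +ₚ-cong {p = p} {p′} {q} {q′}
                  }
                ; assoc = +ₚ-assoc
                }
              ; identity = (λ p α → refl) , (λ p α → trans (coeff-+ p [] α) (+-identityʳ _))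
              }
            ; inverse = (λ p α → trans (+ₚ-comm (-ₚ p) p α) (-ₚ-inverseʳ p α)) , -ₚ-inverseʳ
            ; ⁻¹-cong = λ {p} {q} → -ₚ-cong {p = p} {q}
            }
          ; comm = +ₚ-comm
          }
        ; *-cong = λ {p} {p′} {q} {q′} → *ₚ-cong {p = p} {p′} {q} {q′}
        ; *-assoc = *ₚ-assoc
        ; *-identity = *ₚ-identityˡ , (λ p α → trans (*ₚ-comm p oneP α) (*ₚ-identityˡ p α))
        ; distrib = (λ r p q α → trans (*ₚ-comm r (p +ₚ q) α) (trans (*ₚ-distribʳ r p q α)
                      (+ₚ-cong {p = p *ₚ r} {r *ₚ p} {q *ₚ r} {r *ₚ q} (*ₚ-comm p r) (*ₚ-comm q r) α))) , *ₚ-distribʳ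
        }
      ; *-comm = *ₚ-comm
      }
    }

-- Evaluation of monomials and arithmetic of exponent vectors

module Evaluation {c ℓ : Level} (R : CommutativeRing c ℓ) where
  open CommutativeRing R hiding (zero)
  open IntegerSolver R
  open import Algebra.Properties.Semiring.Exp semiring using (_^_; ^-homo-*)
  open import Algebra.Properties.Monoid.Sum *-monoid using () renaming (sum to product)

  eval : ∀ {k} → Vec ℕ k → (Fin k → Carrier) → Carrier
  eval []      v = 1#
  eval (a ∷ α) v = v zero ^ a * eval α (v ∘ suc)

  eval-+ : ∀ {k} (α β : Vec ℕ k) v → eval (Vec.zipWith ℕ._+_ α β) v ≈ eval α v * eval β v
  eval-+ []      []      v = sym (*-identityʳ 1#)
  eval-+ (a ∷ α) (b ∷ β) v = trans (*-cong (^-homo-* (v zero) a b) (eval-+ α β (v ∘ suc)))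
    (solve 4 (λ p q x y → (p :* q) :* (x :* y) := (p :* x) :* (q :* y)) refl _ _ _ _)

  eval-0 : ∀ k v → eval (Vec.replicate k 0) v ≈ 1#
  eval-0 zero    v = refl
  eval-0 (suc k) v = trans (*-identityˡ _) (eval-0 k (v ∘ suc))

  eval-unit : ∀ {k} i (v : Fin k → Carrier) → eval (tabulate λ j → if does (i Fin.≟ j) then 1 else 0) v ≈ v i
  eval-unit zero    v = trans (*-cong (*-identityʳ _) (zeros (v ∘ suc))) (*-identityʳ _)
    where
    zeros : ∀ {k} (v : Fin k → Carrier) → eval (tabulate λ _ → 0) v ≈ 1#
    zeros {zero}  v = refl
    zeros {suc k} v = trans (*-identityˡ _) (zeros (v ∘ suc))
  eval-unit (suc i) v = trans (*-identityˡ _) (eval-unit i (v ∘ suc))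

  eval-indicator : ∀ {k} (b : Fin k → Bool) v →
    eval (Vec.map (λ b → if b then 1 else 0) (tabulate b)) v ≈ product (λ i → if b i then v i else 1#)
  eval-indicator {zero}  b v = refl
  eval-indicator {suc k} b v with b zero
  ... | true  = *-cong (*-identityʳ _) (eval-indicator (b ∘ suc) (v ∘ suc))
  ... | false = *-congˡ (eval-indicator (b ∘ suc) (v ∘ suc))

  productList : ∀ {m} (f g : Fin m → Carrier) → (∀ i → f i ≈ g i) →
    List.foldr _*_ 1# (List.map f (List.allFin m)) ≈ product g
  productList {m} f g f≈g = trans (reflexive (≡.cong (List.foldr _*_ 1#) (ListP.map-tabulate (λ i → i) f))) (go f g f≈g)
    where
    go : ∀ {k} (f g : Fin k → Carrier) → (∀ i → f i ≈ g i) → List.foldr _*_ 1# (List.tabulate f) ≈ product g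
    go {zero}  f g h = refl
    go {suc k} f g h = *-cong (h zero) (go (f ∘ suc) (g ∘ suc) (h ∘ suc))

module Monomials where

  increment decrement : ∀ {m} → Fin m → Vec ℕ m → Vec ℕ m
  increment i β = Vec.updateAt β i suc
  decrement i β = Vec.updateAt β i ℕ.pred

  unit : ∀ {m} → Fin m → Vec ℕ m
  unit i = tabulate λ j → if does (i Fin.≟ j) then 1 else 0

  vec-ext : ∀ {A : Set} {m} {v w : Vec A m} → (∀ i → lookup v i ≡ lookup w i) → v ≡ w
  vec-ext {v = v} {w} h = ≡.trans (≡.sym (VecP.tabulate∘lookup v)) (≡.trans (VecP.tabulate-cong h) (VecP.tabulate∘lookup w))

  lookup-unit-same : ∀ {m} (i : Fin m) → lookup (unit i) i ≡ 1
  lookup-unit-same i with i Fin.≟ i | VecP.lookup∘tabulate (λ j → if does (i Fin.≟ j) then 1 else 0) i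
  ... | yes _  | eq = eq
  ... | no neq | _  = ⊥-elim (neq ≡.refl)

  lookup-unit-other : ∀ {m} {i j : Fin m} → i ≢ j → lookup (unit i) j ≡ 0
  lookup-unit-other {_} {i} {j} i≢j with i Fin.≟ j | VecP.lookup∘tabulate (λ j → if does (i Fin.≟ j) then 1 else 0) j
  ... | yes eq | _  = ⊥-elim (i≢j eq)
  ... | no _   | eq = eq

  zero-or-positive : ∀ {m} (β : Vec ℕ m) → β ≡ Vec.replicate m 0 ⊎ (∃ λ i → ∃ λ k → lookup β i ≡ suc k)
  zero-or-positive []          = inj₁ ≡.refl
  zero-or-positive (suc b ∷ β) = inj₂ (zero , b , ≡.refl)
  zero-or-positive (zero ∷ β) with zero-or-positive β
  ... | inj₁ eq           = inj₁ (≡.cong (0 ∷_) eq)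
  ... | inj₂ (i , k , eq) = inj₂ (suc i , k , eq)

  increment-decrement : ∀ {m} i {k} (β : Vec ℕ m) → lookup β i ≡ suc k → increment i (decrement i β) ≡ β
  increment-decrement i β eq = ≡.trans (VecP.updateAt-updateAt i β)
    (VecP.updateAt-id-local i β (≡.trans (≡.cong (λ b → suc (ℕ.pred b)) eq) (≡.sym eq)))

  decrement-increment : ∀ {m} i (β : Vec ℕ m) → decrement i (increment i β) ≡ β
  decrement-increment i β = ≡.trans (VecP.updateAt-updateAt i β) (VecP.updateAt-id i β)

  sum-increment : ∀ {m} i (β : Vec ℕ m) → Vec.sum (increment i β) ≡ suc (Vec.sum β)
  sum-increment zero    (b ∷ β) = ≡.refl
  sum-increment (suc i) (b ∷ β) = ≡.trans (≡.cong (b ℕ.+_) (sum-increment i β)) (ℕP.+-suc b (Vec.sum β))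

  unit-+ : ∀ {m} i (β : Vec ℕ m) → Vec.zipWith ℕ._+_ (unit i) β ≡ increment i β
  unit-+ i β = vec-ext λ j → ≡.trans (VecP.lookup-zipWith ℕ._+_ j (unit i) β) (entry j)
    where
    entry : ∀ j → lookup (unit i) j ℕ.+ lookup β j ≡ lookup (increment i β) j
    entry j with i Fin.≟ j
    ... | yes ≡.refl = ≡.trans (≡.cong (ℕ._+ lookup β i) (lookup-unit-same i)) (≡.sym (VecP.lookup∘updateAt i β))
    ... | no i≢j     = ≡.trans (≡.cong (ℕ._+ lookup β j) (lookup-unit-other i≢j))
                         (≡.sym (VecP.lookup∘updateAt′ j i (i≢j ∘ ≡.sym) β))

  decrement-+ : ∀ {m} i {k} (β γ : Vec ℕ m) → lookup β i ≡ suc k →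
    decrement i (Vec.zipWith ℕ._+_ β γ) ≡ Vec.zipWith ℕ._+_ (decrement i β) γ
  decrement-+ zero    (suc b ∷ β) (c ∷ γ) eq = ≡.refl
  decrement-+ (suc i) (b ∷ β)     (c ∷ γ) eq = ≡.cong (b ℕ.+ c ∷_) (decrement-+ i β γ eq)

  lookup-0 : ∀ m (i : Fin m) → lookup (Vec.replicate m 0) i ≡ 0
  lookup-0 m i = VecP.lookup-replicate i 0

-- Formal derivatives, degree and value at the origin

module PolynomialCalculus {c ℓ : Level} (K : CommutativeRing c ℓ) (invᴷ : ℕ → CommutativeRing.Carrier K)
  (invᴷ-inverse : ∀ k → CommutativeRing._≈_ K (CommutativeRing._*_ K (fromℕ K (suc k)) (invᴷ k)) (CommutativeRing.1# K)) where
  open CommutativeRing K hiding (zero)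
  open Poly K
  open PolynomialRing K
  open Monomials
  open IntegerSolver K hiding (con)
  open import Relation.Binary.Reasoning.Setoid setoid

  -- A term not containing the variable stays in the list: `decrement` stops at 0, and the factor
  -- `fromℕ K 0` makes its coefficient vanish.
  ∂ : ∀ {m} → Fin m → Pol m → Pol m
  ∂ i = List.map (λ t → (fromℕ K (lookup (proj₂ t) i) * proj₁ t , decrement i (proj₂ t)))

  -- The transpose of `∂ i` acting on functionals. It reduces identities between derivations to
  -- identities at single monomials.
  ∂ᵀ : ∀ {m} → Fin m → (Mono m → Carrier) → Mono m → Carrier
  ∂ᵀ i F β = fromℕ K (lookup β i) * F (decrement i β)

  pair-∂ : ∀ {m} i (p : Pol m) F → pair (∂ i p) F ≈ pair p (∂ᵀ i F)
  pair-∂ i []            F = refl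
  pair-∂ i ((a , β) ∷ p) F = +-cong
    (solve 3 (λ n a f → n :* a :* f := a :* (n :* f)) refl _ a _) (pair-∂ i p F)

  ∂-cong : ∀ {m} i (p q : Pol m) → p ≈ₚ q → ∂ i p ≈ₚ ∂ i q
  ∂-cong i p q h = ≈-from-pair (∂ i p) (∂ i q) λ F →
    trans (pair-∂ i p F) (trans (pair-respects-≈ p q h (∂ᵀ i F)) (sym (pair-∂ i q F)))

  ∂-+ : ∀ {m} i (p q : Pol m) → ∂ i (p +ₚ q) ≈ₚ (∂ i p +ₚ ∂ i q)
  ∂-+ i p q = ≈-from-pair (∂ i (p +ₚ q)) (∂ i p +ₚ ∂ i q) λ F → begin
    pair (∂ i (p +ₚ q)) F                         ≈⟨ trans (pair-∂ i (p +ₚ q) F) (pair-++ p q (∂ᵀ i F)) ⟩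
    pair p (∂ᵀ i F) + pair q (∂ᵀ i F)             ≈⟨ +-cong (pair-∂ i p F) (pair-∂ i q F) ⟨
    pair (∂ i p) F + pair (∂ i q) F               ≈⟨ pair-++ (∂ i p) (∂ i q) F ⟨
    pair (∂ i p +ₚ ∂ i q) F                       ∎

  fromℕ-+ : ∀ a b → fromℕ K (a ℕ.+ b) ≈ fromℕ K a + fromℕ K b
  fromℕ-+ zero    b = sym (+-identityˡ _)
  fromℕ-+ (suc a) b = trans (+-congˡ (fromℕ-+ a b)) (sym (+-assoc _ _ _))

  ∂ᵀ-⊕ : ∀ {m} i F (β γ : Mono m) → ∂ᵀ i F (β ⊕ γ) ≈
    fromℕ K (lookup β i) * F (decrement i β ⊕ γ) + fromℕ K (lookup γ i) * F (β ⊕ decrement i γ)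
  ∂ᵀ-⊕ i F β γ = begin
    fromℕ K (lookup (β ⊕ γ) i) * F (decrement i (β ⊕ γ))
      ≈⟨ *-congʳ (trans (reflexive (≡.cong (fromℕ K) (VecP.lookup-zipWith ℕ._+_ i β γ))) (fromℕ-+ (lookup β i) (lookup γ i))) ⟩
    (fromℕ K (lookup β i) + fromℕ K (lookup γ i)) * F (decrement i (β ⊕ γ))
      ≈⟨ distribʳ _ _ _ ⟩
    fromℕ K (lookup β i) * F (decrement i (β ⊕ γ)) + fromℕ K (lookup γ i) * F (decrement i (β ⊕ γ))
      ≈⟨ +-cong (shift (lookup β i) (decrement-+ i β γ)) (shift (lookup γ i) (λ eq →
           ≡.trans (≡.cong (decrement i) (⊕-comm β γ)) (≡.trans (decrement-+ i γ β eq) (⊕-comm (decrement i γ) β)))) ⟩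
    fromℕ K (lookup β i) * F (decrement i β ⊕ γ) + fromℕ K (lookup γ i) * F (β ⊕ decrement i γ) ∎
    where
    -- Decrementing a sum agrees with decrementing one summand only where that summand is positive;
    -- at exponent 0 the factor in front is 0 and the two values need not agree.
    shift : ∀ b {γ γ′} → (∀ {k} → b ≡ suc k → γ ≡ γ′) → fromℕ K b * F γ ≈ fromℕ K b * F γ′
    shift zero    h = trans (zeroˡ _) (sym (zeroˡ _))
    shift (suc b) h = *-congˡ (reflexive (≡.cong F (h ≡.refl)))

  ∂-* : ∀ {m} i (p q : Pol m) → ∂ i (p *ₚ q) ≈ₚ ((∂ i p *ₚ q) +ₚ (p *ₚ ∂ i q))
  ∂-* i p q = ≈-from-pair (∂ i (p *ₚ q)) ((∂ i p *ₚ q) +ₚ (p *ₚ ∂ i q)) λ F → begin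
    pair (∂ i (p *ₚ q)) F
      ≈⟨ trans (pair-∂ i (p *ₚ q) F) (pair-* p q (∂ᵀ i F)) ⟩
    pair p (λ β → pair q (λ γ → ∂ᵀ i F (β ⊕ γ)))
      ≈⟨ pair-cong p (λ β → trans (pair-cong q (∂ᵀ-⊕ i F β)) (trans (pair-+ q _ _) (+-congʳ (pair-scale q _ _)))) ⟩
    pair p (λ β → fromℕ K (lookup β i) * pair q (λ γ → F (decrement i β ⊕ γ)) + pair q (λ γ → fromℕ K (lookup γ i) * F (β ⊕ decrement i γ)))
      ≈⟨ pair-+ p _ _ ⟩
    pair p (∂ᵀ i (λ β → pair q (λ γ → F (β ⊕ γ)))) + pair p (λ β → pair q (∂ᵀ i (λ γ → F (β ⊕ γ))))
      ≈⟨ +-cong (pair-∂ i p _) (pair-cong p (λ β → pair-∂ i q _)) ⟨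
    pair (∂ i p) (λ β → pair q (λ γ → F (β ⊕ γ))) + pair p (λ β → pair (∂ i q) (λ γ → F (β ⊕ γ)))
      ≈⟨ +-cong (pair-* (∂ i p) q F) (pair-* p (∂ i q) F) ⟨
    pair (∂ i p *ₚ q) F + pair (p *ₚ ∂ i q) F
      ≈⟨ pair-++ (∂ i p *ₚ q) (p *ₚ ∂ i q) F ⟨
    pair ((∂ i p *ₚ q) +ₚ (p *ₚ ∂ i q)) F ∎

  ∂-comm : ∀ {m} i j (p : Pol m) → ∂ i (∂ j p) ≈ₚ ∂ j (∂ i p)
  ∂-comm i j p = ≈-from-pair (∂ i (∂ j p)) (∂ j (∂ i p)) λ F → begin
    pair (∂ i (∂ j p)) F          ≈⟨ trans (pair-∂ i (∂ j p) F) (pair-∂ j p _) ⟩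
    pair p (∂ᵀ j (∂ᵀ i F))        ≈⟨ pair-cong p (commute F) ⟩
    pair p (∂ᵀ i (∂ᵀ j F))        ≈⟨ trans (pair-∂ j (∂ i p) F) (pair-∂ i p _) ⟨
    pair (∂ j (∂ i p)) F          ∎
    where
    commute : ∀ F β → ∂ᵀ j (∂ᵀ i F) β ≈ ∂ᵀ i (∂ᵀ j F) β
    commute F β with i Fin.≟ j
    ... | yes ≡.refl = refl
    ... | no i≢j = begin
      fromℕ K (lookup β j) * (fromℕ K (lookup (decrement j β) i) * F (decrement i (decrement j β)))
        ≈⟨ *-congˡ (*-cong (reflexive (≡.cong (fromℕ K) (VecP.lookup∘updateAt′ i j i≢j β)))
             (reflexive (≡.cong F (VecP.updateAt-commutes i j i≢j β)))) ⟩
      fromℕ K (lookup β j) * (fromℕ K (lookup β i) * F (decrement j (decrement i β)))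
        ≈⟨ solve 3 (λ a b f → a :* (b :* f) := b :* (a :* f)) refl _ _ _ ⟩
      fromℕ K (lookup β i) * (fromℕ K (lookup β j) * F (decrement j (decrement i β)))
        ≈⟨ *-congˡ (*-congʳ (reflexive (≡.cong (fromℕ K) (VecP.lookup∘updateAt′ j i (i≢j ∘ ≡.sym) β)))) ⟨
      fromℕ K (lookup β i) * (fromℕ K (lookup (decrement i β) j) * F (decrement j (decrement i β))) ∎

  ∂-var-same : ∀ {m} (i : Fin m) → ∂ i (var i) ≈ₚ oneP
  ∂-var-same {m} i = ≈-from-pair (∂ i (var i)) oneP λ F → +-congʳ (*-cong
    (trans (*-identityʳ _) (trans (reflexive (≡.cong (fromℕ K) (lookup-unit-same i))) (+-identityʳ 1#)))
    (reflexive (≡.cong F lowered)))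
    where
    lowered : decrement i (unit i) ≡ zeroMono
    lowered = ≡.trans (≡.cong (decrement i) (≡.trans (≡.sym (≡.trans (⊕-comm (unit i) zeroMono) (⊕-identityˡ (unit i)))) (unit-+ i zeroMono)))
      (decrement-increment i zeroMono)

  ∂-single-0 : ∀ {m} i a (β : Mono m) → lookup β i ≡ 0 → ∂ i ((a , β) ∷ []) ≈ₚ []
  ∂-single-0 i a β eq = ≈-from-pair (∂ i ((a , β) ∷ [])) [] λ F →
    trans (+-identityʳ _) (trans (*-congʳ (trans (*-congʳ (reflexive (≡.cong (fromℕ K) eq))) (zeroˡ a))) (zeroˡ _))

  coeff-∂ : ∀ {m} i (p : Pol m) α → coeff (∂ i p) α ≈ fromℕ K (suc (lookup α i)) * coeff p (increment i α)
  coeff-∂ i p α = begin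
    coeff (∂ i p) α                                                   ≈⟨ trans (coeff-pair (∂ i p) α) (pair-∂ i p (dirac α)) ⟩
    pair p (∂ᵀ i (dirac α))                                           ≈⟨ pair-cong p entry ⟩
    pair p (λ β → fromℕ K (suc (lookup α i)) * dirac (increment i α) β)   ≈⟨ pair-scale p _ _ ⟩
    fromℕ K (suc (lookup α i)) * pair p (dirac (increment i α))           ≈⟨ *-congˡ (coeff-pair p (increment i α)) ⟨
    fromℕ K (suc (lookup α i)) * coeff p (increment i α)                  ∎
    where
    -- A decremented exponent equal to α does not force β to be the increment of α, because
    -- `decrement` fixes exponent 0; in that case the factor b is 0.
    unraised : ∀ β b → lookup β i ≡ b → β ≢ increment i α → fromℕ K b * dirac α (decrement i β) ≈ 0#
    unraised β zero    eq β≢ = zeroˡ _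
    unraised β (suc b) eq β≢ = trans (*-congˡ (dirac-other λ lowered →
      β≢ (≡.trans (≡.sym (increment-decrement i β eq)) (≡.cong (increment i) lowered)))) (zeroʳ _)
    entry : ∀ β → ∂ᵀ i (dirac α) β ≈ fromℕ K (suc (lookup α i)) * dirac (increment i α) β
    entry β = by-cases (VecP.≡-dec ℕ._≟_ β (increment i α))
      where
      by-cases : Dec (β ≡ increment i α) → ∂ᵀ i (dirac α) β ≈ fromℕ K (suc (lookup α i)) * dirac (increment i α) β
      by-cases (yes ≡.refl) = *-cong (reflexive (≡.cong (fromℕ K) (VecP.lookup∘updateAt i α)))
        (trans (reflexive (≡.cong (dirac α) (decrement-increment i α))) (trans (dirac-same α) (sym (dirac-same (increment i α)))))
      by-cases (no β≢) = trans (unraised β (lookup β i) ≡.refl β≢) (sym (trans (*-congˡ (dirac-other β≢)) (zeroʳ _)))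

  positive≢0 : ∀ {m} (β : Mono m) i {k} → lookup β i ≡ suc k → β ≢ zeroMono
  positive≢0 {m} β i eq ≡.refl with ≡.trans (≡.sym (lookup-0 m i)) eq
  ... | ()

  -- Natural exponents add up to 0 only if both are 0. This makes the constant term multiplicative.
  dirac-0-⊕ : ∀ {m} (β γ : Mono m) → dirac zeroMono (β ⊕ γ) ≈ dirac zeroMono β * dirac zeroMono γ
  dirac-0-⊕ {m} β γ with zero-or-positive β
  ... | inj₁ ≡.refl = trans (reflexive (≡.cong (dirac zeroMono) (⊕-identityˡ γ)))
          (sym (trans (*-congʳ (dirac-same (zeroMono {m}))) (*-identityˡ _)))
  ... | inj₂ (i , k , eq) = trans
          (dirac-other {α = zeroMono} {β ⊕ γ} (positive≢0 (β ⊕ γ) i (≡.trans (VecP.lookup-zipWith ℕ._+_ i β γ) (≡.cong (ℕ._+ lookup γ i) eq))))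
          (sym (trans (*-congʳ (dirac-other {α = zeroMono} {β} (positive≢0 β i eq))) (zeroˡ _)))

  coeff-0-* : ∀ {m} (p q : Pol m) → coeff (p *ₚ q) zeroMono ≈ coeff p zeroMono * coeff q zeroMono
  coeff-0-* p q = begin
    coeff (p *ₚ q) zeroMono                                           ≈⟨ trans (coeff-pair (p *ₚ q) zeroMono) (pair-* p q _) ⟩
    pair p (λ β → pair q (λ γ → dirac zeroMono (β ⊕ γ)))
      ≈⟨ pair-cong p (λ β → trans (pair-cong q (dirac-0-⊕ β)) (pair-scale q _ _)) ⟩
    pair p (λ β → dirac zeroMono β * pair q (dirac zeroMono))
      ≈⟨ trans (pair-cong p (λ β → *-comm _ _)) (pair-scale p _ _) ⟩
    pair q (dirac zeroMono) * pair p (dirac zeroMono)                 ≈⟨ *-cong (coeff-pair q zeroMono) (coeff-pair p zeroMono) ⟨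
    coeff q zeroMono * coeff p zeroMono                               ≈⟨ *-comm _ _ ⟩
    coeff p zeroMono * coeff q zeroMono                               ∎

  coeff-0-var : ∀ {m} (i : Fin m) → coeff (var i) zeroMono ≈ 0#
  coeff-0-var i = trans (coeff-pair (var i) zeroMono)
    (trans (pair-single 1# (unit i) (dirac zeroMono)) (trans (*-identityˡ _) (dirac-other {α = zeroMono} {unit i} (positive≢0 (unit i) i (lookup-unit-same i)))))

  -- A bound on coefficients and not on terms as in `DegLe`: `∂` leaves behind terms with
  -- coefficient 0 whose exponents have not dropped.
  Degree< : ∀ {m} → ℕ → Pol m → Set ℓ
  Degree< k p = ∀ α → k ≤ degM α → coeff p α ≈ 0#

  degree-bound : ∀ {m} (p : Pol m) → ∃ λ k → Degree< k p
  degree-bound []            = 0 , λ _ _ → refl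
  degree-bound ((a , β) ∷ p) = let k , h = degree-bound p in suc (degM β) ℕ.+ k , bound k h
    where
    bound : ∀ k → Degree< k p → Degree< (suc (degM β) ℕ.+ k) ((a , β) ∷ p)
    bound k h α le with VecP.≡-dec ℕ._≟_ β α
    ... | yes ≡.refl = ⊥-elim (ℕP.<-irrefl ≡.refl (ℕP.≤-trans (ℕP.m≤m+n (suc (degM β)) k) le))
    ... | no _       = h α (ℕP.≤-trans (ℕP.m≤n+m k (suc (degM β))) le)

  cancel-fromℕ : ∀ k {a} → fromℕ K (suc k) * a ≈ 0# → a ≈ 0#
  cancel-fromℕ k {a} h = begin
    a                                   ≈⟨ *-identityˡ a ⟨
    1# * a                              ≈⟨ *-congʳ (invᴷ-inverse k) ⟨
    fromℕ K (suc k) * invᴷ k * a        ≈⟨ solve 3 (λ n i a → n :* i :* a := i :* (n :* a)) refl _ _ _ ⟩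
    invᴷ k * (fromℕ K (suc k) * a)      ≈⟨ trans (*-congˡ h) (zeroʳ _) ⟩
    0#                                  ∎

  -- Every nonzero exponent vector is an increment of another one, at which some partial derivative
  -- has the wanted coefficient times a positive integer; that integer can be cancelled.
  constant-zero : ∀ {m} (p : Pol m) → (∀ i → ∂ i p ≈ₚ []) → coeff p zeroMono ≈ 0# → p ≈ₚ []
  constant-zero p h origin α with zero-or-positive α
  ... | inj₁ ≡.refl       = origin
  ... | inj₂ (i , k , eq) = trans (reflexive (≡.cong (coeff p) (≡.sym (increment-decrement i α eq))))
          (cancel-fromℕ (lookup (decrement i α) i) (trans (sym (coeff-∂ i p (decrement i α))) (h i (decrement i α))))

  pair-fromℕ : ∀ {m} k (F : Mono m → Carrier) → pair (fromℕ (polynomialRing m) k) F ≈ fromℕ K k * F zeroMono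
  pair-fromℕ zero    F = sym (zeroˡ _)
  pair-fromℕ {m} (suc k) F = trans (pair-++ oneP (fromℕ (polynomialRing m) k) F)
    (trans (+-cong (+-identityʳ _) (pair-fromℕ k F)) (sym (distribʳ _ _ _)))

  con-inverse : ∀ {m} k → (fromℕ (polynomialRing m) (suc k) *ₚ con (invᴷ k)) ≈ₚ oneP
  con-inverse {m} k = ≈-from-pair (fromℕ (polynomialRing m) (suc k) *ₚ con (invᴷ k)) oneP λ F → begin
    pair (fromℕ (polynomialRing m) (suc k) *ₚ con (invᴷ k)) F
      ≈⟨ trans (pair-* (fromℕ (polynomialRing m) (suc k)) (con (invᴷ k)) F) (pair-fromℕ (suc k) _) ⟩
    fromℕ K (suc k) * (invᴷ k * F (zeroMono ⊕ zeroMono) + 0#)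
      ≈⟨ solve 3 (λ n i f → n :* (i :* f :+ :0) := (n :* i) :* f :+ :0) refl _ _ _ ⟩
    fromℕ K (suc k) * invᴷ k * F (zeroMono ⊕ zeroMono) + 0#
      ≈⟨ +-congʳ (*-cong (invᴷ-inverse k) (reflexive (≡.cong F (⊕-identityˡ zeroMono)))) ⟩
    1# * F zeroMono + 0# ∎

  calculus : ∀ m → DifferentialPolynomials (polynomialRing m) m
  calculus m = record
    { x             = var
    ; ∂             = ∂
    ; ∂-cong        = λ i {p} {q} → ∂-cong i p q
    ; ∂-+           = ∂-+
    ; ∂-*           = ∂-*
    ; ∂-comm        = ∂-comm
    ; ∂-x-same      = ∂-var-same
    ; ∂-x-other     = λ {i} {j} i≢j → ∂-single-0 i 1# (unit j) (lookup-unit-other (i≢j ∘ ≡.sym))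
    ; inv           = λ k → con (invᴷ k)
    ; inv-inverse   = con-inverse
    ; Degree<       = Degree<
    ; degree-bound  = degree-bound
    ; degree-zero   = λ h α → h α z≤n
    ; degree-∂      = λ i {k} {p} h α le → trans (coeff-∂ i p α)
        (trans (*-congˡ (h (increment i α) (≡.subst (suc k ≤_) (≡.sym (sum-increment i α)) (s≤s le)))) (zeroʳ _))
    ; degree-minus  = λ {k} {p} {q} hp hq α le → trans (coeff-+ p (-ₚ q) α)
        (trans (+-cong (hp α le) (trans (coeff-neg q α) (-‿cong (hq α le)))) (-‿inverseʳ 0#))
    ; AtOrigin0     = λ p → coeff p zeroMono ≈ 0#
    ; origin-resp   = λ p≈q h → trans (sym (p≈q zeroMono)) h
    ; origin-0      = refl
    ; origin-+      = λ {p} {q} hp hq → trans (coeff-+ p q zeroMono) (trans (+-cong hp hq) (+-identityʳ 0#))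
    ; origin-*      = λ q {p} h → trans (coeff-0-* q p) (trans (*-congˡ h) (zeroʳ _))
    ; origin-x      = coeff-0-var
    ; constant-zero = λ {p} → constant-zero p
    }

-- Substitution and induction for concrete polynomials

module PolynomialSubstitution {c ℓ : Level} (K : CommutativeRing c ℓ) (invᴷ : ℕ → CommutativeRing.Carrier K)
  (invᴷ-inverse : ∀ k → CommutativeRing._≈_ K (CommutativeRing._*_ K (fromℕ K (suc k)) (invᴷ k)) (CommutativeRing.1# K)) where
  open CommutativeRing K hiding (zero)
  open Poly K
  open PolynomialRing K
  open PolynomialCalculus K invᴷ invᴷ-inverse
  open Monomials
  open IntegerSolver K hiding (con)
  open import Relation.Binary.Reasoning.Setoid setoid
  private
    module P {m : ℕ} = CommutativeRing (polynomialRing m)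
    module E {m : ℕ} = Evaluation (polynomialRing m)

  powP-^ : ∀ {m} (p : Pol m) k → powP p k ≡ Algebra.Properties.Semiring.Exp._^_ (P.semiring {m}) p k
  powP-^ p zero    = ≡.refl
  powP-^ p (suc k) = ≡.cong (p *ₚ_) (powP-^ p k)

  evalMono-eval : ∀ {k m} (β : Mono k) (v : Fin k → Pol m) → evalMono β v ≡ E.eval β v
  evalMono-eval []      v = ≡.refl
  evalMono-eval (b ∷ β) v = ≡.cong₂ _*ₚ_ (powP-^ (v zero) b) (evalMono-eval β (v ∘ suc))

  pair-subst : ∀ {k m} (p : Pol k) (v : Fin k → Pol m) F → pair (subst p v) F ≈ pair p (λ β → pair (E.eval β v) F)
  pair-subst []            v F = refl
  pair-subst ((a , β) ∷ p) v F = begin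
    pair ((con a *ₚ evalMono β v) +ₚ subst p v) F
      ≈⟨ pair-++ (con a *ₚ evalMono β v) (subst p v) F ⟩
    pair (con a *ₚ evalMono β v) F + pair (subst p v) F
      ≈⟨ +-cong (trans (pair-* (con a) (evalMono β v) F) (pair-single a zeroMono (λ β′ → pair (evalMono β v) (λ γ → F (β′ ⊕ γ))))) (pair-subst p v F) ⟩
    a * pair (evalMono β v) (λ γ → F (zeroMono ⊕ γ)) + pair p (λ β → pair (E.eval β v) F)
      ≈⟨ +-congʳ (*-congˡ (trans (pair-cong (evalMono β v) (λ γ → reflexive (≡.cong F (⊕-identityˡ γ))))
           (reflexive (≡.cong (λ q → pair q F) (evalMono-eval β v))))) ⟩
    a * pair (E.eval β v) F + pair p (λ β → pair (E.eval β v) F) ∎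

  subst-cong : ∀ {k m} (p q : Pol k) (v : Fin k → Pol m) → p ≈ₚ q → subst p v ≈ₚ subst q v
  subst-cong p q v h = ≈-from-pair (subst p v) (subst q v) λ F →
    trans (pair-subst p v F) (trans (pair-respects-≈ p q h _) (sym (pair-subst q v F)))

  subst-+ : ∀ {k m} (p q : Pol k) (v : Fin k → Pol m) → subst (p +ₚ q) v ≈ₚ (subst p v +ₚ subst q v)
  subst-+ p q v = ≈-from-pair (subst (p +ₚ q) v) (subst p v +ₚ subst q v) λ F → begin
    pair (subst (p +ₚ q) v) F               ≈⟨ trans (pair-subst (p +ₚ q) v F) (pair-++ p q _) ⟩
    pair p (λ β → pair (E.eval β v) F) + pair q (λ β → pair (E.eval β v) F)
                                            ≈⟨ +-cong (pair-subst p v F) (pair-subst q v F) ⟨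
    pair (subst p v) F + pair (subst q v) F ≈⟨ pair-++ (subst p v) (subst q v) F ⟨
    pair (subst p v +ₚ subst q v) F         ∎

  subst-* : ∀ {k m} (p q : Pol k) (v : Fin k → Pol m) → subst (p *ₚ q) v ≈ₚ (subst p v *ₚ subst q v)
  subst-* p q v = ≈-from-pair (subst (p *ₚ q) v) (subst p v *ₚ subst q v) λ F → begin
    pair (subst (p *ₚ q) v) F
      ≈⟨ trans (pair-subst (p *ₚ q) v F) (pair-* p q _) ⟩
    pair p (λ β → pair q (λ γ → pair (E.eval (β ⊕ γ) v) F))
      ≈⟨ pair-cong p (λ β → pair-cong q (λ γ → trans
           (pair-respects-≈ (E.eval (β ⊕ γ) v) (E.eval β v *ₚ E.eval γ v) (E.eval-+ β γ v) F)
           (pair-* (E.eval β v) (E.eval γ v) F))) ⟩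
    pair p (λ β → pair q (λ γ → pair (E.eval β v) (λ ρ → pair (E.eval γ v) (λ σ → F (ρ ⊕ σ)))))
      ≈⟨ pair-cong p (λ β → pair-swap q (E.eval β v) (λ γ ρ → pair (E.eval γ v) (λ σ → F (ρ ⊕ σ)))) ⟩
    pair p (λ β → pair (E.eval β v) (λ ρ → pair q (λ γ → pair (E.eval γ v) (λ σ → F (ρ ⊕ σ)))))
      ≈⟨ pair-cong p (λ β → pair-cong (E.eval β v) (λ ρ → pair-subst q v _)) ⟨
    pair p (λ β → pair (E.eval β v) (λ ρ → pair (subst q v) (λ σ → F (ρ ⊕ σ))))
      ≈⟨ trans (pair-* (subst p v) (subst q v) F) (pair-subst p v _) ⟨
    pair (subst p v *ₚ subst q v) F ∎

  subst-con : ∀ {k m} a (v : Fin k → Pol m) → subst (con {k} a) v ≈ₚ con a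
  subst-con {k} {m} a v = ≈-from-pair (subst (con {k} a) v) (con a) λ F → begin
    pair (subst (con {k} a) v) F                    ≈⟨ pair-subst (con {k} a) v F ⟩
    a * pair (E.eval (zeroMono {k}) v) F + 0#       ≈⟨ +-congʳ (*-congˡ (pair-respects-≈ (E.eval (zeroMono {k}) v) oneP (E.eval-0 k v) F)) ⟩
    a * (1# * F zeroMono + 0#) + 0#                 ≈⟨ solve 2 (λ a f → a :* (:1 :* f :+ :0) :+ :0 := a :* f :+ :0) refl a _ ⟩
    a * F zeroMono + 0#                             ∎

  subst-monoP : ∀ {k m} (β : Mono k) (v : Fin k → Pol m) → subst (monoP β) v ≈ₚ E.eval β v
  subst-monoP β v = ≈-from-pair (subst (monoP β) v) (E.eval β v) λ F →
    trans (pair-subst (monoP β) v F) (trans (+-identityʳ _) (*-identityˡ _))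

  subst-var : ∀ {k m} i (v : Fin k → Pol m) → subst (var i) v ≈ₚ v i
  subst-var i v α = trans (subst-monoP (unit i) v α) (E.eval-unit i v α)

  coeff-0-one : ∀ {m} → coeff (oneP {m}) zeroMono ≈ 1#
  coeff-0-one {m} = trans (coeff-pair (oneP {m}) zeroMono)
    (trans (pair-single 1# (zeroMono {m}) (dirac zeroMono)) (trans (*-identityˡ _) (dirac-same (zeroMono {m}))))

  coeff-0-eval : ∀ {k m} (β : Mono k) i {b} (v : Fin k → Pol m) → (∀ i → coeff (v i) zeroMono ≈ 0#) →
    lookup β i ≡ suc b → coeff (E.eval β v) zeroMono ≈ 0#
  coeff-0-eval {m = m} (suc b ∷ β) zero v h eq = trans (coeff-0-* (v zero *ₚ rest) (E.eval β (v ∘ suc)))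
    (trans (*-congʳ (trans (coeff-0-* (v zero) rest) (trans (*-congʳ (h zero)) (zeroˡ _)))) (zeroˡ _))
    where rest = Algebra.Properties.Semiring.Exp._^_ (P.semiring {m}) (v zero) b
  coeff-0-eval {m = m} (b ∷ β) (suc i) v h eq = trans (coeff-0-* rest (E.eval β (v ∘ suc)))
    (trans (*-congˡ (coeff-0-eval β i (v ∘ suc) (h ∘ suc) eq)) (zeroʳ _))
    where rest = Algebra.Properties.Semiring.Exp._^_ (P.semiring {m}) (v zero) b

  -- A nonconstant monomial in polynomials without constant term has no constant term either, so `p`
  -- and `subst p v` have the same value at the origin.
  origin-subst : ∀ {k m} (p : Pol k) (v : Fin k → Pol m) → (∀ i → coeff (v i) zeroMono ≈ 0#) →
    coeff (subst p v) zeroMono ≈ 0# → coeff p zeroMono ≈ 0#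
  origin-subst {k} {m} p v h vanish = begin
    coeff p zeroMono                                              ≈⟨ coeff-pair p zeroMono ⟩
    pair p (dirac zeroMono)                                       ≈⟨ pair-cong p entry ⟨
    pair p (λ β → pair (E.eval β v) (dirac zeroMono))             ≈⟨ pair-subst p v (dirac zeroMono) ⟨
    pair (subst p v) (dirac zeroMono)                             ≈⟨ coeff-pair (subst p v) zeroMono ⟨
    coeff (subst p v) zeroMono                                    ≈⟨ vanish ⟩
    0#                                                            ∎
    where
    entry : ∀ β → pair (E.eval β v) (dirac zeroMono) ≈ dirac zeroMono β
    entry β with zero-or-positive β
    ... | inj₁ ≡.refl = trans (sym (coeff-pair (E.eval β v) zeroMono))
            (trans (E.eval-0 k v zeroMono) (trans (coeff-0-one {m}) (sym (dirac-same (zeroMono {k})))))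
    ... | inj₂ (i , b , eq) = trans (sym (coeff-pair (E.eval β v) zeroMono))
            (trans (coeff-0-eval β i v h eq) (sym (dirac-other {α = zeroMono} {β} (positive≢0 β i eq))))

  module Induction {m : ℕ} (Q : Pol m → Set (c ⊔ ℓ)) (resp : ∀ p q → p ≈ₚ q → Q p → Q q)
    (Q-con : ∀ a → Q (con a)) (Q-var : ∀ i → Q (var i))
    (Q-+ : ∀ p q → Q p → Q q → Q (p +ₚ q)) (Q-* : ∀ p q → Q p → Q q → Q (p *ₚ q)) where

    -- One variable is split off at a time; the bound on the total degree is the recursion argument,
    -- since the decremented vector is not a subterm.
    monomials : ∀ k (β : Mono m) → degM β ≤ k → Q (monoP β)
    monomials k β le with zero-or-positive β
    ... | inj₁ ≡.refl = Q-con 1#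
    ... | inj₂ (i , b , eq) = descend k le
      where
      β′ = decrement i β
      size : suc (degM β′) ≡ degM β
      size = ≡.trans (≡.sym (sum-increment i β′)) (≡.cong Vec.sum (increment-decrement i β eq))
      split : (var i *ₚ monoP β′) ≈ₚ monoP β
      split = ≈-from-pair (var i *ₚ monoP β′) (monoP β) λ F →
        +-congʳ (*-cong (*-identityʳ 1#) (reflexive (≡.cong F (≡.trans (unit-+ i β′) (increment-decrement i β eq)))))
      descend : ∀ k → degM β ≤ k → Q (monoP β)
      descend zero    le with ≡.subst (_≤ 0) (≡.sym size) le
      ... | ()
      descend (suc k) le = resp _ _ split (Q-* (var i) (monoP β′) (Q-var i)
        (monomials k β′ (ℕP.≤-pred (≡.subst (_≤ suc k) (≡.sym size) le))))

    polynomials : ∀ p → Q p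
    polynomials []            = resp (con 0#) [] (≈-from-pair (con 0#) [] λ F → trans (+-identityʳ _) (zeroˡ _)) (Q-con 0#)
    polynomials ((a , β) ∷ p) = resp ((con a *ₚ monoP β) +ₚ p) ((a , β) ∷ p) split
      (Q-+ (con a *ₚ monoP β) p (Q-* (con a) (monoP β) (Q-con a) (monomials (degM β) β ℕP.≤-refl)) (polynomials p))
      where
      split : ((con a *ₚ monoP β) +ₚ p) ≈ₚ ((a , β) ∷ p)
      split = ≈-from-pair ((con a *ₚ monoP β) +ₚ p) ((a , β) ∷ p) λ F →
        +-congʳ (*-cong (*-identityʳ a) (reflexive (≡.cong F (⊕-identityˡ β))))

  algebras : PolynomialAlgebras c ℓ c
  algebras = record
    { A            = polynomialRing
    ; calculus     = calculus
    ; Scalar       = Carrier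
    ; con          = con
    ; subst        = subst
    ; ∂-con        = λ {m} i a → ∂-single-0 i a zeroMono (lookup-0 m i)
    ; subst-cong   = λ {_} {_} {p} {q} v → subst-cong p q v
    ; subst-+      = subst-+
    ; subst-*      = subst-*
    ; subst-0      = λ v α → refl
    ; subst-1      = λ v → subst-con 1# v
    ; subst-con    = subst-con
    ; subst-x      = subst-var
    ; origin-subst = origin-subst
    ; induction    = λ Q resp Q-con Q-var Q-+ Q-* → Induction.polynomials Q (λ p q → resp {p} {q}) Q-con Q-var
                       (λ p q → Q-+ {p} {q}) (λ p q → Q-* {p} {q})
    }

-- Ideals generated by a set of polynomials

module GeneratedIdeal {c ℓ : Level} (K : CommutativeRing c ℓ) {m : ℕ} (Gen : Poly.Pol K m → Set c) where
  open CommutativeRing K hiding (zero)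
  open Poly K
  open PolynomialRing K
  private
    module P = CommutativeRing (polynomialRing m)

  combination : List (Pol m × Pol m) → Pol m
  combination rs = sumP (List.map (λ rg → proj₁ rg *ₚ proj₂ rg) rs)

  combination-++ : ∀ rs rs′ → combination (rs ++ rs′) ≡ combination rs +ₚ combination rs′
  combination-++ []             rs′ = ≡.refl
  combination-++ ((r , g) ∷ rs) rs′ =
    ≡.trans (≡.cong ((r *ₚ g) ++_) (combination-++ rs rs′)) (≡.sym (ListP.++-assoc (r *ₚ g) (combination rs) (combination rs′)))

  scale : Pol m → Pol m × Pol m → Pol m × Pol m
  scale r (s , g) = r *ₚ s , g

  combination-scale : ∀ r rs → combination (List.map (scale r) rs) ≈ₚ (r *ₚ combination rs)
  combination-scale r []             α = sym (P.zeroʳ r α)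
  combination-scale r ((s , g) ∷ rs) α = trans
    (+ₚ-cong {p = (r *ₚ s) *ₚ g} {r *ₚ (s *ₚ g)} {combination (List.map (scale r) rs)} {r *ₚ combination rs}
      (*ₚ-assoc r s g) (combination-scale r rs) α)
    (sym (P.distribˡ r (s *ₚ g) (combination rs) α))

  generated : RingIdeal (polynomialRing m) (c ⊔ ℓ)
  generated = record
    { Member      = InIdeal Gen
    ; member-resp = λ { p≈q (rs , gens , eq) → rs , gens , λ α → trans (sym (p≈q α)) (eq α) }
    ; member-0    = [] , [] , λ α → refl
    ; member-+    = λ { {p} {q} (rs , gens , eq) (rs′ , gens′ , eq′) →
        rs ++ rs′ , AllP.++⁺ gens gens′ ,
        λ α → trans (+ₚ-cong {p = p} {combination rs} {q} {combination rs′} eq eq′ α)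
          (reflexive (≡.cong (λ t → coeff t α) (≡.sym (combination-++ rs rs′)))) }
    ; member-*    = λ { r {p} (rs , gens , eq) →
        List.map (scale r) rs , AllP.map⁺ gens ,
        λ α → trans (*ₚ-cong {p = r} {r} {p} {combination rs} (λ _ → refl) eq α) (sym (combination-scale r rs α)) }
    }

  generator : ∀ {g} → Gen g → InIdeal Gen g
  generator {g} h = (oneP , g) ∷ [] , h ∷ [] , λ α →
    sym (trans (P.+-identityʳ (oneP *ₚ g) α) (*ₚ-identityˡ g α))

  generated-least : (J : RingIdeal (polynomialRing m) (c ⊔ ℓ)) → (∀ g → Gen g → RingIdeal.Member J g) →
    ∀ {p} → InIdeal Gen p → RingIdeal.Member J p
  generated-least J h {p} (rs , gens , eq) = J.member-resp {combination rs} {p} (λ α → sym (eq α)) (go rs gens)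
    where
    module J = RingIdeal J
    go : ∀ rs → All (λ rg → Gen (proj₂ rg)) rs → J.Member (combination rs)
    go []             []           = J.member-0
    go ((r , g) ∷ rs) (gen ∷ gens) = J.member-+ {r *ₚ g} {combination rs} (J.member-* r {g} (h g gen)) (go rs gens)

-- The algebras of a graph and the filtered isomorphism

module Instance {c ℓ : Level} (K : CommutativeRing c ℓ) (invᴷ : ℕ → CommutativeRing.Carrier K)
  (invᴷ-inverse : ∀ k → CommutativeRing._≈_ K (CommutativeRing._*_ K (fromℕ K (suc k)) (invᴷ k)) (CommutativeRing.1# K))
  {n : ℕ} (G : SimpleGraph n) where
  open CommutativeRing K hiding (zero)
  open SimpleGraph G
  open Alg K G
  open PolynomialRing K
  open Monomials
  open PolynomialCalculus K invᴷ invᴷ-inverse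
  open PolynomialSubstitution K invᴷ invᴷ-inverse
  open Substitution algebras using (subst-identity)
  open Connectivity lo hi
  open GraphSigns (polynomialRing m) Fin._≟_ lo hi
  private
    module P = CommutativeRing (polynomialRing (suc n))
    module F = CommutativeRing (polynomialRing m)
    module E {k : ℕ} = Evaluation (polynomialRing k)
    module ^P = Algebra.Properties.Semiring.Exp P.semiring
  open Algebra.Properties.Monoid.Sum P.*-monoid using () renaming (sum to productᴾ)
  open Algebra.Properties.Monoid.Sum F.*-monoid using () renaming (sum to productᶠ)

  module Φᴵ = GeneratedIdeal K ΦGen
  module Dᴵ = GeneratedIdeal K DGen

  -- Substituting the variables for themselves changes nothing, and it turns the monomial into its
  -- evaluation, which is the product.
  monoP-product : ∀ {k} (b : Fin k → Bool) → monoP (indicator (tabulate b)) ≈ₚ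
    Algebra.Properties.Monoid.Sum.sum (CommutativeRing.*-monoid (polynomialRing k)) (λ i → if b i then var i else oneP)
  monoP-product b α = trans (sym (subst-identity (monoP (indicator (tabulate b))) α))
    (trans (subst-monoP (indicator (tabulate b)) var α) (E.eval-indicator b var α))

  closed-reach : ∀ {H : Subset m} {I : Fin (suc n) → Bool} → (∀ e → lookup H e ≡ false → I (lo e) ≡ I (hi e)) →
    ∀ {u v} → Reach G H u v → I u ≡ I v
  closed-reach h here           = ≡.refl
  closed-reach h (stepʳ e eq r) = ≡.trans (closed-reach h r) (h e eq)
  closed-reach h (stepˡ e eq r) = ≡.trans (closed-reach h r) (≡.sym (h e eq))

  xor-false : ∀ a b → a xor b ≡ false → a ≡ b
  xor-false true  true  _ = ≡.refl
  xor-false false false _ = ≡.refl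

  -- Once the edges of the cut are removed, `I` is constant along every walk, so a vertex inside
  -- cannot reach one outside.
  cut-not-slim : ∀ I → Proper I → ¬ Slim G (tabulate λ e → I (lo e) xor I (hi e))
  cut-not-slim I ((u , u∈) , (v , v∉)) slim
    with ≡.trans (≡.sym u∈) (≡.trans (closed-reach {I = I} uncut (slim u v)) v∉)
    where
    uncut : ∀ e → lookup (tabulate λ e → I (lo e) xor I (hi e)) e ≡ false → I (lo e) ≡ I (hi e)
    uncut e eq = xor-false (I (lo e)) (I (hi e)) (≡.trans (≡.sym (VecP.lookup∘tabulate _ e)) eq)
  ... | ()

  con-cie : ∀ i e → con (cie i e) ≈ₚ incidence i e
  con-cie i e with lo e Fin.≟ i | hi e Fin.≟ i
  ... | yes _ | _     = λ α → refl
  ... | no _  | yes _ = λ α → refl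
  ... | no _  | no _  = ≈-from-pair (con 0#) [] λ F → trans (+-identityʳ _) (zeroˡ _)

  Y-product : ∀ i → Y i ≈ₚ productᶠ (λ e → oneP +ₚ (incidence i e *ₚ var e))
  Y-product i = E.productList _ (λ e → oneP +ₚ (incidence i e *ₚ var e)) λ e →
    +ₚ-cong {p = oneP} {oneP} {con (cie i e) *ₚ var e} {incidence i e *ₚ var e} (λ _ → refl)
      (*ₚ-cong {p = con (cie i e)} {incidence i e} {var e} {var e} (con-cie i e) (λ _ → refl))

  coeff-multiple : ∀ {k} (r : Pol k) a (γ α : Mono k) → (∀ β → β ⊕ γ ≢ α) → coeff (r *ₚ ((a , γ) ∷ [])) α ≈ 0#
  coeff-multiple r a γ α h = trans (coeff-pair (r *ₚ ((a , γ) ∷ [])) α) (trans (pair-* r ((a , γ) ∷ []) (dirac α))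
    (trans (pair-cong r (λ β → trans (pair-single a γ (λ γ → dirac α (β ⊕ γ))) (trans (*-congˡ (dirac-other {α = α} {β ⊕ γ} (h β))) (zeroʳ a)))) (pair-0 r)))

  lookup-indicator : ∀ {k} (H : Subset k) e → lookup (indicator H) e ≡ (if lookup H e then 1 else 0)
  lookup-indicator H e = VecP.lookup-map e _ H

  slim-monotone : ∀ {H T : Subset m} → (∀ e → lookup T e ≡ false → lookup H e ≡ false) → Slim G T → Slim G H
  slim-monotone {H} {T} sub slim u v = go (slim u v)
    where
    go : ∀ {v} → Reach G T u v → Reach G H u v
    go here           = here
    go (stepʳ e eq r) = stepʳ e (sub e eq) (go r)
    go (stepˡ e eq r) = stepˡ e (sub e eq) (go r)

  -- The monomial of T is squarefree, so no φ_e² divides it. If the monomial of a non-slim H divided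
  -- it, H would be a subset of T, but subsets of slim sets are slim.
  generator-coeff : ∀ r g → ΦGen g → ∀ T → Slim G T → coeff (r *ₚ g) (indicator T) ≈ 0#
  generator-coeff r g (inj₁ (e , ≡.refl)) T slim = coeff-multiple r (1# * 1#) (unit e ⊕ unit e) (indicator T) impossible
    where
    bit : ∀ b k → k ℕ.+ 2 ≢ (if b then 1 else 0)
    bit true  (suc k) eq with ≡.trans (≡.sym (ℕP.+-comm k 2)) (ℕP.suc-injective eq)
    ... | ()
    bit false (suc k) ()
    impossible : ∀ β → β ⊕ (unit e ⊕ unit e) ≢ indicator T
    impossible β eq = bit (lookup T e) (lookup β e) (≡.trans (≡.sym (≡.trans (VecP.lookup-zipWith ℕ._+_ e β (unit e ⊕ unit e))
      (≡.cong (lookup β e ℕ.+_) (≡.trans (VecP.lookup-zipWith ℕ._+_ e (unit e) (unit e)) (≡.cong₂ ℕ._+_ (lookup-unit-same e) (lookup-unit-same e))))))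
      (≡.trans (≡.cong (λ β → lookup β e) eq) (lookup-indicator T e)))
  generator-coeff r g (inj₂ (H , ¬slim , ≡.refl)) T slim =
    coeff-multiple r 1# (indicator H) (indicator T) λ β eq → ¬slim (slim-monotone (sub β eq) slim)
    where
    bits : ∀ h k → k ℕ.+ (if h then 1 else 0) ≡ 0 → h ≡ false
    bits false k       _  = ≡.refl
    bits true  (suc k) ()
    sub : ∀ β → β ⊕ indicator H ≡ indicator T → ∀ e → lookup T e ≡ false → lookup H e ≡ false
    sub β eq e e∉T = bits (lookup H e) (lookup β e) (≡.trans
      (≡.sym (≡.trans (VecP.lookup-zipWith ℕ._+_ e β (indicator H)) (≡.cong (lookup β e ℕ.+_) (lookup-indicator H e))))
      (≡.trans (≡.cong (λ β → lookup β e) eq) (≡.trans (lookup-indicator T e) (≡.cong (λ b → if b then 1 else 0) e∉T))))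

  slim-coeff : ∀ g → InIdeal ΦGen g → ∀ T → Slim G T → coeff g (indicator T) ≈ 0#
  slim-coeff g (rs , gens , eq) T slim = trans (eq (indicator T)) (go rs gens)
    where
    go : ∀ rs → All (λ rg → ΦGen (proj₂ rg)) rs → coeff (Φᴵ.combination rs) (indicator T) ≈ 0#
    go []             []           = refl
    go ((r , g) ∷ rs) (gen ∷ gens) = trans (coeff-+ (r *ₚ g) (Φᴵ.combination rs) (indicator T))
      (trans (+-cong (generator-coeff r g gen T slim) (go rs gens)) (+-identityʳ 0#))

  insert : Fin m → (Fin m → Bool) → Fin m → Bool
  insert e T f = does (e Fin.≟ f) ∨ T f

  insert-other : ∀ {e f} T → e ≢ f → insert e T f ≡ T f
  insert-other {e} {f} T e≢f with e Fin.≟ f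
  ... | yes eq = ⊥-elim (e≢f eq)
  ... | no _   = ≡.refl

  indicator-insert : ∀ e T → T e ≡ false → increment e (indicator (tabulate T)) ≡ indicator (tabulate (insert e T))
  indicator-insert e T e∉T = vec-ext λ f → ≡.trans (entry f (e Fin.≟ f)) (≡.sym (bit (insert e T) f))
    where
    bit : ∀ T f → lookup (indicator (tabulate T)) f ≡ (if T f then 1 else 0)
    bit T f = ≡.trans (lookup-indicator (tabulate T) f) (≡.cong (λ b → if b then 1 else 0) (VecP.lookup∘tabulate T f))
    entry : ∀ f → Dec (e ≡ f) → lookup (increment e (indicator (tabulate T))) f ≡ (if insert e T f then 1 else 0)
    entry f (yes ≡.refl) with e Fin.≟ e
    ... | no neq = ⊥-elim (neq ≡.refl)
    ... | yes _  = ≡.trans (VecP.lookup∘updateAt e (indicator (tabulate T)))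
                     (≡.cong suc (≡.trans (bit T e) (≡.cong (λ b → if b then 1 else 0) e∉T)))
    entry f (no e≢f) = ≡.trans (VecP.lookup∘updateAt′ f e (e≢f ∘ ≡.sym) (indicator (tabulate T)))
      (≡.trans (bit T f) (≡.cong (λ b → if b then 1 else 0) (≡.sym (insert-other T e≢f))))

  -- S is the set of edges that have been differentiated away, C the set of edges that have been kept.
  coeff-vanishing : ∀ C L (S : Fin m → Bool) g → Unique L → (∀ {e} → e ∈ L → e ∉ C) →
    (∀ {e} → e ∈ C → S e ≡ false) → (∀ {e} → e ∈ L → S e ≡ false) →
    (∀ T → (∀ {e} → T e ≡ true → e ∈ L) → Slim G (tabulate λ e → S e ∨ T e) → coeff g (indicator (tabulate T)) ≈ 0#) →
    Vanishing ∂ (λ g → coeff g zeroMono ≈ 0#) C L g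
  coeff-vanishing C [] S g _ _ C∌S _ h conn =
    trans (reflexive (≡.cong (coeff g) (vec-ext λ e → ≡.trans (lookup-0 m e)
      (≡.sym (≡.trans (lookup-indicator (tabulate λ _ → false) e) (≡.cong (λ b → if b then 1 else 0) (VecP.lookup∘tabulate (λ _ → false) e)))))))
      (h (λ _ → false) (λ ()) λ u v → reach (conn u v))
    where
    reach : ∀ {u v} → Path C u v → Reach G (tabulate λ e → S e ∨ false) u v
    reach stay               = here
    reach (up {e} e∈ path)   = stepʳ e (≡.trans (VecP.lookup∘tabulate _ e) (≡.cong (_∨ false) (C∌S e∈))) (reach path)
    reach (down {e} e∈ path) = stepˡ e (≡.trans (VecP.lookup∘tabulate _ e) (≡.cong (_∨ false) (C∌S e∈))) (reach path)
  coeff-vanishing C (e ∷ L) S g (e∉L ∷ unique) disjoint C∌S L∌S h =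
    coeff-vanishing C L (insert e S) (∂ e g) unique (disjoint ∘ there)
      (λ {f} f∈C → ≡.trans (insert-other {e} {f} S (λ { ≡.refl → disjoint (here ≡.refl) f∈C })) (C∌S f∈C))
      (λ {f} f∈L → ≡.trans (insert-other S (All.lookup e∉L f∈L)) (L∌S (there f∈L)))
      deleted ,
    coeff-vanishing (e ∷ C) L S g unique
      (λ { f∈L (here ≡.refl) → All.lookup e∉L f∈L ≡.refl ; f∈L (there f∈C) → disjoint (there f∈L) f∈C })
      (λ { (here ≡.refl) → L∌S (here ≡.refl) ; (there f∈C) → C∌S f∈C })
      (L∌S ∘ there) (λ T T⊆L → h T (there ∘ T⊆L))
    where
    deleted : ∀ T → (∀ {f} → T f ≡ true → f ∈ L) → Slim G (tabulate λ f → insert e S f ∨ T f) →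
      coeff (∂ e g) (indicator (tabulate T)) ≈ 0#
    -- The coefficient of ∂ e g at T is a multiple of that of g at T with `e` added. Moving `e` from
    -- the differentiated set to T leaves the union of the two sets unchanged, so the slimness
    -- hypothesis carries over.
    deleted T T⊆L slim = trans (coeff-∂ e g (indicator (tabulate T)))
      (trans (*-congˡ (trans (reflexive (≡.cong (coeff g) (indicator-insert e T e∉T)))
        (h (insert e T) supported (≡.subst (Slim G) (VecP.tabulate-cong swap) slim)))) (zeroʳ _))
      where
      e∉T : T e ≡ false
      e∉T with T e in eq
      ... | false = ≡.refl
      ... | true  = ⊥-elim (All.lookup e∉L (T⊆L eq) ≡.refl)
      supported : ∀ {f} → insert e T f ≡ true → f ∈ e ∷ L
      supported {f} eq with e Fin.≟ f
      ... | yes ≡.refl = here ≡.refl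
      ... | no _       = there (T⊆L eq)
      swap : ∀ f → insert e S f ∨ T f ≡ S f ∨ insert e T f
      swap f = ≡.trans (≡.cong (_∨ T f) (∨-comm (does (e Fin.≟ f)) (S f))) (∨-assoc (S f) _ (T f))

  Φ-vanishing : ∀ {g} → InIdeal ΦGen g → Vanishing ∂ (λ g → coeff g zeroMono ≈ 0#) [] (allFin m) g
  Φ-vanishing {g} g∈ = coeff-vanishing [] (allFin m) (λ _ → false) g (UniqueP.allFin⁺ m) (λ _ ()) (λ ()) (λ _ → ≡.refl)
    (λ T _ → slim-coeff g g∈ (tabulate T))

  monomial : (Fin (suc n) → Bool) → Pol (suc n)
  monomial I = productᴾ (λ i → if I i then var i else oneP)

  minus-one-cong : ∀ {p q : Pol (suc n)} → p ≈ₚ q → (p -ₚ oneP) ≈ₚ (q -ₚ oneP)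
  minus-one-cong {p} {q} p≈q = +ₚ-cong {p = p} {q} { -ₚ oneP} { -ₚ oneP} p≈q (λ _ → refl)

  generator-power : ∀ (I : Fin (suc n) → Bool) d →
    powP (monoP (indicator (tabulate I)) -ₚ oneP) d ≈ₚ ((monomial I -ₚ oneP) ^P.^ d)
  generator-power I d α = trans (reflexive (≡.cong (λ p → coeff p α) (powP-^ (monoP (indicator (tabulate I)) -ₚ oneP) d)))
    (^P.^-congˡ d {monoP (indicator (tabulate I)) -ₚ oneP} {monomial I -ₚ oneP}
      (minus-one-cong {monoP (indicator (tabulate I))} {monomial I} (monoP-product I)) α)

  cut-tabulate : ∀ I → cut G (tabulate I) ≡ cutSize (allFin m) I
  cut-tabulate I = ≡.cong NL.sum (ListP.map-cong (λ e → ≡.cong (if_then 1 else 0)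
    (≡.cong₂ _xor_ (VecP.lookup∘tabulate I (lo e)) (VecP.lookup∘tabulate I (hi e)))) (allFin m))

  ⊤-tabulate : ⊤ ≡ tabulate {n = suc n} (λ _ → true)
  ⊤-tabulate = vec-ext λ i → ≡.trans (VecP.lookup-replicate i true) (≡.sym (VecP.lookup∘tabulate (λ _ → true) i))

  D-cut : ∀ I → Proper I → InIdeal DGen ((monomial I -ₚ oneP) ^P.^ cutSize (allFin m) I)
  D-cut I ((u , u∈) , (v , v∉)) = RingIdeal.member-resp Dᴵ.generated {generator} {(monomial I -ₚ oneP) ^P.^ cutSize (allFin m) I}
    (λ α → trans (generator-power I (cut G (tabulate I)) α)
      (reflexive (≡.cong (λ d → coeff ((monomial I -ₚ oneP) ^P.^ d) α) (cut-tabulate I))))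
    (Dᴵ.generator (inj₁ (tabulate I , nonempty , proper , ≡.refl)))
    where
    generator = powP (monoP (indicator (tabulate I)) -ₚ oneP) (cut G (tabulate I))
    nonempty : Nonempty (tabulate I)
    nonempty = u , VecP.lookup⇒[]= u (tabulate I) (≡.trans (VecP.lookup∘tabulate I u) u∈)
    proper : tabulate I ≢ ⊤
    proper eq with ≡.trans (≡.sym v∉) (≡.trans (≡.sym (VecP.lookup∘tabulate I v))
      (≡.trans (≡.cong (λ H → lookup H v) eq) (VecP.lookup-replicate v true)))
    ... | ()

  total-generator : (monoP (indicator (⊤ {suc n})) -ₚ oneP) ≈ₚ (monomial (λ _ → true) -ₚ oneP)
  total-generator = minus-one-cong {monoP (indicator (⊤ {suc n}))} {monomial (λ _ → true)}
    (≡.subst (λ H → monoP (indicator H) ≈ₚ monomial (λ _ → true)) (≡.sym ⊤-tabulate) (monoP-product (λ _ → true)))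

  D-least : (J : RingIdeal (polynomialRing (suc n)) (c ⊔ ℓ)) →
    (∀ I → Proper I → RingIdeal.Member J ((monomial I -ₚ oneP) ^P.^ cutSize (allFin m) I)) →
    RingIdeal.Member J (monomial (λ _ → true) -ₚ oneP) →
    ∀ {p} → InIdeal DGen p → RingIdeal.Member J p
  D-least J h-cut h-total {p} = Dᴵ.generated-least J generators {p}
    where
    generators : ∀ g → DGen g → RingIdeal.Member J g
    generators g (inj₂ ≡.refl) = RingIdeal.member-resp J {monomial (λ _ → true) -ₚ oneP} {g} (λ α → sym (total-generator α)) h-total
    generators g (inj₁ (I , (u , u∈) , I≢⊤ , ≡.refl)) with FinP.any? (λ v → lookup I v Bool.≟ false)
    ... | yes (v , v∉) = RingIdeal.member-resp J {(monomial (lookup I) -ₚ oneP) ^P.^ cut G I} {g}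
      (λ α → trans (sym (generator-power (lookup I) (cut G I) α))
        (reflexive (≡.cong (λ H → coeff (powP (monoP (indicator H) -ₚ oneP) (cut G I)) α) (VecP.tabulate∘lookup I))))
      (h-cut (lookup I) ((u , VecP.[]=⇒lookup u∈) , (v , v∉)))
    ... | no none = ⊥-elim (I≢⊤ (vec-ext λ v → ≡.trans (all-true v) (≡.sym (VecP.lookup-replicate v true))))
      where
      all-true : ∀ v → lookup I v ≡ true
      all-true v with lookup I v in eq
      ... | true  = ≡.refl
      ... | false = ⊥-elim (none (v , eq))

  ideals : GraphIdeals algebras lo hi
  ideals = record
    { lo≢hi       = λ e → FinP.<⇒≢ (lo<hi e)
    ; Y           = Y
    ; Y-product   = Y-product
    ; Φ           = Φᴵ.generated
    ; Φ-square    = λ e → Φᴵ.generator (inj₁ (e , ≡.refl))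
    ; Φ-cut       = λ I prop → RingIdeal.member-resp Φᴵ.generated
        {monoP (indicator (tabulate λ e → I (lo e) xor I (hi e)))}
        {productᶠ (λ e → if I (lo e) xor I (hi e) then var e else oneP)}
        (monoP-product (λ e → I (lo e) xor I (hi e)))
        (Φᴵ.generator (inj₂ (_ , cut-not-slim I prop , ≡.refl)))
    ; Φ-vanishing = λ {g} → Φ-vanishing {g}
    ; D           = Dᴵ.generated
    ; D-cut       = D-cut
    ; D-total     = RingIdeal.member-resp Dᴵ.generated {monoP (indicator (⊤ {suc n})) -ₚ oneP} {monomial (λ _ → true) -ₚ oneP}
        total-generator (Dᴵ.generator (inj₂ ≡.refl))
    ; D-least     = λ J h-cut h-total {p} → D-least J h-cut h-total {p}
    }

  open Comparison algebras lo hi ideals using (D⊆preimage; preimage⊆D)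

  ≈⇒≈Φ : ∀ p q → p ≈ₚ q → p ≈Φ q
  ≈⇒≈Φ p q = Quotient.≈⇒~ (polynomialRing m) Φᴵ.generated {p} {q}

  difference : ∀ p q → subst (p -ₚ q) Y ≈ₚ (subst p Y -ₚ subst q Y)
  difference p q = Substitution.subst-minus algebras p q Y

  wellDefined : ∀ p q → p ≈D q → subst p Y ≈Φ subst q Y
  wellDefined p q p≈q = RingIdeal.member-resp Φᴵ.generated {subst (p -ₚ q) Y} {subst p Y -ₚ subst q Y}
    (difference p q) (D⊆preimage {p -ₚ q} p≈q)

  -- Elements of both filtered pieces are represented by polynomials of bounded degree in the
  -- generators, and the map keeps the representing polynomial. The filtration therefore asks for
  -- nothing beyond well-definedness, and surjectivity is part of the definition of the subalgebra.
  filteredIso : FilteredIso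
  filteredIso = record
    { f         = λ p → subst p Y
    ; wellDef   = wellDefined
    ; into      = λ p → p , ≈⇒≈Φ (subst p Y) (subst p Y) (λ _ → refl)
    ; pres-+    = λ p q → ≈⇒≈Φ (subst (p +ₚ q) Y) (subst p Y +ₚ subst q Y) (subst-+ p q Y)
    ; pres-*    = λ p q → ≈⇒≈Φ (subst (p *ₚ q) Y) (subst p Y *ₚ subst q Y) (subst-* p q Y)
    ; pres-con  = λ a → ≈⇒≈Φ (subst (con a) Y) (con a) (subst-con a Y)
    ; inj       = λ p q h → preimage⊆D (p -ₚ q) (RingIdeal.member-resp Φᴵ.generated
        {subst p Y -ₚ subst q Y} {subst (p -ₚ q) Y} (λ α → sym (difference p q α)) h)
    ; surj      = λ x (P , x≈P) → P , Quotient.~-sym (polynomialRing m) Φᴵ.generated {x} {subst P Y} x≈P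
    ; filt      = λ k p (q , deg , p≈q) → q , deg , wellDefined p q p≈q
    ; filt-onto = λ k x (P , deg , x≈P) →
        P , (P , deg , Quotient.≈⇒~ (polynomialRing (suc n)) Dᴵ.generated {P} {P} (λ _ → refl)) ,
        Quotient.~-sym (polynomialRing m) Φᴵ.generated {x} {subst P Y} x≈P
    }

theorem9 : ∀ {c ℓ : Level} (K : CommutativeRing c ℓ) → IsField K → CharZero K →
    (n : ℕ) (G : SimpleGraph n) → Alg.FilteredIsomorphic K G
theorem9 K (_ , inverse) char0 n G = Instance.filteredIso K (λ k → proj₁ (reciprocal k)) (λ k → proj₂ (reciprocal k)) G
  where
  open CommutativeRing K
  reciprocal : ∀ k → ∃ λ y → (fromℕ K (suc k) * y) ≈ 1#
  reciprocal k = inverse (fromℕ K (suc k)) (λ eq → ℕP.1+n≢0 (char0 (suc k) eq))
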